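{- Let $t \ge 1$ be an integer. If $M$ is a simple rank-$r$ matroid with no $(t+1)$-claw, then $|E(M)| \ge f(r,t)$. If equality holds, then either (i) $M \cong M_{r,t}$, or (ii) $t < r < 2t$ and $M$ is the direct sum of coloops and exactly $r-t$ circuits, not all of which are triangles.
   Context: A claw of a matroid $M$ is a set that is both a flat and an independent set of $M$; a $k$-claw is a claw of size $k$. A triangle is a $3$-element circuit. For integers $r \ge 0$, $t \ge 1$, $M_{r,t}$ denotes the direct sum of $t$ (possibly empty, i.e. rank-$0$) binary projective geometries whose ranks sum to $r$ and pairwise differ by at most $1$, and $f(r,t) = |E(M_{r,t})|$; explicitly $f(r,t) = (t-a)2^{\lfloor r/t\rfloor} + a2^{\lceil r/t \rceil} - t$ where $a \in \{0,\dots,t-1\}$ and $a \equiv r \pmod t$. -}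

module Defs where

open import Data.Bool.Base using (Bool; true; false; _xor_)
open import Data.Bool.Properties using (xor-assoc; xor-comm; xor-identityʳ; xor-same)
  renaming (_≟_ to _≟ᵇ_)
open import Data.Fin.Base using (Fin; zero; suc; _↑ˡ_; _↑ʳ_; combine; remQuot; toℕ)
open import Data.Fin.Permutation using (Permutation; _⟨$⟩ˡ_)
open import Data.Fin.Properties
  using (any?; pigeonhole; remQuot-combine; combine-remQuot)
open import Data.Fin.Subset
  using (Subset; _∈_; _∉_; _⊆_; _⊂_; _∪_; ⊤; ⊥; ⁅_⁆; ∣_∣)
open import Data.Fin.Subset.Properties
open import Data.List.Base as List using (List; []; _∷_; length; filter; foldr; map; replicate)
open import Data.List.Extrema.Nat using (max)
open import Data.List.Membership.Propositional using () renaming (_∈_ to _∈ˡ_)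
open import Data.List.Properties
  using (length-++; length-map; length-replicate; map-++; map-replicate;
         filter-++; filter-all)
open import Data.List.Relation.Unary.All as All using (All)
open import Data.List.Relation.Unary.All.Properties using (replicate⁺; map⁺; ++⁺)
open import Data.Nat.Base
open import Data.Nat.DivMod using (_/_; _%_; m≡m%n+[m/n]*n; m%n<n)
open import Data.Nat.ListAction using (sum)
open import Data.Nat.ListAction.Properties using (sum-++)
open import Data.Nat.Properties
open import Data.Product.Base using (Σ; ∃; _×_; _,_; proj₁; proj₂)
open import Data.Sum.Base using (_⊎_; inj₁; inj₂)
open import Data.Vec.Base as Vec using (Vec; []; _∷_; take; drop; lookup; tabulate; zipWith; here; there)
open import Data.Vec.Properties
  using (≡-dec; take-zipWith; drop-zipWith; zipWith-assoc; zipWith-comm;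
         zipWith-identityˡ; zipWith-identityʳ)
open import Function.Base using (_∘_)
open import Function.Bundles using (_⇔_)
open import Relation.Binary.Definitions using (DecidableEquality)
open import Relation.Binary.PropositionalEquality
open import Relation.Nullary.Decidable using (yes; no; ¬?; _×-dec_; decidable-stable)
open import Relation.Nullary.Negation using (¬_; contradiction)
open import Relation.Unary using (Decidable)

-- The ground set is Fin size.  Indep? is automatic classically; it makes the
-- family of independent sets an honest finite family of finite sets.
record Matroid : Set₁ where
  field
    size    : ℕ
    Indep   : Subset size → Set
    Indep?  : Decidable Indep
    ⊥-indep : Indep ⊥
    ⊆-indep : ∀ {I J} → I ⊆ J → Indep J → Indep I
    augment : ∀ {I J} → Indep I → Indep J → ∣ I ∣ < ∣ J ∣ →
              ∃ λ e → e ∈ J × e ∉ I × Indep (I ∪ ⁅ e ⁆)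

open Matroid public

bitVectors : ∀ n → List (Vec Bool n)
bitVectors zero    = [] ∷ []
bitVectors (suc n) = map (false ∷_) (bitVectors n) List.++ map (true ∷_) (bitVectors n)

subsets : ∀ n → List (Subset n)
subsets = bitVectors

rankOf : (M : Matroid) → Subset (size M) → ℕ
rankOf M X =
  max 0 (map ∣_∣ (filter (λ I → (I ⊆? X) ×-dec Indep? M I) (subsets (size M))))

rank : Matroid → ℕ
rank M = rankOf M ⊤

IsFlat : (M : Matroid) → Subset (size M) → Set
IsFlat M F = ∀ e → e ∉ F → rankOf M F < rankOf M (F ∪ ⁅ e ⁆)

IsCircuit : (M : Matroid) → Subset (size M) → Set
IsCircuit M C = ¬ Indep M C × (∀ {D} → D ⊂ C → Indep M D)

-- Loops are the circuits of size 1 and parallel pairs those of size 2;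
-- the empty set is never a circuit.
IsSimple : Matroid → Set
IsSimple M = ∀ C → IsCircuit M C → 3 ≤ ∣ C ∣

IsClaw : (M : Matroid) → Subset (size M) → Set
IsClaw M S = IsFlat M S × Indep M S

HasClaw : Matroid → ℕ → Set
HasClaw M k = ∃ λ S → IsClaw M S × ∣ S ∣ ≡ k

image : ∀ {m n} → Permutation m n → Subset m → Subset n
image π I = tabulate (λ j → lookup I (π ⟨$⟩ˡ j))

infix 4 _≅_

_≅_ : Matroid → Matroid → Set
M ≅ N = Σ (Permutation (size M) (size N)) λ π → ∀ I → Indep M I ⇔ Indep N (image π I)

module SubsetLemmas where
  ∃-∈-∉ : ∀ {n} {I J : Subset n} → ∣ I ∣ < ∣ J ∣ → ∃ λ e → e ∈ J × e ∉ I
  ∃-∈-∉ {I = I} {J} I<J with any? (λ e → (e ∈? J) ×-dec ¬? (e ∈? I))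
  ... | yes p = p
  ... | no ¬p = contradiction I<J (≤⇒≯ (p⊆q⇒∣p∣≤∣q∣ J⊆I))
    where
    J⊆I : J ⊆ I
    J⊆I {x} x∈J = decidable-stable (x ∈? I) λ x∉I → ¬p (x , x∈J , x∉I)

  ∣p∪⁅e⁆∣≤ : ∀ {n} (p : Subset n) e → ∣ p ∪ ⁅ e ⁆ ∣ ≤ suc ∣ p ∣
  ∣p∪⁅e⁆∣≤ (true ∷ p)  zero    = ≤-trans (≤-reflexive (cong (suc ∘ ∣_∣) (∪-identityʳ p))) (n≤1+n _)
  ∣p∪⁅e⁆∣≤ (false ∷ p) zero    = ≤-reflexive (cong (suc ∘ ∣_∣) (∪-identityʳ p))
  ∣p∪⁅e⁆∣≤ (true ∷ p)  (suc e) = s≤s (∣p∪⁅e⁆∣≤ p e)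
  ∣p∪⁅e⁆∣≤ (false ∷ p) (suc e) = ∣p∪⁅e⁆∣≤ p e

open SubsetLemmas

-- U k n is the rank-k uniform matroid on n elements (for k ≤ n).
U : ℕ → ℕ → Matroid
U k n = record
  { size    = n
  ; Indep   = λ I → ∣ I ∣ ≤ k
  ; Indep?  = λ I → ∣ I ∣ ≤? k
  ; ⊥-indep = ≤-trans (≤-reflexive (∣⊥∣≡0 n)) z≤n
  ; ⊆-indep = λ I⊆J → ≤-trans (p⊆q⇒∣p∣≤∣q∣ I⊆J)
  ; augment = λ {I} {J} _ J≤k I<J → let e , e∈J , e∉I = ∃-∈-∉ I<J in
      e , e∈J , e∉I , ≤-trans (∣p∪⁅e⁆∣≤ I e) (≤-trans I<J J≤k)
  }

empty coloop : Matroid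
empty  = U 0 0
coloop = U 1 1

-- The matroid whose ground set, of k + 1 elements, is a circuit.
circuit : ℕ → Matroid
circuit k = U k (suc k)

module DirectSumLemmas where
  take-⊥ : ∀ m {n} → take m (⊥ {m + n}) ≡ ⊥
  take-⊥ zero    = refl
  take-⊥ (suc m) = cong (false ∷_) (take-⊥ m)

  drop-⊥ : ∀ m {n} → drop m (⊥ {m + n}) ≡ ⊥
  drop-⊥ zero    = refl
  drop-⊥ (suc m) = drop-⊥ m

  ∈-take⁺ : ∀ {m n} {e : Fin m} (I : Subset (m + n)) → e ↑ˡ n ∈ I → e ∈ take m I
  ∈-take⁺ {e = zero}  (_ ∷ I) here      = here
  ∈-take⁺ {e = suc e} (_ ∷ I) (there p) = there (∈-take⁺ I p)

  ∈-take⁻ : ∀ {m n} {e : Fin m} (I : Subset (m + n)) → e ∈ take m I → e ↑ˡ n ∈ I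
  ∈-take⁻ {e = zero}  (_ ∷ I) here      = here
  ∈-take⁻ {e = suc e} (_ ∷ I) (there p) = there (∈-take⁻ I p)

  ∈-drop⁺ : ∀ m {n} {e : Fin n} (I : Subset (m + n)) → m ↑ʳ e ∈ I → e ∈ drop m I
  ∈-drop⁺ zero    I       p         = p
  ∈-drop⁺ (suc m) (_ ∷ I) (there p) = ∈-drop⁺ m I p

  ∈-drop⁻ : ∀ m {n} {e : Fin n} (I : Subset (m + n)) → e ∈ drop m I → m ↑ʳ e ∈ I
  ∈-drop⁻ zero    I       p = p
  ∈-drop⁻ (suc m) (_ ∷ I) p = there (∈-drop⁻ m I p)

  take-⁅↑ˡ⁆ : ∀ {m n} (e : Fin m) → take m ⁅ e ↑ˡ n ⁆ ≡ ⁅ e ⁆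
  take-⁅↑ˡ⁆ {suc m} zero = cong (true ∷_) (take-⊥ m)
  take-⁅↑ˡ⁆ (suc e)      = cong (false ∷_) (take-⁅↑ˡ⁆ e)

  drop-⁅↑ˡ⁆ : ∀ {m n} (e : Fin m) → drop m ⁅ e ↑ˡ n ⁆ ≡ ⊥
  drop-⁅↑ˡ⁆ {suc m} zero = drop-⊥ m
  drop-⁅↑ˡ⁆ (suc e)      = drop-⁅↑ˡ⁆ e

  take-⁅↑ʳ⁆ : ∀ m {n} (e : Fin n) → take m ⁅ m ↑ʳ e ⁆ ≡ ⊥
  take-⁅↑ʳ⁆ zero    e = refl
  take-⁅↑ʳ⁆ (suc m) e = cong (false ∷_) (take-⁅↑ʳ⁆ m e)

  drop-⁅↑ʳ⁆ : ∀ m {n} (e : Fin n) → drop m ⁅ m ↑ʳ e ⁆ ≡ ⁅ e ⁆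
  drop-⁅↑ʳ⁆ zero    e = refl
  drop-⁅↑ʳ⁆ (suc m) e = drop-⁅↑ʳ⁆ m e

  ∣take∣+∣drop∣ : ∀ m {n} (I : Subset (m + n)) → ∣ I ∣ ≡ ∣ take m I ∣ + ∣ drop m I ∣
  ∣take∣+∣drop∣ zero    I           = refl
  ∣take∣+∣drop∣ (suc m) (true ∷ I)  = cong suc (∣take∣+∣drop∣ m I)
  ∣take∣+∣drop∣ (suc m) (false ∷ I) = ∣take∣+∣drop∣ m I

  +-<⇒<⊎< : ∀ {a b c d} → a + b < c + d → a < c ⊎ b < d
  +-<⇒<⊎< {a} {b} {c} {d} lt with a <? c | b <? d
  ... | yes p | _     = inj₁ p
  ... | no _  | yes q = inj₂ q
  ... | no ¬p | no ¬q = contradiction lt (≤⇒≯ (+-mono-≤ (≮⇒≥ ¬p) (≮⇒≥ ¬q)))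

open DirectSumLemmas

infixr 6 _⊕_

_⊕_ : Matroid → Matroid → Matroid
M ⊕ N = record
  { size    = m + n
  ; Indep   = λ I → Indep M (take m I) × Indep N (drop m I)
  ; Indep?  = λ I → Indep? M (take m I) ×-dec Indep? N (drop m I)
  ; ⊥-indep = subst (Indep M) (sym (take-⊥ m)) (⊥-indep M)
            , subst (Indep N) (sym (drop-⊥ m)) (⊥-indep N)
  ; ⊆-indep = λ {I} {J} I⊆J (p , q) →
      ⊆-indep M (λ x → ∈-take⁺ J (I⊆J (∈-take⁻ I x))) p ,
      ⊆-indep N (λ x → ∈-drop⁺ m J (I⊆J (∈-drop⁻ m I x))) q
  ; augment = aug
  }
  where
  m = size M
  n = size N

  aug : ∀ {I J : Subset (m + n)} →
        Indep M (take m I) × Indep N (drop m I) →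
        Indep M (take m J) × Indep N (drop m J) → ∣ I ∣ < ∣ J ∣ →
        ∃ λ e → e ∈ J × e ∉ I × Indep M (take m (I ∪ ⁅ e ⁆)) × Indep N (drop m (I ∪ ⁅ e ⁆))
  aug {I} {J} (p , q) (p′ , q′) I<J
    with +-<⇒<⊎< (subst₂ _<_ (∣take∣+∣drop∣ m I) (∣take∣+∣drop∣ m J) I<J)
  ... | inj₁ lt = let e , e∈ , e∉ , ind = augment M p p′ lt in
      e ↑ˡ n , ∈-take⁻ J e∈ , e∉ ∘ ∈-take⁺ I ,
      subst (Indep M) (sym (trans (take-zipWith _ I _) (cong (take m I ∪_) (take-⁅↑ˡ⁆ e)))) ind ,
      subst (Indep N) (sym (trans (drop-zipWith {m = m} _ I _)
        (trans (cong (drop m I ∪_) (drop-⁅↑ˡ⁆ e)) (∪-identityʳ _)))) q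
  ... | inj₂ lt = let e , e∈ , e∉ , ind = augment N q q′ lt in
      m ↑ʳ e , ∈-drop⁻ m J e∈ , e∉ ∘ ∈-drop⁺ m I ,
      subst (Indep M) (sym (trans (take-zipWith _ I _)
        (trans (cong (take m I ∪_) (take-⁅↑ʳ⁆ m e)) (∪-identityʳ _)))) p ,
      subst (Indep N) (sym (trans (drop-zipWith {m = m} _ I _) (cong (drop m I ∪_) (drop-⁅↑ʳ⁆ m e)))) ind

⨁ : List Matroid → Matroid
⨁ = foldr _⊕_ empty

𝟎 : ∀ {k} → Vec Bool k
𝟎 = Vec.replicate _ false

infixl 6 _+ᵛ_

_+ᵛ_ : ∀ {k} → Vec Bool k → Vec Bool k → Vec Bool k
_+ᵛ_ = zipWith _xor_

infix 4 _≟ᵛ_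

_≟ᵛ_ : ∀ {k} → DecidableEquality (Vec Bool k)
_≟ᵛ_ = ≡-dec _≟ᵇ_

-- Over the two-element field a coefficient vector is a subset.
combination : ∀ {k n} → (Fin n → Vec Bool k) → Subset n → Vec Bool k
combination v []          = 𝟎
combination v (true  ∷ c) = v zero +ᵛ combination (v ∘ suc) c
combination v (false ∷ c) = combination (v ∘ suc) c

LinIndep : ∀ {k n} → (Fin n → Vec Bool k) → Subset n → Set
LinIndep v I = ∀ c → c ⊆ I → combination v c ≡ 𝟎 → c ≡ ⊥

module BinaryLemmas where
  +ᵛ-assoc : ∀ {k} (x y z : Vec Bool k) → (x +ᵛ y) +ᵛ z ≡ x +ᵛ (y +ᵛ z)
  +ᵛ-assoc = zipWith-assoc xor-assoc

  +ᵛ-comm : ∀ {k} (x y : Vec Bool k) → x +ᵛ y ≡ y +ᵛ x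
  +ᵛ-comm = zipWith-comm xor-comm

  +ᵛ-idˡ : ∀ {k} (x : Vec Bool k) → 𝟎 +ᵛ x ≡ x
  +ᵛ-idˡ = zipWith-identityˡ λ _ → refl

  +ᵛ-idʳ : ∀ {k} (x : Vec Bool k) → x +ᵛ 𝟎 ≡ x
  +ᵛ-idʳ = zipWith-identityʳ xor-identityʳ

  +ᵛ-self : ∀ {k} (x : Vec Bool k) → x +ᵛ x ≡ 𝟎
  +ᵛ-self []      = refl
  +ᵛ-self (x ∷ v) = cong₂ _∷_ (xor-same x) (+ᵛ-self v)

  +ᵛ≡𝟎⇒≡ : ∀ {k} (x y : Vec Bool k) → x +ᵛ y ≡ 𝟎 → x ≡ y
  +ᵛ≡𝟎⇒≡ x y eq = begin
    x              ≡⟨ +ᵛ-idʳ x ⟨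
    x +ᵛ 𝟎         ≡⟨ cong (x +ᵛ_) (+ᵛ-self y) ⟨
    x +ᵛ (y +ᵛ y)  ≡⟨ +ᵛ-assoc x y y ⟨
    (x +ᵛ y) +ᵛ y  ≡⟨ cong (_+ᵛ y) eq ⟩
    𝟎 +ᵛ y         ≡⟨ +ᵛ-idˡ y ⟩
    y              ∎
    where open ≡-Reasoning

  combination-⊥ : ∀ {k n} (v : Fin n → Vec Bool k) → combination v ⊥ ≡ 𝟎
  combination-⊥ {n = zero}  v = refl
  combination-⊥ {n = suc n} v = combination-⊥ (v ∘ suc)

  combination-+ : ∀ {k n} (v : Fin n → Vec Bool k) (c d : Subset n) →
                  combination v (c +ᵛ d) ≡ combination v c +ᵛ combination v d
  combination-+ v [] [] = sym (+ᵛ-idˡ 𝟎)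
  combination-+ v (true ∷ c) (true ∷ d) = begin
    combination w (c +ᵛ d)   ≡⟨ combination-+ w c d ⟩
    C +ᵛ D                   ≡⟨ cong (_+ᵛ D) (+ᵛ-idʳ C) ⟨
    C +ᵛ 𝟎 +ᵛ D              ≡⟨ cong (λ z → C +ᵛ z +ᵛ D) (+ᵛ-self x) ⟨
    C +ᵛ (x +ᵛ x) +ᵛ D       ≡⟨ cong (_+ᵛ D) (+ᵛ-assoc C x x) ⟨
    C +ᵛ x +ᵛ x +ᵛ D         ≡⟨ cong (λ z → z +ᵛ x +ᵛ D) (+ᵛ-comm C x) ⟩
    x +ᵛ C +ᵛ x +ᵛ D         ≡⟨ +ᵛ-assoc (x +ᵛ C) x D ⟩
    (x +ᵛ C) +ᵛ (x +ᵛ D)     ∎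
    where
    open ≡-Reasoning
    w = v ∘ suc
    x = v zero
    C = combination w c
    D = combination w d
  combination-+ v (true ∷ c) (false ∷ d) =
    trans (cong (v zero +ᵛ_) (combination-+ (v ∘ suc) c d)) (sym (+ᵛ-assoc (v zero) _ _))
  combination-+ v (false ∷ c) (true ∷ d) = begin
    x +ᵛ combination w (c +ᵛ d)  ≡⟨ cong (x +ᵛ_) (combination-+ w c d) ⟩
    x +ᵛ (C +ᵛ D)                ≡⟨ +ᵛ-assoc x C D ⟨
    x +ᵛ C +ᵛ D                  ≡⟨ cong (_+ᵛ D) (+ᵛ-comm x C) ⟩
    C +ᵛ x +ᵛ D                  ≡⟨ +ᵛ-assoc C x D ⟩
    C +ᵛ (x +ᵛ D)                ∎
    where
    open ≡-Reasoning
    w = v ∘ suc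
    x = v zero
    C = combination w c
    D = combination w d
  combination-+ v (false ∷ c) (false ∷ d) = combination-+ (v ∘ suc) c d

  combination-⁅⁆ : ∀ {k n} (v : Fin n → Vec Bool k) e → combination v ⁅ e ⁆ ≡ v e
  combination-⁅⁆ v zero    = trans (cong (v zero +ᵛ_) (combination-⊥ (v ∘ suc))) (+ᵛ-idʳ (v zero))
  combination-⁅⁆ v (suc e) = combination-⁅⁆ (v ∘ suc) e

  +ᵛ-⊆ : ∀ {n} {c d I : Subset n} → c ⊆ I → d ⊆ I → c +ᵛ d ⊆ I
  +ᵛ-⊆ {c = true  ∷ c} {d = _ ∷ d}     p q {zero} x = p here
  +ᵛ-⊆ {c = false ∷ c} {d = true ∷ d}  p q {zero} x = q here
  +ᵛ-⊆ {c = false ∷ c} {d = false ∷ d} p q {zero} ()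
  +ᵛ-⊆ {c = _ ∷ c} {d = _ ∷ d} {_ ∷ I} p q {suc _} (there x) =
    there (+ᵛ-⊆ (drop-∷-⊆ p) (drop-∷-⊆ q) x)

  +ᵛ-⁅⁆⊆ : ∀ {n} {c I : Subset n} {e} → c ⊆ I ∪ ⁅ e ⁆ → e ∈ c → c +ᵛ ⁅ e ⁆ ⊆ I
  +ᵛ-⁅⁆⊆ {I = i ∷ I} {zero} c⊆ here {suc x} (there x∈) =
    there (subst (x ∈_) (∪-identityʳ I) (drop-∷-⊆ c⊆ (subst (x ∈_) (+ᵛ-idʳ _) x∈)))
  +ᵛ-⁅⁆⊆ {c = true ∷ c} {true ∷ I}  {suc e} c⊆ (there e∈) {zero} x∈ = here
  +ᵛ-⁅⁆⊆ {c = true ∷ c} {false ∷ I} {suc e} c⊆ (there e∈) {zero} x∈ with () ← c⊆ here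
  +ᵛ-⁅⁆⊆ {c = _ ∷ c} {_ ∷ I} {suc e} c⊆ (there e∈) {suc x} (there x∈) =
    there (+ᵛ-⁅⁆⊆ (drop-∷-⊆ c⊆) e∈ x∈)

  linIndep? : ∀ {k n} (v : Fin n → Vec Bool k) I →
              LinIndep v I ⊎ (∃ λ c → c ⊆ I × combination v c ≡ 𝟎 × c ≢ ⊥)
  linIndep? v I
    with anySubset? (λ c → (c ⊆? I) ×-dec (combination v c ≟ᵛ 𝟎) ×-dec ¬? (c ≟ᵛ ⊥))
  ... | yes p = inj₂ p
  ... | no ¬p = inj₁ λ c c⊆I c≡𝟎 → decidable-stable (c ≟ᵛ ⊥) λ c≢⊥ → ¬p (c , c⊆I , c≡𝟎 , c≢⊥)

  LinIndep? : ∀ {k n} (v : Fin n → Vec Bool k) → Decidable (LinIndep v)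
  LinIndep? v I with linIndep? v I
  ... | inj₁ p                       = yes p
  ... | inj₂ (c , c⊆I , c≡𝟎 , c≢⊥) = no λ p → c≢⊥ (p c c⊆I c≡𝟎)

  InSpan : ∀ {k n} → (Fin n → Vec Bool k) → Subset n → Vec Bool k → Set
  InSpan v I x = ∃ λ c → c ⊆ I × combination v c ≡ x

  span-combination : ∀ {k m n} (v : Fin n → Vec Bool k) (I : Subset n)
                     (w : Fin m → Vec Bool k) (c : Subset m) →
                     (∀ {e} → e ∈ c → InSpan v I (w e)) → InSpan v I (combination w c)
  span-combination v I w [] h = ⊥ , ⊥⊆ , combination-⊥ v
  span-combination v I w (true ∷ c) h =
    let a , a⊆I , a≡ = h here
        b , b⊆I , b≡ = span-combination v I (w ∘ suc) c (h ∘ there)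
    in a +ᵛ b , +ᵛ-⊆ a⊆I b⊆I , trans (combination-+ v a b) (cong₂ _+ᵛ_ a≡ b≡)
  span-combination v I w (false ∷ c) h = span-combination v I (w ∘ suc) c (h ∘ there)

  dependent⇒InSpan : ∀ {k n} (v : Fin n → Vec Bool k) (I : Subset n) e →
                     LinIndep v I → ¬ LinIndep v (I ∪ ⁅ e ⁆) → InSpan v I (v e)
  dependent⇒InSpan v I e ind dep with linIndep? v (I ∪ ⁅ e ⁆)
  ... | inj₁ ind′ = contradiction ind′ dep
  ... | inj₂ (c , c⊆ , c≡𝟎 , c≢⊥) with e ∈? c
  ...   | yes e∈c = c +ᵛ ⁅ e ⁆ , +ᵛ-⁅⁆⊆ c⊆ e∈c ,
      trans (combination-+ v c ⁅ e ⁆)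
        (trans (cong₂ _+ᵛ_ c≡𝟎 (combination-⁅⁆ v e)) (+ᵛ-idˡ (v e)))
  ...   | no e∉c = contradiction (ind c c⊆I c≡𝟎) c≢⊥
    where
    c⊆I : c ⊆ I
    c⊆I x∈c with x∈p∪q⁻ I ⁅ e ⁆ (c⊆ x∈c)
    ... | inj₁ x∈I = x∈I
    ... | inj₂ x∈e = contradiction (subst (_∈ c) (x∈⁅y⁆⇒x≡y e x∈e) x∈c) e∉c

  expand : ∀ {n} (J : Subset n) → Vec Bool ∣ J ∣ → Subset n
  expand []          []       = []
  expand (true ∷ J)  (b ∷ bs) = b ∷ expand J bs
  expand (false ∷ J) bs       = false ∷ expand J bs

  expand-⊆ : ∀ {n} (J : Subset n) bs → expand J bs ⊆ J
  expand-⊆ (true ∷ J)  (b ∷ bs) {zero}  x         = here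
  expand-⊆ (true ∷ J)  (b ∷ bs) {suc _} (there x) = there (expand-⊆ J bs x)
  expand-⊆ (false ∷ J) bs       {suc _} (there x) = there (expand-⊆ J bs x)

  restrict : ∀ {n} (J : Subset n) → Subset n → Vec Bool ∣ J ∣
  restrict []          []      = []
  restrict (true ∷ J)  (b ∷ c) = b ∷ restrict J c
  restrict (false ∷ J) (_ ∷ c) = restrict J c

  restrict-expand : ∀ {n} (J : Subset n) bs → restrict J (expand J bs) ≡ bs
  restrict-expand []          []       = refl
  restrict-expand (true ∷ J)  (b ∷ bs) = cong (b ∷_) (restrict-expand J bs)
  restrict-expand (false ∷ J) bs       = restrict-expand J bs

  expand-restrict : ∀ {n} (J c : Subset n) → c ⊆ J → expand J (restrict J c) ≡ c
  expand-restrict []          []          _ = refl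
  expand-restrict (true ∷ J)  (b ∷ c)     p = cong (b ∷_) (expand-restrict J c (drop-∷-⊆ p))
  expand-restrict (false ∷ J) (false ∷ c) p = cong (false ∷_) (expand-restrict J c (drop-∷-⊆ p))
  expand-restrict (false ∷ J) (true ∷ c)  p with () ← p here

  bit : Bool → Fin 2
  bit false = zero
  bit true  = suc zero

  unbit : Fin 2 → Bool
  unbit zero       = false
  unbit (suc zero) = true

  unbit-bit : ∀ b → unbit (bit b) ≡ b
  unbit-bit false = refl
  unbit-bit true  = refl

  bit-unbit : ∀ i → bit (unbit i) ≡ i
  bit-unbit zero       = refl
  bit-unbit (suc zero) = refl

  encode : ∀ {n} → Vec Bool n → Fin (2 ^ n)
  encode []       = zero
  encode (b ∷ bs) = combine (bit b) (encode bs)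

  decode : ∀ n → Fin (2 ^ n) → Vec Bool n
  decode zero    _ = []
  decode (suc n) i = unbit (proj₁ (remQuot (2 ^ n) i)) ∷ decode n (proj₂ (remQuot {2} (2 ^ n) i))

  decode-encode : ∀ {n} (bs : Vec Bool n) → decode n (encode bs) ≡ bs
  decode-encode []       = refl
  decode-encode {suc n} (b ∷ bs) =
    cong₂ _∷_ (trans (cong (unbit ∘ proj₁) split) (unbit-bit b))
              (trans (cong (decode n ∘ proj₂) split) (decode-encode bs))
    where
    split : remQuot {2} (2 ^ n) (encode (b ∷ bs)) ≡ (bit b , encode bs)
    split = remQuot-combine (bit b) (encode bs)

  encode-decode : ∀ n (i : Fin (2 ^ n)) → encode (decode n i) ≡ i
  encode-decode zero    zero = refl
  encode-decode (suc n) i    =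
    trans (cong₂ combine (bit-unbit (proj₁ (remQuot {2} (2 ^ n) i)))
                         (encode-decode n (proj₂ (remQuot {2} (2 ^ n) i))))
          (combine-remQuot {2} (2 ^ n) i)

  -- If J is in the span of I then the 2^|J| combinations of J lie among the
  -- at most 2^|I| combinations of I, so two of them coincide.
  independent-in-span : ∀ {k n} (v : Fin n → Vec Bool k) (I J : Subset n) → LinIndep v J →
                        (∀ {e} → e ∈ J → InSpan v I (v e)) → ¬ (∣ I ∣ < ∣ J ∣)
  independent-in-span v I J ind J⊆span lt =
    let i , j , i<j , same = pigeonhole (^-monoʳ-< 2 (s≤s (s≤s z≤n)) lt) index
    in <⇒≢ i<j (cong toℕ (index-injective i j same))
    where
    coeffs : Fin (2 ^ ∣ J ∣) → Subset _
    coeffs i = expand J (decode ∣ J ∣ i)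

    spans : ∀ i → InSpan v I (combination v (coeffs i))
    spans i = span-combination v I v (coeffs i) λ e∈ → J⊆span (expand-⊆ J (decode ∣ J ∣ i) e∈)

    index : Fin (2 ^ ∣ J ∣) → Fin (2 ^ ∣ I ∣)
    index i = encode (restrict I (proj₁ (spans i)))

    recover : ∀ i → expand I (decode ∣ I ∣ (index i)) ≡ proj₁ (spans i)
    recover i = trans (cong (expand I) (decode-encode (restrict I (proj₁ (spans i)))))
                      (expand-restrict I _ (proj₁ (proj₂ (spans i))))

    module _ (i j : Fin (2 ^ ∣ J ∣)) (same : index i ≡ index j) where
      open ≡-Reasoning

      sum≡𝟎 : combination v (coeffs i +ᵛ coeffs j) ≡ 𝟎
      sum≡𝟎 = begin
        combination v (coeffs i +ᵛ coeffs j)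
          ≡⟨ combination-+ v (coeffs i) (coeffs j) ⟩
        combination v (coeffs i) +ᵛ combination v (coeffs j)
          ≡⟨ cong₂ _+ᵛ_ (proj₂ (proj₂ (spans i))) (proj₂ (proj₂ (spans j))) ⟨
        combination v (proj₁ (spans i)) +ᵛ combination v (proj₁ (spans j))
          ≡⟨ cong (λ c → combination v c +ᵛ combination v (proj₁ (spans j)))
               (trans (sym (recover i)) (trans (cong (expand I ∘ decode _) same) (recover j))) ⟩
        combination v (proj₁ (spans j)) +ᵛ combination v (proj₁ (spans j))
          ≡⟨ +ᵛ-self _ ⟩
        𝟎 ∎

      coeffs≡ : coeffs i ≡ coeffs j
      coeffs≡ = +ᵛ≡𝟎⇒≡ _ _
        (ind _ (+ᵛ-⊆ (expand-⊆ J (decode _ i)) (expand-⊆ J (decode _ j))) sum≡𝟎)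

      index-injective : i ≡ j
      index-injective = begin
        i                              ≡⟨ encode-decode ∣ J ∣ i ⟨
        encode (decode ∣ J ∣ i)        ≡⟨ cong encode (restrict-expand J (decode ∣ J ∣ i)) ⟨
        encode (restrict J (coeffs i)) ≡⟨ cong (encode ∘ restrict J) coeffs≡ ⟩
        encode (restrict J (coeffs j)) ≡⟨ cong encode (restrict-expand J (decode ∣ J ∣ j)) ⟩
        encode (decode ∣ J ∣ j)        ≡⟨ encode-decode ∣ J ∣ j ⟩
        j                              ∎

open BinaryLemmas

binary : ∀ {k n} → (Fin n → Vec Bool k) → Matroid
binary {n = n} v = record
  { size    = n
  ; Indep   = LinIndep v
  ; Indep?  = LinIndep? v
  ; ⊥-indep = λ _ c⊆⊥ _ → ⊆-antisym c⊆⊥ ⊥⊆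
  ; ⊆-indep = λ I⊆J ind c c⊆I → ind c (I⊆J ∘ c⊆I)
  ; augment = aug
  }
  where
  aug : ∀ {I J} → LinIndep v I → LinIndep v J → ∣ I ∣ < ∣ J ∣ →
        ∃ λ e → e ∈ J × e ∉ I × LinIndep v (I ∪ ⁅ e ⁆)
  aug {I} {J} indI indJ I<J
    with any? (λ e → (e ∈? J) ×-dec ¬? (e ∈? I) ×-dec LinIndep? v (I ∪ ⁅ e ⁆))
  ... | yes p = p
  ... | no ¬p = contradiction I<J (independent-in-span v I J indJ J⊆span)
    where
    J⊆span : ∀ {e} → e ∈ J → InSpan v I (v e)
    J⊆span {e} e∈J with e ∈? I
    ... | yes e∈I = ⁅ e ⁆ , (λ x∈ → subst (_∈ I) (sym (x∈⁅y⁆⇒x≡y e x∈)) e∈I) , combination-⁅⁆ v e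
    ... | no e∉I  = dependent⇒InSpan v I e indI λ ind → ¬p (e , e∈J , e∉I , ind)

nonzeroVectors : ∀ k → List (Vec Bool k)
nonzeroVectors k = filter (λ x → ¬? (x ≟ᵛ 𝟎)) (bitVectors k)

-- The rank-k geometry PG(k - 1, 2); it is empty for k = 0.
PG : ℕ → Matroid
PG k = binary (List.lookup (nonzeroVectors k))

-- a of the t geometries get rank r / t + 1, which is the ceiling of r / t
-- when a ≠ 0; the others get rank r / t.
parts : ∀ (r t : ℕ) .{{_ : NonZero t}} → List ℕ
parts r t = replicate (t ∸ a) (r / t) List.++ replicate a (suc (r / t))
  where a = r % t

𝐌 : ∀ (r t : ℕ) .{{_ : NonZero t}} → Matroid
𝐌 r t = ⨁ (map PG (parts r t))

f : ∀ (r t : ℕ) .{{_ : NonZero t}} → ℕ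
f r t = size (𝐌 r t)

module SizeLemmas where
  sum-replicate : ∀ n x → sum (replicate n x) ≡ n * x
  sum-replicate zero    x = refl
  sum-replicate (suc n) x = cong (x +_) (sum-replicate n x)

  t∸a+a : ∀ r t .{{_ : NonZero t}} → t ∸ r % t + r % t ≡ t
  t∸a+a r t = m∸n+n≡m (<⇒≤ (m%n<n r t))

  length-bitVectors : ∀ n → length (bitVectors n) ≡ 2 ^ n
  length-bitVectors zero    = refl
  length-bitVectors (suc n) = begin
    length (map (false ∷_) L List.++ map (true ∷_) L)
      ≡⟨ length-++ (map (false ∷_) L) ⟩
    length (map (false ∷_) L) + length (map (true ∷_) L)
      ≡⟨ cong₂ _+_ (length-map _ L) (length-map _ L) ⟩
    length L + length L
      ≡⟨ cong (λ l → l + l) (length-bitVectors n) ⟩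
    2 ^ n + 2 ^ n
      ≡⟨ cong (2 ^ n +_) (+-identityʳ (2 ^ n)) ⟨
    2 * 2 ^ n ∎
    where
    open ≡-Reasoning
    L = bitVectors n

  nonzero? : ∀ {k} → Decidable (λ (x : Vec Bool k) → ¬ (x ≡ 𝟎))
  nonzero? x = ¬? (x ≟ᵛ 𝟎)

  length-filter-false∷ : ∀ {k} (L : List (Vec Bool k)) →
    length (filter nonzero? (map (false ∷_) L)) ≡ length (filter nonzero? L)
  length-filter-false∷ []      = refl
  length-filter-false∷ (x ∷ L) with x ≟ᵛ 𝟎
  ... | yes _ = length-filter-false∷ L
  ... | no _  = cong suc (length-filter-false∷ L)

  size-PG : ∀ k → size (PG k) + 1 ≡ 2 ^ k
  size-PG zero    = refl
  size-PG (suc k) = begin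
    length (filter nonzero? (map (false ∷_) L List.++ map (true ∷_) L)) + 1
      ≡⟨ cong (λ l → length l + 1) (filter-++ nonzero? (map (false ∷_) L) _) ⟩
    length (filter nonzero? (map (false ∷_) L) List.++ filter nonzero? (map (true ∷_) L)) + 1
      ≡⟨ cong (_+ 1) (length-++ (filter nonzero? (map (false ∷_) L))) ⟩
    length (filter nonzero? (map (false ∷_) L)) + length (filter nonzero? (map (true ∷_) L)) + 1
      ≡⟨ cong₂ (λ m n → m + n + 1) (length-filter-false∷ L)
           (trans (cong length (filter-all nonzero? (map⁺ (All.universal (λ _ ()) L))))
                  (trans (length-map _ L) (length-bitVectors k))) ⟩
    size (PG k) + 2 ^ k + 1
      ≡⟨ +-assoc (size (PG k)) (2 ^ k) 1 ⟩
    size (PG k) + (2 ^ k + 1)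
      ≡⟨ cong (size (PG k) +_) (+-comm (2 ^ k) 1) ⟩
    size (PG k) + (1 + 2 ^ k)
      ≡⟨ +-assoc (size (PG k)) 1 (2 ^ k) ⟨
    size (PG k) + 1 + 2 ^ k
      ≡⟨ cong₂ _+_ (size-PG k) (sym (+-identityʳ (2 ^ k))) ⟩
    2 * 2 ^ k ∎
    where
    open ≡-Reasoning
    L = bitVectors k

  size-⨁-PG : ∀ ks → size (⨁ (map PG ks)) + length ks ≡ sum (map (2 ^_) ks)
  size-⨁-PG []       = refl
  size-⨁-PG (k ∷ ks) = begin
    size (PG k) + s + (1 + length ks)    ≡⟨ +-assoc (size (PG k) + s) 1 (length ks) ⟨
    size (PG k) + s + 1 + length ks      ≡⟨ cong (_+ length ks) (+-assoc (size (PG k)) s 1) ⟩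
    size (PG k) + (s + 1) + length ks    ≡⟨ cong (λ x → size (PG k) + x + length ks) (+-comm s 1) ⟩
    size (PG k) + (1 + s) + length ks    ≡⟨ cong (_+ length ks) (+-assoc (size (PG k)) 1 s) ⟨
    size (PG k) + 1 + s + length ks      ≡⟨ +-assoc (size (PG k) + 1) s (length ks) ⟩
    size (PG k) + 1 + (s + length ks)    ≡⟨ cong₂ _+_ (size-PG k) (size-⨁-PG ks) ⟩
    2 ^ k + sum (map (2 ^_) ks)          ∎
    where
    open ≡-Reasoning
    s = size (⨁ (map PG ks))

open SizeLemmas

module _ (r t : ℕ) .{{_ : NonZero t}} where
  private
    a = r % t
    q = r / t

  open ≡-Reasoning

  length-parts : length (parts r t) ≡ t
  length-parts = begin
    length (parts r t)   ≡⟨ length-++ (replicate (t ∸ a) q) ⟩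
    length (replicate (t ∸ a) q) + length (replicate a (suc q))
                         ≡⟨ cong₂ _+_ (length-replicate (t ∸ a)) (length-replicate a) ⟩
    t ∸ a + a            ≡⟨ t∸a+a r t ⟩
    t                    ∎

  sum-parts : sum (parts r t) ≡ r
  sum-parts = begin
    sum (parts r t)                  ≡⟨ sum-++ (replicate (t ∸ a) q) _ ⟩
    sum (replicate (t ∸ a) q) + sum (replicate a (suc q))
                                     ≡⟨ cong₂ _+_ (sum-replicate (t ∸ a) q) (sum-replicate a (suc q)) ⟩
    (t ∸ a) * q + a * suc q          ≡⟨ cong ((t ∸ a) * q +_) (*-suc a q) ⟩
    (t ∸ a) * q + (a + a * q)        ≡⟨ cong ((t ∸ a) * q +_) (+-comm a (a * q)) ⟩
    (t ∸ a) * q + (a * q + a)        ≡⟨ +-assoc ((t ∸ a) * q) (a * q) a ⟨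
    (t ∸ a) * q + a * q + a          ≡⟨ cong (_+ a) (*-distribʳ-+ q (t ∸ a) a) ⟨
    (t ∸ a + a) * q + a              ≡⟨ cong (λ s → s * q + a) (t∸a+a r t) ⟩
    t * q + a                        ≡⟨ cong (_+ a) (*-comm t q) ⟩
    q * t + a                        ≡⟨ +-comm (q * t) a ⟩
    a + q * t                        ≡⟨ m≡m%n+[m/n]*n r t ⟨
    r                                ∎

  parts-balanced : ∀ {j k} → j ∈ˡ parts r t → k ∈ˡ parts r t → j ≤ suc k
  parts-balanced {j} {k} j∈ k∈ = ≤-trans (proj₂ (bounds j∈)) (s≤s (proj₁ (bounds k∈)))
    where
    all : All (λ k → q ≤ k × k ≤ suc q) (parts r t)
    all = ++⁺ (replicate⁺ (t ∸ a) (≤-refl , n≤1+n q)) (replicate⁺ a (n≤1+n q , ≤-refl))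

    bounds : ∀ {k} → k ∈ˡ parts r t → q ≤ k × k ≤ suc q
    bounds = All.lookup all

  f-explicit : f r t ≡ (t ∸ a) * 2 ^ q + a * 2 ^ suc q ∸ t
  f-explicit = begin
    f r t
      ≡⟨ m+n∸n≡m (f r t) t ⟨
    f r t + t ∸ t
      ≡⟨ cong (λ l → f r t + l ∸ t) length-parts ⟨
    f r t + length (parts r t) ∸ t
      ≡⟨ cong (_∸ t) (size-⨁-PG (parts r t)) ⟩
    sum (map (2 ^_) (parts r t)) ∸ t
      ≡⟨ cong (λ l → sum l ∸ t) (map-++ (2 ^_) (replicate (t ∸ a) q) _) ⟩
    sum (map (2 ^_) (replicate (t ∸ a) q) List.++ map (2 ^_) (replicate a (suc q))) ∸ t
      ≡⟨ cong (_∸ t) (sum-++ (map (2 ^_) (replicate (t ∸ a) q)) _) ⟩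
    sum (map (2 ^_) (replicate (t ∸ a) q)) + sum (map (2 ^_) (replicate a (suc q))) ∸ t
      ≡⟨ cong₂ (λ x y → sum x + sum y ∸ t) (map-replicate (2 ^_) (t ∸ a) q)
                                           (map-replicate (2 ^_) a (suc q)) ⟩
    sum (replicate (t ∸ a) (2 ^ q)) + sum (replicate a (2 ^ suc q)) ∸ t
      ≡⟨ cong₂ (λ x y → x + y ∸ t) (sum-replicate (t ∸ a) (2 ^ q)) (sum-replicate a (2 ^ suc q)) ⟩
    (t ∸ a) * 2 ^ q + a * 2 ^ suc q ∸ t ∎

{-# OPTIONS --safe #-}
module Submission where

-- Let S be a t-claw of M, where M has rank r.  The simplification N of M / S has no
-- (t + 1)-claw either, and every point of N is a parallel class of M / S with at least two
-- elements, since otherwise it would extend S to a claw.  Hence |M| ≥ t + 2|N|, which matches the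
-- recursion f r t = t + 2 f (r - t) t; if M has no t-claw, use f r t < f r (t - 1).
--
-- If |M| = f r t then every class is a pair {y , y′}, contained in a unique circuit
-- {y , y′} ∪ A_y with A_y ⊆ S non-empty.  If y and z span a two-point line of N and e ∈ A_y ∩ A_z,
-- then (S - e) ∪ {y , z} is a (t + 1)-claw; so A_y and A_z are disjoint.  When r < 2t, N is free,
-- and M is a direct sum of coloops and of these circuits.  Otherwise N is by induction a direct sum
-- of t non-empty projective geometries, so that each A_y is the single element attached to the
-- summand of y, and M decomposes into t summands without 2-claws, of one rank more.

-- Every matroid in the induction lives on the same type `Fin (size M)`: a restriction is a subset
-- `G`, and N is `contract` restricted to a set `T` of representatives, so nothing is reindexed
-- before the final isomorphism. A claw of N is then literally a claw of M (`claw-lift`). The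
-- inductive step for r ≥ 2t has to exclude that N is itself one of the exceptional sums of
-- circuits. Such an N would contain t + 1 points of which any two span a two-point line, hence t +
-- 1 disjoint non-empty sets A_y inside the t-set S (`not-exceptional`). So the exception does not
-- propagate to higher rank. The bound itself is reused for t = 1 in the equality case: a simple
-- matroid of rank ρ without 2-claws has at least 2^ρ - 1 points. Against an upper count this shows
-- that a lifted class has the expected rank, and that the complement of a hyperplane has exactly
-- one point more than the hyperplane, which is the source of the binary coordinates.

open import Defs
open import Data.Bool.Base using (Bool; true; false; _xor_; not)
open import Data.Bool.Properties using (xor-identityʳ; xor-same) renaming (_≟_ to _≟ᵇ_)
open import Data.Fin.Base
  using (Fin; zero; suc; _↑ˡ_; _↑ʳ_; splitAt; toℕ; fromℕ<; inject≤)
open import Data.Fin.Permutation using (permutation)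
open import Data.Fin.Properties
  using (any?; all?; splitAt-↑ˡ; splitAt-↑ʳ; splitAt⁻¹-↑ˡ; splitAt⁻¹-↑ʳ; toℕ<n; toℕ-fromℕ<;
         toℕ-injective; inject≤-injective)
  renaming (_≟_ to _≟ᶠ_; suc-injective to suc-injectiveᶠ)
open import Data.Fin.Subset
  using (Subset; _∈_; _∉_; _⊆_; _∪_; _∩_; _─_; _-_; ∁; ⊤; ⊥; ⁅_⁆; ∣_∣)
open import Data.Fin.Subset.Properties
open import Data.List.Base as List using (List; []; _∷_; length; map; replicate; _++_)
open import Data.List.Extrema.Nat using (xs≤max; max≤v⁺)
import Data.List.Membership.DecPropositional as DecMembership
open import Data.List.Membership.Propositional using () renaming (_∈_ to _∈ˡ_)
open import Data.List.Membership.Propositional.Properties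
  using (∈-lookup; ∈-filter⁺; ∈-filter⁻; ∈-++⁺ˡ; ∈-++⁺ʳ; ∈-map⁺; ∈-map⁻; ∈-tabulate⁺; ∈-tabulate⁻)
open import Data.List.Properties
  using (length-tabulate; length-++; length-replicate; length-map; map-++; map-replicate)
open import Data.List.Relation.Binary.Pointwise using (Pointwise; []; _∷_; ++⁺)
open import Data.List.Relation.Unary.All as All using (All; []; _∷_)
open import Data.List.Relation.Unary.AllPairs using ([]; _∷_)
open import Data.List.Relation.Unary.Any as Any using (here; there)
open import Data.List.Relation.Unary.Any.Properties using (lookup-index)
open import Data.List.Relation.Unary.Unique.Propositional using (Unique)
import Data.List.Relation.Unary.Unique.Propositional.Properties as Unique
open import Data.Nat.Base hiding (∣_-_∣)
open import Data.Nat.DivMod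
  using (_/_; _%_; m<n⇒m/n≡0; m<n⇒m%n≡m; m%n<n; m/n≡1+[m∸n]/n; m≥n⇒m/n>0; [m+n]%n≡m%n)
open import Data.Nat.Induction using (<-rec)
open import Data.Nat.ListAction using (sum)
open import Data.Nat.ListAction.Properties using (sum-++)
open import Data.Nat.Properties
open import Data.Nat.Solver using (module +-*-Solver)
open import Data.Product.Base using (∃; ∃₂; _×_; _,_; proj₁; proj₂)
open import Data.Sum.Base using (_⊎_; inj₁; inj₂; [_,_]′)
open import Data.Vec.Base using (Vec; []; _∷_; take; drop; tabulate; lookup; here; there)
open import Data.Vec.Properties
  using (lookup∘tabulate; []=⇒lookup; lookup⇒[]=; lookup-zipWith; lookup-replicate)
open import Data.Vec.Relation.Binary.Pointwise.Extensional using (ext; Pointwise-≡⇒≡)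
open import Function.Base using (_∘_; id; case_of_)
open import Function.Bundles using (_⇔_; mk⇔; Equivalence)
open import Relation.Binary.PropositionalEquality hiding (J)
open import Relation.Nullary.Decidable
  using (Dec; yes; no; does; dec-true; dec-false; ¬?; _×-dec_; _⊎-dec_; _→-dec_; decidable-stable)
open import Relation.Nullary.Negation using (¬_; contradiction)
open import Relation.Unary using (Decidable)

-- Finite subsets

infixl 6 _⊹_
_⊹_ : ∀ {n} → Subset n → Fin n → Subset n
p ⊹ x = p ∪ ⁅ x ⁆

split : ∀ {a b} {A : Set a} {B : Set b} → Dec A → (A → B) → (¬ A → B) → B
split (yes a) f g = f a
split (no ¬a) f g = g ¬a

module _ {n : ℕ} where
  ∈∉⇒≢ : ∀ {p : Subset n} {x y} → x ∈ p → y ∉ p → x ≢ y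
  ∈∉⇒≢ {p} x∈ y∉ eq = y∉ (subst (_∈ p) eq x∈)

  ∈∪ˡ : ∀ {p q : Subset n} {x} → x ∈ p → x ∈ p ∪ q
  ∈∪ˡ x∈ = x∈p∪q⁺ (inj₁ x∈)

  ∈∪ʳ : ∀ {p q : Subset n} {x} → x ∈ q → x ∈ p ∪ q
  ∈∪ʳ x∈ = x∈p∪q⁺ (inj₂ x∈)

  ∪-lub : ∀ {p q s : Subset n} → p ⊆ s → q ⊆ s → p ∪ q ⊆ s
  ∪-lub {p} {q} p⊆ q⊆ x∈ = [ p⊆ , q⊆ ]′ (x∈p∪q⁻ p q x∈)

  ∈⊹ʳ : ∀ {p : Subset n} {x} → x ∈ p ⊹ x
  ∈⊹ʳ {x = x} = ∈∪ʳ (x∈⁅x⁆ x)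

  ∈⊹⁻ : ∀ (p : Subset n) {x e} → x ∈ p ⊹ e → x ∈ p ⊎ x ≡ e
  ∈⊹⁻ p {e = e} x∈ with x∈p∪q⁻ p ⁅ e ⁆ x∈
  ... | inj₁ x∈p = inj₁ x∈p
  ... | inj₂ x∈e = inj₂ (x∈⁅y⁆⇒x≡y e x∈e)

  ∉⊹ : ∀ {p : Subset n} {x e} → x ∉ p → x ≢ e → x ∉ p ⊹ e
  ∉⊹ {p} x∉ x≢ x∈ = [ x∉ , x≢ ]′ (∈⊹⁻ p x∈)

  ⁅⁆⊆ : ∀ {p : Subset n} {x} → x ∈ p → ⁅ x ⁆ ⊆ p
  ⁅⁆⊆ {p} {x} x∈ y∈ = subst (_∈ p) (sym (x∈⁅y⁆⇒x≡y x y∈)) x∈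

  ⊹-lub : ∀ {p q : Subset n} {x} → p ⊆ q → x ∈ q → p ⊹ x ⊆ q
  ⊹-lub p⊆ x∈ = ∪-lub p⊆ (⁅⁆⊆ x∈)

  ⊹-mono : ∀ {p q : Subset n} {x} → p ⊆ q → p ⊹ x ⊆ q ⊹ x
  ⊹-mono p⊆ = ⊹-lub (∈∪ˡ ∘ p⊆) ∈⊹ʳ

  -⊆ : ∀ {p : Subset n} {x} → p - x ⊆ p
  -⊆ {p} {x} = p─q⊆p p ⁅ x ⁆

  ∈─⁻ : ∀ (p q : Subset n) {x} → x ∈ p ─ q → x ∈ p × x ∉ q
  ∈─⁻ p q x∈ = p─q⊆p p q x∈ , go p q x∈
    where
    go : ∀ {n} (p q : Subset n) {x} → x ∈ p ─ q → x ∉ q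
    go (_ ∷ p) (true ∷ q) (there x∈)  (there x∈q) = go p q x∈ x∈q
    go (_ ∷ p) (false ∷ q) (there x∈) (there x∈q) = go p q x∈ x∈q

  ∉- : ∀ {p : Subset n} {x} → x ∉ p - x
  ∉- {p} {x} x∈ = proj₂ (∈─⁻ p ⁅ x ⁆ x∈) (x∈⁅x⁆ x)

  ∈-⁺ : ∀ {p : Subset n} {x y} → x ∈ p → x ≢ y → x ∈ p - y
  ∈-⁺ = x∈p∧x≢y⇒x∈p-y

  ∈-⁻ : ∀ {p : Subset n} {x y} → x ∈ p - y → x ∈ p × x ≢ y
  ∈-⁻ {p} {x} {y} x∈ = -⊆ {p} x∈ , λ { refl → ∉- {p} x∈ }

  ⊆-⊹ : ∀ {p : Subset n} {x} → p ⊆ (p - x) ⊹ x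
  ⊆-⊹ {p} {x} {y} y∈ with y ≟ᶠ x
  ... | yes refl = ∈⊹ʳ
  ... | no y≢x = ∈∪ˡ (∈-⁺ y∈ y≢x)

  abstract
    -- Opaque, so that a subset cut out by a decidable predicate is handled through its two
    -- membership lemmas and never unfolds to a `tabulate`.
    ⟪_⟫ : ∀ {ℓ} {P : Fin n → Set ℓ} → Decidable P → Subset n
    ⟪ P? ⟫ = tabulate (does ∘ P?)

    ∈⟪⟫⁺ : ∀ {ℓ} {P : Fin n → Set ℓ} (P? : Decidable P) {x} → P x → x ∈ ⟪ P? ⟫
    ∈⟪⟫⁺ P? {x} px = lookup⇒[]= x _ (trans (lookup∘tabulate (does ∘ P?) x) (dec-true (P? x) px))

    ∈⟪⟫⁻ : ∀ {ℓ} {P : Fin n → Set ℓ} (P? : Decidable P) {x} → x ∈ ⟪ P? ⟫ → P x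
    ∈⟪⟫⁻ P? {x} x∈ with P? x in eq
    ... | yes px = px
    ... | no _ with () ← trans (sym (trans (lookup∘tabulate (does ∘ P?) x) (cong does eq))) ([]=⇒lookup x∈)

  ⊈⇒∃ : ∀ {p q : Subset n} → ¬ p ⊆ q → ∃ λ x → x ∈ p × x ∉ q
  ⊈⇒∃ {p} {q} p⊈q with any? (λ x → (x ∈? p) ×-dec ¬? (x ∈? q))
  ... | yes h = h
  ... | no ¬h = contradiction (λ {x} x∈p → decidable-stable (x ∈? q) λ x∉q → ¬h (x , x∈p , x∉q)) p⊈q

  -- Finite choice; `d` only fills in the values outside `T`, so that `g` is total.
  choose : ∀ {m ℓ} (T : Subset n) {P : Fin n → Fin m → Set ℓ} → (Fin n → Fin m) →
           (∀ {y} → y ∈ T → ∃ (P y)) → ∃ λ g → ∀ y → y ∈ T → P y (g y)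
  choose {m} T {P} d h = g , λ _ → g-ok
    where
    g : Fin n → Fin m
    g y with y ∈? T
    ... | yes y∈ = proj₁ (h y∈)
    ... | no _   = d y
    g-ok : ∀ {y} → y ∈ T → P y (g y)
    g-ok {y} y∈ with y ∈? T
    ... | yes y∈′ = proj₂ (h y∈′)
    ... | no y∉  = contradiction y∈ y∉

∣⊹∣ : ∀ {n} (p : Subset n) {x} → x ∉ p → ∣ p ⊹ x ∣ ≡ suc ∣ p ∣
∣⊹∣ (true ∷ p)  {zero}  x∉ = contradiction here x∉
∣⊹∣ (false ∷ p) {zero}  x∉ = cong (suc ∘ ∣_∣) (∪-identityʳ p)
∣⊹∣ (true ∷ p)  {suc x} x∉ = cong suc (∣⊹∣ p (x∉ ∘ there))
∣⊹∣ (false ∷ p) {suc x} x∉ = ∣⊹∣ p (x∉ ∘ there)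

∣p∪q∣+∣p∩q∣ : ∀ {n} (p q : Subset n) → ∣ p ∪ q ∣ + ∣ p ∩ q ∣ ≡ ∣ p ∣ + ∣ q ∣
∣p∪q∣+∣p∩q∣ [] [] = refl
∣p∪q∣+∣p∩q∣ (true ∷ p) (true ∷ q) =
  cong suc (trans (+-suc _ _) (trans (cong suc (∣p∪q∣+∣p∩q∣ p q)) (sym (+-suc _ _))))
∣p∪q∣+∣p∩q∣ (true ∷ p) (false ∷ q) = cong suc (∣p∪q∣+∣p∩q∣ p q)
∣p∪q∣+∣p∩q∣ (false ∷ p) (true ∷ q) =
  trans (cong suc (∣p∪q∣+∣p∩q∣ p q)) (sym (+-suc _ _))
∣p∪q∣+∣p∩q∣ (false ∷ p) (false ∷ q) = ∣p∪q∣+∣p∩q∣ p q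

module _ {n : ℕ} where
  ∣∪∣≤ : ∀ (p q : Subset n) → ∣ p ∪ q ∣ ≤ ∣ p ∣ + ∣ q ∣
  ∣∪∣≤ p q = ≤-trans (m≤m+n _ _) (≤-reflexive (∣p∪q∣+∣p∩q∣ p q))

  ∣∪∣-disjoint : ∀ (p q : Subset n) → (∀ {x} → x ∈ p → x ∉ q) → ∣ p ∪ q ∣ ≡ ∣ p ∣ + ∣ q ∣
  ∣∪∣-disjoint p q dis = begin
    ∣ p ∪ q ∣               ≡⟨ +-identityʳ _ ⟨
    ∣ p ∪ q ∣ + 0           ≡⟨ cong (∣ p ∪ q ∣ +_) (trans (cong ∣_∣ (Empty-unique no-common)) (∣⊥∣≡0 n)) ⟨
    ∣ p ∪ q ∣ + ∣ p ∩ q ∣   ≡⟨ ∣p∪q∣+∣p∩q∣ p q ⟩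
    ∣ p ∣ + ∣ q ∣           ∎
    where
    open ≡-Reasoning
    no-common : ¬ ∃ (_∈ p ∩ q)
    no-common (x , x∈) = let a , b = x∈p∩q⁻ p q x∈ in dis a b

  ∈─⁺ : ∀ {p q : Subset n} {x} → x ∈ p → x ∉ q → x ∈ p ─ q
  ∈─⁺ = x∈p∧x∉q⇒x∈p─q

  ∣∩∣+∣─∣ : ∀ (p q : Subset n) → ∣ p ∣ ≡ ∣ p ∩ q ∣ + ∣ p ─ q ∣
  ∣∩∣+∣─∣ p q = trans (cong ∣_∣ (⊆-antisym to from))
    (∣∪∣-disjoint (p ∩ q) (p ─ q) λ x∈ x∈′ → proj₂ (∈─⁻ p q x∈′) (proj₂ (x∈p∩q⁻ p q x∈)))
    where
    to : p ⊆ (p ∩ q) ∪ (p ─ q)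
    to {x} x∈ with x ∈? q
    ... | yes x∈q = ∈∪ˡ (x∈p∩q⁺ (x∈ , x∈q))
    ... | no x∉q = ∈∪ʳ (∈─⁺ x∈ x∉q)
    from : (p ∩ q) ∪ (p ─ q) ⊆ p
    from = ∪-lub (p∩q⊆p p q) (p─q⊆p p q)

  ∣-∣ : ∀ {p : Subset n} {x} → x ∈ p → ∣ p ∣ ≡ suc ∣ p - x ∣
  ∣-∣ {p} {x} x∈ = trans (cong ∣_∣ (⊆-antisym {i = p} {j = (p - x) ⊹ x} ⊆-⊹ (⊹-lub (-⊆ {p = p}) x∈)))
      (∣⊹∣ (p - x) (∉- {p = p}))

  ⊆∧∣∣≥⇒⊇ : ∀ {p q : Subset n} → p ⊆ q → ∣ q ∣ ≤ ∣ p ∣ → q ⊆ p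
  ⊆∧∣∣≥⇒⊇ {p} {q} p⊆q q≤p {x} x∈q with x ∈? p
  ... | yes x∈p = x∈p
  ... | no x∉p = contradiction (p⊂q⇒∣p∣<∣q∣ (p⊆q , x , x∈q , x∉p)) (≤⇒≯ q≤p)

  ∣∣≡0⇒∉ : ∀ {p : Subset n} {x} → ∣ p ∣ ≡ 0 → x ∉ p
  ∣∣≡0⇒∉ {p} eq x∈ with () ← trans (sym (∣-∣ x∈)) eq

  ∣∣>0⇒∈ : ∀ {p : Subset n} → 0 < ∣ p ∣ → ∃ (_∈ p)
  ∣∣>0⇒∈ {p} lt with nonempty? p
  ... | yes h = h
  ... | no ¬h = contradiction lt (≤⇒≯ (≤-reflexive (trans (cong ∣_∣ (Empty-unique ¬h)) (∣⊥∣≡0 n))))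

  maximal : ∀ {P : Subset n → Set} → Decidable P → ∀ X → P X →
            ∃ λ Y → X ⊆ Y × P Y × (∀ {e} → e ∉ Y → ¬ P (Y ⊹ e))
  maximal {P} P? X pX = go (n ∸ ∣ X ∣) X pX ≤-refl
    where
    go : ∀ k X → P X → n ∸ ∣ X ∣ ≤ k → ∃ λ Y → X ⊆ Y × P Y × (∀ {e} → e ∉ Y → ¬ P (Y ⊹ e))
    go k X pX le with any? (λ e → ¬? (e ∈? X) ×-dec P? (X ⊹ e))
    ... | no ¬h = X , id , pX , λ e∉ pe → ¬h (_ , e∉ , pe)
    go zero X pX le | yes (e , e∉ , pe) =
      contradiction (≤-trans (≤-reflexive (sym (∣⊹∣ X e∉))) (∣p∣≤n (X ⊹ e))) (≤⇒≯ (m∸n≡0⇒m≤n (n≤0⇒n≡0 le)))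
    go (suc k) X pX le | yes (e , e∉ , pe) =
      let Y , X⊆ , r = go k (X ⊹ e) pe
              (≤-trans (≤-reflexive (trans (cong (n ∸_) (∣⊹∣ X e∉)) (sym (pred[m∸n]≡m∸[1+n] n ∣ X ∣))))
              (pred-mono-≤ le))
      in Y , X⊆ ∘ ∈∪ˡ , r

module _ {m n : ℕ} where
  -- Relational, so that no function from `A` to `B` has to be chosen. The induction deletes some x
  -- together with one partner y; injectivity keeps the partners of all other elements different
  -- from y.
  ∣∣-injective : ∀ {ℓ} {R : Fin m → Fin n → Set ℓ} (A : Subset m) (B : Subset n) →
    (∀ {x} → x ∈ A → ∃ λ y → y ∈ B × R x y) →
    (∀ {x x′ y} → x ∈ A → x′ ∈ A → R x y → R x′ y → x ≡ x′) → ∣ A ∣ ≤ ∣ B ∣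
  ∣∣-injective {R = R} A B tot inj = go ∣ A ∣ A B refl tot inj
    where
    go : ∀ k A B → ∣ A ∣ ≡ k → (∀ {x} → x ∈ A → ∃ λ y → y ∈ B × R x y) →
         (∀ {x x′ y} → x ∈ A → x′ ∈ A → R x y → R x′ y → x ≡ x′) → ∣ A ∣ ≤ ∣ B ∣
    go zero A B eq tot inj = ≤-trans (≤-reflexive eq) z≤n
    go (suc k) A B eq tot inj =
      let x , x∈ = ∣∣>0⇒∈ {p = A} (≤-trans (s≤s z≤n) (≤-reflexive (sym eq)))
          y , y∈ , xy = tot x∈
      in subst₂ _≤_ (sym (∣-∣ x∈)) (sym (∣-∣ y∈)) (s≤s
           (go k (A - x) (B - y) (suc-injective (trans (sym (∣-∣ x∈)) eq))
             (λ {x′} x′∈ → let x′∈A , x′≢x = ∈-⁻ x′∈ ; y′ , y′∈ , r = tot x′∈A in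
               y′ , ∈-⁺ y′∈ (λ y′≡y → x′≢x (inj x′∈A x∈ r (subst (R x) (sym y′≡y) xy))) , r)
             (λ a b → inj (-⊆ {p = A} a) (-⊆ {p = A} b))))

  -- If y had no preimage, `A` would inject into `B - y`, which is smaller than `A`.
  ∣∣-surjective : ∀ {ℓ} {R : Fin m → Fin n → Set ℓ} (A : Subset m) (B : Subset n) →
    (∀ x y → Dec (R x y)) →
    (∀ {x} → x ∈ A → ∃ λ y → y ∈ B × R x y) →
    (∀ {x x′ y} → x ∈ A → x′ ∈ A → R x y → R x′ y → x ≡ x′) → ∣ B ∣ ≤ ∣ A ∣ →
    ∀ {y} → y ∈ B → ∃ λ x → x ∈ A × R x y
  ∣∣-surjective {R = R} A B R? tot inj le {y} y∈ with any? (λ x → (x ∈? A) ×-dec R? x y)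
  ... | yes h = h
  ... | no ¬h = contradiction (≤-trans (≤-reflexive (sym (∣-∣ y∈))) le) (≤⇒≯ (∣∣-injective {R = R} A (B - y)
      (λ x∈ → let z , z∈ , r = tot x∈ in z , ∈-⁺ z∈ (λ z≡y → ¬h (_ , x∈ , subst (R _) z≡y r)) , r) inj))

-- Matroids

-- For independent `I` this is membership in the closure. The first disjunct is separate because
-- `I ⊹ x` is `I` itself when x ∈ I.
Spanned : (M : Matroid) → Subset (size M) → Fin (size M) → Set
Spanned M I x = x ∈ I ⊎ ¬ Indep M (I ⊹ x)

Spanned? : ∀ M I x → Dec (Spanned M I x)
Spanned? M I x = (x ∈? I) ⊎-dec ¬? (Indep? M (I ⊹ x))

-- An independent set is a flat exactly when each further element extends it independently, which
-- removes the rank from the definition. The flat is taken in the restriction to `G`.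
record Claw (M : Matroid) (G S : Subset (size M)) : Set where
  field
    claw⊆      : S ⊆ G
    claw-indep : Indep M S
    claw-ext   : ∀ {e} → e ∈ G → e ∉ S → Indep M (S ⊹ e)
open Claw public

NoClaw : (M : Matroid) → Subset (size M) → ℕ → Set
NoClaw M G k = ∀ {S} → Claw M G S → ∣ S ∣ ≢ k

-- The case x = y rules out loops, the other cases parallel pairs.
Simple : (M : Matroid) → Subset (size M) → Set
Simple M G = ∀ {x y} → x ∈ G → y ∈ G → Indep M (⁅ x ⁆ ⊹ y)

record Basis (M : Matroid) (G B : Subset (size M)) : Set where
  field
    basis⊆      : B ⊆ G
    basis-indep : Indep M B
    basis-spans : ∀ {x} → x ∈ G → Spanned M B x
open Basis public

module _ (M : Matroid) where
  private variable
    I J K X G B : Subset (size M)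
    x y : Fin (size M)

  aug-to : Indep M I → Indep M J → ∣ I ∣ ≤ ∣ J ∣ →
           ∃ λ K → I ⊆ K × K ⊆ I ∪ J × Indep M K × ∣ K ∣ ≡ ∣ J ∣
  aug-to {I} {J} indI indJ le = go (∣ J ∣ ∸ ∣ I ∣) I indI (sym (m∸n+n≡m le))
    where
    go : ∀ k I → Indep M I → ∣ J ∣ ≡ k + ∣ I ∣ →
         ∃ λ K → I ⊆ K × K ⊆ I ∪ J × Indep M K × ∣ K ∣ ≡ ∣ J ∣
    go zero I indI eq = I , id , ∈∪ˡ , indI , sym eq
    go (suc k) I indI eq =
      let e , e∈J , e∉I , ind = augment M indI indJ (≤-trans (s≤s (m≤n+m ∣ I ∣ k)) (≤-reflexive (sym eq)))
          K , I⊆ , K⊆ , indK , eqK = go k (I ⊹ e) ind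
              (trans eq (trans (sym (+-suc k ∣ I ∣)) (cong (k +_) (sym (∣⊹∣ I e∉I)))))
      in K , I⊆ ∘ ∈∪ˡ , ∪-lub (⊹-lub ∈∪ˡ (∈∪ʳ e∈J)) ∈∪ʳ ∘ K⊆ , indK , eqK

  -- Enlarge `J ⊹ y` from `I` to a set `Q` of size |I|. It contains y and lies in `I ⊹ y`, so it
  -- misses exactly one element e of `I`.
  exchange : Indep M I → J ⊆ I → y ∉ I → Indep M (J ⊹ y) → ¬ Indep M (I ⊹ y) →
             ∃ λ e → e ∈ I × e ∉ J × Indep M ((I - e) ⊹ y)
  exchange {I} {J} {y} indI J⊆I y∉I indJy depIy = e , e∈I , e∉J , ⊆-indep M -⊹⊆Q indQ
    where
    J<I : suc ∣ J ∣ ≤ ∣ I ∣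
    J<I = let x , x∈I , x∉J = ⊈⇒∃ {p = I} {q = J} (λ I⊆J → depIy (⊆-indep M (⊹-mono I⊆J) indJy))
          in p⊂q⇒∣p∣<∣q∣ (J⊆I , x , x∈I , x∉J)
    extension = aug-to indJy indI (≤-trans (≤-reflexive (∣⊹∣ J (y∉I ∘ J⊆I))) J<I)
    Q = proj₁ extension
    J⊆Q : J ⊹ y ⊆ Q
    J⊆Q = proj₁ (proj₂ extension)
    Q⊆ : Q ⊆ (J ⊹ y) ∪ I
    Q⊆ = proj₁ (proj₂ (proj₂ extension))
    indQ = proj₁ (proj₂ (proj₂ (proj₂ extension)))
    ∣Q∣ = proj₂ (proj₂ (proj₂ (proj₂ extension)))
    dropped : ∃ λ e → e ∈ I × e ∉ Q
    dropped = ⊈⇒∃ λ I⊆Q → depIy (⊆-indep M (⊹-lub I⊆Q (J⊆Q ∈⊹ʳ)) indQ)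
    e = proj₁ dropped
    e∈I = proj₁ (proj₂ dropped)
    e∉Q = proj₂ (proj₂ dropped)
    e∉J : e ∉ J
    e∉J = e∉Q ∘ J⊆Q ∘ ∈∪ˡ
    Q⊆-⊹ : Q ⊆ (I - e) ⊹ y
    Q⊆-⊹ x∈Q = [ (λ x∈Jy → [ (λ x∈J → ∈∪ˡ (∈-⁺ (J⊆I x∈J) x≢e)) ,
        (λ x≡y → subst (_∈ (I - e) ⊹ y) (sym x≡y) ∈⊹ʳ) ]′ (∈⊹⁻ J x∈Jy))
                 , (λ x∈I → ∈∪ˡ (∈-⁺ x∈I x≢e)) ]′ (x∈p∪q⁻ (J ⊹ y) I (Q⊆ x∈Q))
      where x≢e = ∈∉⇒≢ x∈Q e∉Q
    -⊹⊆Q : (I - e) ⊹ y ⊆ Q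
    -⊹⊆Q = ⊆∧∣∣≥⇒⊇ Q⊆-⊹ (≤-reflexive
        (trans (∣⊹∣ (I - e) (y∉I ∘ -⊆ {p = I})) (trans (sym (∣-∣ e∈I)) (sym ∣Q∣))))

  -- The fundamental circuit of y over `I` is unique. Otherwise `exchange` would remove some e
  -- outside the intersection, hence outside one of J₁ and J₂, and that set together with y would
  -- survive inside an independent set.
  dep-∩ : ∀ J₁ J₂ → Indep M I → y ∉ I → J₁ ⊆ I → J₂ ⊆ I →
          ¬ Indep M (J₁ ⊹ y) → ¬ Indep M (J₂ ⊹ y) → ¬ Indep M ((J₁ ∩ J₂) ⊹ y)
  dep-∩ {I} {y} J₁ J₂ indI y∉I J₁⊆I J₂⊆I dep₁ dep₂ ind =
    let e , e∈I , e∉∩ , ind′ = exchange indI (J₁⊆I ∘ p∩q⊆p J₁ J₂) y∉I ind (dep₁ ∘ ⊆-indep M (⊹-mono J₁⊆I))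
    in split (e ∈? J₁)
         (λ e∈J₁ → dep₂ (⊆-indep M (⊹-mono λ x∈ → ∈-⁺ (J₂⊆I x∈) (∈∉⇒≢ x∈ λ e∈J₂ → e∉∩ (x∈p∩q⁺ (e∈J₁ , e∈J₂))))
             ind′))
         (λ e∉J₁ → dep₁ (⊆-indep M (⊹-mono λ x∈ → ∈-⁺ (J₁⊆I x∈) (∈∉⇒≢ x∈ e∉J₁)) ind′))

  span-bound : Indep M I → Indep M K → (∀ {x} → x ∈ K → Spanned M I x) → ∣ K ∣ ≤ ∣ I ∣
  span-bound indI indK sp = ≮⇒≥ λ lt → let e , e∈K , e∉I , ind = augment M indI indK lt in
    [ e∉I , (λ dep → dep ind) ]′ (sp e∈K)

  span-mono : I ⊆ J → Spanned M I x → Spanned M J x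
  span-mono I⊆J (inj₁ x∈) = inj₁ (I⊆J x∈)
  span-mono I⊆J (inj₂ dep) = inj₂ (dep ∘ ⊆-indep M (⊹-mono I⊆J))

  span-trans : Indep M I → Indep M X → (∀ {x} → x ∈ X → Spanned M I x) → Spanned M X y → Spanned M I y
  span-trans indI indX sp (inj₁ y∈) = sp y∈
  span-trans {I} {X} {y} indI indX sp (inj₂ dep) with y ∈? I | Indep? M (I ⊹ y)
  ... | yes y∈ | _ = inj₁ y∈
  ... | no _ | no dep′ = inj₂ dep′
  -- With `I ⊹ y` independent, `X` can be enlarged from it to |I| + 1 elements. The result misses y
  -- because `X ⊹ y` is dependent, so it is spanned by `I` and too large.
  ... | no y∉ | yes ind =
    let K , X⊆K , K⊆ , indK , ∣K∣ = aug-to indX ind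
            (≤-trans (span-bound indI indX sp) (p⊆q⇒∣p∣≤∣q∣ (∈∪ˡ {p = I})))
        y∉K = λ y∈K → dep (⊆-indep M (⊹-lub X⊆K y∈K) indK)
        spK : ∀ {x} → x ∈ K → Spanned M I x
        spK = λ x∈K → [ sp , (λ x∈Iy → [ inj₁ , (λ { refl → contradiction x∈K y∉K }) ]′ (∈⊹⁻ I x∈Iy)) ]′
                         (x∈p∪q⁻ X (I ⊹ y) (K⊆ x∈K))
    in contradiction (≤-trans (≤-reflexive (trans (sym (∣⊹∣ I y∉)) (sym ∣K∣))) (span-bound indI indK spK))
        (<-irrefl refl)

  basis-bound : Basis M G B → I ⊆ G → Indep M I → ∣ I ∣ ≤ ∣ B ∣
  basis-bound bas I⊆G indI = span-bound (basis-indep bas) indI (basis-spans bas ∘ I⊆G)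

  basis-size : ∀ {B₁ B₂} → Basis M G B₁ → Basis M G B₂ → ∣ B₁ ∣ ≡ ∣ B₂ ∣
  basis-size b₁ b₂ = ≤-antisym (basis-bound b₂ (basis⊆ b₁) (basis-indep b₁))
      (basis-bound b₁ (basis⊆ b₂) (basis-indep b₂))

  basis-extend : I ⊆ G → Indep M I → ∃ λ B → I ⊆ B × Basis M G B
  basis-extend {I} {G} I⊆G indI =
    let B , I⊆B , (B⊆G , indB) , max = maximal (λ X → (X ⊆? G) ×-dec Indep? M X) I ((λ {x} → I⊆G {x}) , indI)
    in B , I⊆B , record
      { basis⊆ = B⊆G
      ; basis-indep = indB
      ; basis-spans = λ {x} x∈G → spans B B⊆G max x∈G
      }
    where
    spans : ∀ B → B ⊆ G → (∀ {e} → e ∉ B → ¬ (B ⊹ e ⊆ G × Indep M (B ⊹ e))) → ∀ {x} → x ∈ G → Spanned M B x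
    spans B B⊆G max {x} x∈G with x ∈? B
    ... | yes x∈B = inj₁ x∈B
    ... | no x∉B = inj₂ λ ind → max x∉B ((λ {z} → ⊹-lub B⊆G x∈G {z}) , ind)

  indep-⁅⁆ : Simple M G → x ∈ G → Indep M ⁅ x ⁆
  indep-⁅⁆ simple x∈ = ⊆-indep M ∈∪ˡ (simple x∈ x∈)

  -- The elements of S are not removed: they become loops.
  contract : ∀ S → Indep M S → Matroid
  contract S indS = record
    { size    = size M
    ; Indep   = λ X → X ⊆ ∁ S × Indep M (S ∪ X)
    ; Indep?  = λ X → (X ⊆? ∁ S) ×-dec Indep? M (S ∪ X)
    ; ⊥-indep = ⊥⊆ , ⊆-indep M (∪-lub id ⊥⊆) indS
    ; ⊆-indep = λ I⊆J (p , q) → (λ {x} → p ∘ I⊆J {x}) , ⊆-indep M (∪-lub ∈∪ˡ (∈∪ʳ ∘ I⊆J)) q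
    ; augment = aug
    }
    where
    ∣S∪∣ : ∀ X → X ⊆ ∁ S → ∣ S ∪ X ∣ ≡ ∣ S ∣ + ∣ X ∣
    ∣S∪∣ X X⊆ = ∣∪∣-disjoint S X λ x∈S x∈X → x∈∁p⇒x∉p (X⊆ x∈X) x∈S
    aug : ∀ {I J} → I ⊆ ∁ S × Indep M (S ∪ I) → J ⊆ ∁ S × Indep M (S ∪ J) → ∣ I ∣ < ∣ J ∣ →
          ∃ λ e → e ∈ J × e ∉ I × I ⊹ e ⊆ ∁ S × Indep M (S ∪ (I ⊹ e))
    aug {I} {J} (I⊆ , indI) (J⊆ , indJ) lt =
      let e , e∈ , e∉ , ind = augment M indI indJ
              (subst₂ _<_ (sym (∣S∪∣ I I⊆)) (sym (∣S∪∣ J J⊆)) (+-monoʳ-< ∣ S ∣ lt))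
          e∈J = [ (λ e∈S → contradiction (∈∪ˡ e∈S) e∉) , id ]′ (x∈p∪q⁻ S J e∈)
      in e , e∈J , e∉ ∘ ∈∪ʳ , (λ {x} → ⊹-lub I⊆ (J⊆ e∈J) {x}) ,
         ⊆-indep M (∪-lub (∈∪ˡ ∘ ∈∪ˡ) (⊹-mono ∈∪ʳ)) ind

-- The function f

module _ (r t : ℕ) .{{_ : NonZero t}} where
  -- The sum (t - a) * 2^q + a * 2^(q + 1) collapses to (t + a) * 2^q. Keeping t on the left avoids
  -- truncated subtraction.
  f+t : f r t + t ≡ (t + r % t) * 2 ^ (r / t)
  f+t = begin
    f r t + t                                   ≡⟨ cong (_+ t) (f-explicit r t) ⟩
    (t ∸ a) * P + a * (2 * P) ∸ t + t           ≡⟨ m∸n+n≡m t≤ ⟩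
    (t ∸ a) * P + a * (2 * P)                   ≡⟨ solve 3
        (λ d a P → d :* P :+ a :* (con 2 :* P) := ((d :+ a) :+ a) :* P) refl (t ∸ a) a P ⟩
    (t ∸ a + a + a) * P                         ≡⟨ cong (λ s → (s + a) * P) t∸a+a≡t ⟩
    (t + a) * P                                 ∎
    where
    open ≡-Reasoning
    open +-*-Solver
    a = r % t
    P = 2 ^ (r / t)
    t∸a+a≡t : t ∸ a + a ≡ t
    t∸a+a≡t = m∸n+n≡m (<⇒≤ (m%n<n r t))
    t≤ : t ≤ (t ∸ a) * P + a * (2 * P)
    t≤ = ≤-trans (≤-reflexive (trans (sym t∸a+a≡t)
        (cong₂ _+_ (sym (*-identityʳ (t ∸ a))) (sym (*-identityʳ a)))))
           (+-mono-≤ (*-monoʳ-≤ (t ∸ a) (m^n>0 2 (r / t))) (*-monoʳ-≤ a (m^n>0 2 (suc (r / t)))))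

  f-small : r < t → f r t ≡ r
  f-small r<t = +-cancelʳ-≡ t (f r t) r (begin
    f r t + t                    ≡⟨ f+t ⟩
    (t + r % t) * 2 ^ (r / t)    ≡⟨ cong₂ (λ a q → (t + a) * 2 ^ q) (m<n⇒m%n≡m r<t) (m<n⇒m/n≡0 r<t) ⟩
    (t + r) * 1                  ≡⟨ *-identityʳ (t + r) ⟩
    t + r                        ≡⟨ +-comm t r ⟩
    r + t                        ∎)
    where open ≡-Reasoning

  [t+r]/t : (t + r) / t ≡ suc (r / t)
  [t+r]/t = trans (m/n≡1+[m∸n]/n (m≤m+n t r)) (cong (λ x → suc (x / t)) (m+n∸m≡n t r))

-- Raising the rank by t keeps the remainder and raises the quotient by one, so `f r t + t` doubles.
f-step : ∀ r t .{{_ : NonZero t}} → f (t + r) t ≡ t + 2 * f r t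
f-step r t = +-cancelʳ-≡ t _ _ (begin
  f (t + r) t + t                         ≡⟨ f+t (t + r) t ⟩
  (t + (t + r) % t) * 2 ^ ((t + r) / t)   ≡⟨ cong₂ (λ a q → (t + a) * 2 ^ q)
      (trans (cong (_% t) (+-comm t r)) ([m+n]%n≡m%n r t)) ([t+r]/t r t) ⟩
  (t + r % t) * (2 * 2 ^ (r / t))         ≡⟨ solve 2 (λ x P → x :* (con 2 :* P) := con 2 :* (x :* P)) refl
      (t + r % t) (2 ^ (r / t)) ⟩
  2 * ((t + r % t) * 2 ^ (r / t))         ≡⟨ cong (2 *_) (f+t r t) ⟨
  2 * (f r t + t)                         ≡⟨ solve 2 (λ x t → con 2 :* (x :+ t) := (t :+ con 2 :* x) :+ t)
      refl (f r t) t ⟩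
  t + 2 * f r t + t                       ∎)
  where
  open ≡-Reasoning
  open +-*-Solver

step-rec : ∀ t .{{_ : NonZero t}} {ℓ} (P : ℕ → Set ℓ) → (∀ r → r < t → P r) → (∀ r → P r → P (t + r)) → ∀ r →
    P r
step-rec t@(suc _) P small step = <-rec P λ r rec → split (r <? t) (small r) λ r≮t →
  let t≤r = ≮⇒≥ r≮t in
  subst P (m+[n∸m]≡n t≤r) (step (r ∸ t) (rec (∸-monoʳ-< (s≤s z≤n) t≤r)))

f-zero : ∀ t .{{_ : NonZero t}} → f 0 t ≡ 0
f-zero t@(suc _) = f-small 0 t (s≤s z≤n)

f-mono : ∀ t .{{_ : NonZero t}} r → f r t < f (suc r) t
f-mono t = step-rec t (λ r → f r t < f (suc r) t) small step
  where
  small : ∀ r → r < t → f r t < f (suc r) t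
  small r r<t with m≤n⇒m<n∨m≡n r<t
  ... | inj₁ lt = ≤-reflexive (trans (cong suc (f-small r t r<t)) (sym (f-small (suc r) t lt)))
  -- The boundary r + 1 = t, where the quotient first becomes 1: the value comes from `f-step` at
  -- rank 0.
  ... | inj₂ refl = ≤-reflexive (begin
    suc (f r t)            ≡⟨ cong suc (f-small r t r<t) ⟩
    suc r                  ≡⟨ +-identityʳ (suc r) ⟨
    suc r + 2 * 0          ≡⟨ cong (λ x → suc r + 2 * x) (f-zero (suc r)) ⟨
    t + 2 * f 0 t          ≡⟨ f-step 0 t ⟨
    f (t + 0) t            ≡⟨ cong (λ x → f x t) (+-identityʳ t) ⟩
    f (suc r) t            ∎)
    where open ≡-Reasoning
  step : ∀ r → f r t < f (suc r) t → f (t + r) t < f (suc (t + r)) t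
  step r lt = subst₂ _<_ (sym (f-step r t)) (trans (sym (f-step (suc r) t)) (cong (λ x → f x t) (+-suc t r)))
                (+-monoʳ-< t (*-monoʳ-< 2 lt))

r≤f : ∀ t .{{_ : NonZero t}} r → r ≤ f r t
r≤f t zero = z≤n
r≤f t (suc r) = ≤-<-trans (r≤f t r) (f-mono t r)

-- Taking t + 1 off the rank on the left and t off the rank on the right leaves r against r + 1; the
-- strict growth in `f-mono`, doubled, outweighs the larger additive term.
f-anti : ∀ t .{{_ : NonZero t}} r → suc t ≤ r → f r (suc t) < f r t
f-anti t r = step-rec (suc t) P small step r
  where
  P : ℕ → Set
  P r = suc t ≤ r → f r (suc t) < f r t
  small : ∀ r → r < suc t → P r
  small r lt le = contradiction lt (≤⇒≯ le)
  weak : ∀ r → P r → f r (suc t) ≤ f r t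
  weak r ih = split (suc t ≤? r) (<⇒≤ ∘ ih) λ t≰r → ≤-trans (≤-reflexive (f-small r (suc t) (≰⇒> t≰r)))
      (r≤f t r)
  step : ∀ r → P r → P (suc t + r)
  step r ih _ = begin-strict
    f (suc t + r) (suc t)      ≡⟨ f-step r (suc t) ⟩
    suc (t + 2 * f r (suc t))  <⟨ ≤-refl ⟩
    suc (suc (t + 2 * f r (suc t)))  ≡⟨ solve 2
        (λ t x → con 2 :+ (t :+ con 2 :* x) := t :+ con 2 :* (con 1 :+ x)) refl t (f r (suc t)) ⟩
    t + 2 * suc (f r (suc t))  ≤⟨ +-monoʳ-≤ t (*-monoʳ-≤ 2 (≤-<-trans (weak r ih) (f-mono t r))) ⟩
    t + 2 * f (suc r) t        ≡⟨ f-step (suc r) t ⟨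
    f (t + suc r) t            ≡⟨ cong (λ x → f x t) (+-suc t r) ⟩
    f (suc t + r) t            ∎
    where
    open ≤-Reasoning
    open +-*-Solver

f-one : ∀ r → f r 1 + 1 ≡ 2 ^ r
f-one zero = cong (_+ 1) (f-zero 1)
f-one (suc r) = begin
  f (1 + r) 1 + 1       ≡⟨ cong (_+ 1) (f-step r 1) ⟩
  1 + 2 * f r 1 + 1     ≡⟨ solve 1 (λ x → con 1 :+ con 2 :* x :+ con 1 := con 2 :* (x :+ con 1)) refl (f r 1)
      ⟩
  2 * (f r 1 + 1)       ≡⟨ cong (2 *_) (f-one r) ⟩
  2 * 2 ^ r             ∎
  where
  open ≡-Reasoning
  open +-*-Solver

-- Contraction by a claw and the lower bound

-- For a claw `S`, no element of `G` outside `S` is a loop of M / S, and `T` picks one element of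
-- each parallel class. Restricted to `T`, M / S is the simplification N.
record Transversal (M : Matroid) (G S T : Subset (size M)) : Set where
  field
    T⊆G    : T ⊆ G
    T∌S    : ∀ {x} → x ∈ T → x ∉ S
    T-pair : ∀ {x y} → x ∈ T → y ∈ T → x ≢ y → Indep M (S ⊹ x ⊹ y)
    T-cover : ∀ {x} → x ∈ G → x ∉ S → x ∉ T → ∃ λ y → y ∈ T × ¬ Indep M (S ⊹ y ⊹ x)
open Transversal public

module _ (M : Matroid) (G : Subset (size M)) where
  Claw? : ∀ S → Dec (Claw M G S)
  Claw? S with S ⊆? G | Indep? M S | any? (λ e → (e ∈? G) ×-dec ¬? (e ∈? S) ×-dec ¬? (Indep? M (S ⊹ e)))
  ... | no ¬p | _ | _ = no (¬p ∘ claw⊆)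
  ... | _ | no ¬p | _ = no (¬p ∘ claw-indep)
  ... | _ | _ | yes (e , e∈ , e∉ , dep) = no λ c → dep (claw-ext c e∈ e∉)
  ... | yes p | yes q | no ¬h = yes record
    { claw⊆ = p ; claw-indep = q
    ; claw-ext = λ {e} e∈ e∉ → decidable-stable (Indep? M (S ⊹ e)) λ dep → ¬h (e , e∈ , e∉ , dep) }

  extension-of-nonclaw : ∀ S → S ⊆ G → Indep M S → ¬ Claw M G S → ∃ λ e → e ∈ G × e ∉ S × ¬ Indep M (S ⊹ e)
  extension-of-nonclaw S S⊆G ind ¬claw
    with any? (λ e → (e ∈? G) ×-dec ¬? (e ∈? S) ×-dec ¬? (Indep? M (S ⊹ e)))
  ... | yes h = h
  ... | no ¬h = contradiction (record
    { claw⊆ = S⊆G ; claw-indep = ind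
    ; claw-ext = λ {e} e∈ e∉ → decidable-stable (Indep? M (S ⊹ e)) λ dep → ¬h (e , e∈ , e∉ , dep) }) ¬claw

  singleton-claw : Simple M G → ∀ {x} → x ∈ G → Claw M G ⁅ x ⁆
  singleton-claw simple x∈ = record
    { claw⊆ = ⁅⁆⊆ x∈ ; claw-indep = indep-⁅⁆ M simple x∈ ; claw-ext = λ e∈ _ → simple x∈ e∈ }

  transversal : ∀ {S} → Claw M G S → ∃ (Transversal M G S)
  transversal {S} claw =
    let T , _ , (T⊆ , pair) , max = maximal
          (λ X → (X ⊆? (G ─ S)) ×-dec all?
              (λ x → all? λ y → (x ∈? X) →-dec ((y ∈? X) →-dec (¬? (x ≟ᶠ y) →-dec Indep? M (S ⊹ x ⊹ y)))))
          ⊥ ((λ {x} → ⊥⊆ {x = x}) , λ x y x∈ → contradiction x∈ ∉⊥)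
    in T , record
      { T⊆G = proj₁ ∘ ∈─⁻ G S ∘ T⊆
      ; T∌S = proj₂ ∘ ∈─⁻ G S ∘ T⊆
      ; T-pair = λ {x} {y} → pair x y
      ; T-cover = cover T T⊆ pair max
      }
    where
    Pairs : Subset (size M) → Set
    Pairs X = ∀ x y → x ∈ X → y ∈ X → x ≢ y → Indep M (S ⊹ x ⊹ y)
    cover : ∀ T → T ⊆ G ─ S → Pairs T → (∀ {e} → e ∉ T → ¬ (T ⊹ e ⊆ G ─ S × Pairs (T ⊹ e))) →
            ∀ {x} → x ∈ G → x ∉ S → x ∉ T → ∃ λ y → y ∈ T × ¬ Indep M (S ⊹ y ⊹ x)
    cover T T⊆ pair max {x} x∈G x∉S x∉T with any? (λ y → (y ∈? T) ×-dec ¬? (Indep? M (S ⊹ y ⊹ x)))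
    ... | yes h = h
    ... | no ¬h = contradiction ((λ {z} → ⊹-lub T⊆ (∈─⁺ x∈G x∉S) {z}) , pairs) (max x∉T)
      where
      new : ∀ y → y ∈ T → Indep M (S ⊹ y ⊹ x)
      new y y∈ = decidable-stable (Indep? M (S ⊹ y ⊹ x)) λ dep → ¬h (y , y∈ , dep)
      pairs : Pairs (T ⊹ x)
      pairs a b a∈ b∈ a≢b with ∈⊹⁻ T a∈ | ∈⊹⁻ T b∈
      ... | inj₁ a∈T | inj₁ b∈T = pair a b a∈T b∈T a≢b
      ... | inj₁ a∈T | inj₂ refl = new a a∈T
      ... | inj₂ refl | inj₁ b∈T = ⊆-indep M (⊹-lub (⊹-lub (∈∪ˡ ∘ ∈∪ˡ) ∈⊹ʳ) (∈∪ˡ ∈⊹ʳ)) (new b b∈T)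
      ... | inj₂ refl | inj₂ refl = contradiction refl a≢b

module Contraction (M : Matroid) (G S T : Subset (size M)) (simple : Simple M G)
                   (claw : Claw M G S) (tr : Transversal M G S T) where
  N : Matroid
  N = contract M S (claw-indep claw)

  private
    S⊆G = claw⊆ claw
    indS = claw-indep claw

  indep-S⊹ : ∀ {x} → x ∈ G → Indep M (S ⊹ x)
  indep-S⊹ {x} x∈ = split (x ∈? S) (λ x∈S → ⊆-indep M (⊹-lub id x∈S) indS) (claw-ext claw x∈)

  N-indep : ∀ {X} → X ⊆ T → Indep M (S ∪ X) → Indep N X
  N-indep X⊆ ind = (λ {x} x∈ → x∉p⇒x∈∁p (T∌S tr (X⊆ x∈))) , ind

  -- Exchanging x into `S ∪ (W ⊹ y)` while keeping `S` must remove y: with any other element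
  -- removed, the dependent set `S ⊹ y ⊹ x` would survive inside an independent one.
  parallel-replace : ∀ {W x y} → y ∉ S → y ∉ W → x ∈ G → x ∉ S → x ≢ y →
    ¬ Indep M (S ⊹ y ⊹ x) → Indep M (S ∪ (W ⊹ y)) → Indep M (S ∪ (W ⊹ x))
  parallel-replace {W} {x} {y} y∉S y∉W x∈G x∉S x≢y dep ind =
    case exchange M {J = S} ind ∈∪ˡ x∉I (indep-S⊹ x∈G) (dep ∘ ⊆-indep M (⊹-mono Sy⊆I)) of λ
        { (e , e∈I , e∉S , ind′) →
    split (e ≟ᶠ y)
         (λ { refl → ⊆-indep M (λ z∈ → [ (λ z∈S → ∈∪ˡ (∈-⁺ (∈∪ˡ z∈S) (∈∉⇒≢ z∈S y∉S)))
                     , (λ z∈Wx → [ (λ z∈W → ∈∪ˡ (∈-⁺ (∈∪ʳ (∈∪ˡ z∈W)) (∈∉⇒≢ z∈W y∉W)))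
                                 , (λ z≡x → subst (_∈ (I - y) ⊹ x) (sym z≡x) ∈⊹ʳ) ]′ (∈⊹⁻ W z∈Wx)) ]′
                                     (x∈p∪q⁻ S (W ⊹ x) z∈)) ind′ })
         (λ e≢y → contradiction (⊆-indep M
             (⊹-mono (⊹-lub (λ z∈ → ∈-⁺ (∈∪ˡ z∈) (∈∉⇒≢ z∈ e∉S)) (∈-⁺ (Sy⊆I ∈⊹ʳ) (e≢y ∘ sym)))) ind′) dep) }
    where
    I = S ∪ (W ⊹ y)
    Sy⊆I : S ⊹ y ⊆ I
    Sy⊆I = ⊹-lub ∈∪ˡ (∈∪ʳ ∈⊹ʳ)
    x∉I : x ∉ I
    x∉I x∈I = dep (⊆-indep M (⊹-lub Sy⊆I x∈I) ind)

  -- Were y and z different, `dep-∩` inside the independent set `S ⊹ y ⊹ z` would make `S ⊹ x`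
  -- dependent, against the claw property.
  partner-unique : ∀ {x y z} → y ∈ T → z ∈ T → x ∈ G → x ∉ T →
    ¬ Indep M (S ⊹ y ⊹ x) → ¬ Indep M (S ⊹ z ⊹ x) → y ≡ z
  partner-unique {x} {y} {z} y∈ z∈ x∈G x∉T depy depz = decidable-stable (y ≟ᶠ z) λ y≢z →
    let ind = T-pair tr y∈ z∈ y≢z
        x∉S = λ x∈S → depy (⊆-indep M (⊹-lub id (∈∪ˡ x∈S)) (indep-S⊹ (T⊆G tr y∈)))
        x∉I = ∉⊹ (∉⊹ x∉S (λ { refl → x∉T y∈ })) (λ { refl → x∉T z∈ })
    in dep-∩ M (S ⊹ y) (S ⊹ z) ind x∉I ∈∪ˡ (⊹-mono ∈∪ˡ) depy depz
         (⊆-indep M (⊹-mono λ {w} w∈ → let w∈y , w∈z = x∈p∩q⁻ (S ⊹ y) (S ⊹ z) w∈ in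
           [ id , (λ w≡y → [ id , (λ w≡z → contradiction (trans (sym w≡y) w≡z) y≢z) ]′ (∈⊹⁻ S w∈z)) ]′
               (∈⊹⁻ S w∈y)) (indep-S⊹ x∈G))

  N-simple : Simple N T
  N-simple {x} {y} x∈ y∈ = N-indep (⊹-lub (⁅⁆⊆ x∈) y∈)
    (split (x ≟ᶠ y)
      (λ { refl → ⊆-indep M (∪-lub ∈∪ˡ (⊹-lub (⁅⁆⊆ ∈⊹ʳ) ∈⊹ʳ)) (indep-S⊹ (T⊆G tr x∈)) })
      (λ x≢y → ⊆-indep M (∪-lub (∈∪ˡ ∘ ∈∪ˡ) (⊹-lub (⁅⁆⊆ (∈∪ˡ ∈⊹ʳ)) ∈⊹ʳ)) (T-pair tr x∈ y∈ x≢y)))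

  N-basis : ∀ {B} → Basis N T B → Basis M G (S ∪ B)
  N-basis {B} bas = record
    { basis⊆ = ∪-lub S⊆G (T⊆G tr ∘ basis⊆ bas)
    ; basis-indep = indSB
    ; basis-spans = λ {x} x∈G → split (x ∈? S) (inj₁ ∘ ∈∪ˡ) λ x∉S → split (x ∈? T) spanT λ x∉T →
        case T-cover tr x∈G x∉S x∉T of λ { (y , y∈T , dep) →
        span-trans M indSB (indep-S⊹ (T⊆G tr y∈T))
            (λ z∈ → [ inj₁ ∘ ∈∪ˡ , (λ { refl → spanT y∈T }) ]′ (∈⊹⁻ S z∈)) (inj₂ dep) }
    }
    where
    indSB = proj₂ (basis-indep bas)
    spanT : ∀ {x} → x ∈ T → Spanned M (S ∪ B) x
    spanT {x} x∈T = [ inj₁ ∘ ∈∪ʳ , (λ dep → inj₂ λ ind → dep (N-indep (⊹-lub (basis⊆ bas) x∈T)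
        (⊆-indep M (∪-lub (∈∪ˡ ∘ ∈∪ˡ) (⊹-mono ∈∪ʳ)) ind))) ]′ (basis-spans bas x∈T)

  ∣S∪∣ : ∀ {X} → X ⊆ T → ∣ S ∪ X ∣ ≡ ∣ S ∣ + ∣ X ∣
  ∣S∪∣ {X} X⊆ = ∣∪∣-disjoint S X λ x∈S x∈X → T∌S tr (X⊆ x∈X) x∈S

  -- The case to check is e outside `S` and `T`, with representative y. If y ∉ X, swap y for e in
  -- the independent set `S ∪ (X ⊹ y)`. If y ∈ X, a circuit in `X ⊹ e` would by `dep-∩` be contained
  -- in {y, e}, against simplicity.
  claw-lift : ∀ {X} → Claw N T X → Claw M G X
  claw-lift {X} c = record
    { claw⊆ = T⊆G tr ∘ claw⊆ c
    ; claw-indep = ⊆-indep M ∈∪ʳ indSX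
    ; claw-ext = λ {e} e∈G e∉X → split (e ∈? S)
        (λ e∈S → ⊆-indep M (⊹-lub ∈∪ʳ (∈∪ˡ e∈S)) indSX) λ e∉S → split (e ∈? T)
        (λ e∈T → ⊆-indep M ∈∪ʳ (proj₂ (claw-ext c e∈T e∉X))) λ e∉T →
        case T-cover tr e∈G e∉S e∉T of λ { (y , y∈T , dep) → split (y ∈? X)
          (λ y∈X → decidable-stable (Indep? M (X ⊹ e)) λ depX →
            dep-∩ M (S ⊹ y) X indSX (λ e∈SX → [ e∉S , e∉X ]′ (x∈p∪q⁻ S X e∈SX)) (⊹-lub ∈∪ˡ (∈∪ʳ y∈X)) ∈∪ʳ dep
                depX
              (⊆-indep M (⊹-mono λ {w} w∈ → let w∈y , w∈X = x∈p∩q⁻ (S ⊹ y) X w∈ in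
                [ (λ w∈S → contradiction w∈S (x∈∁p⇒x∉p (proj₁ (claw-indep c) w∈X))) , (λ { refl → x∈⁅x⁆ w })
                    ]′ (∈⊹⁻ S w∈y))
                (simple (T⊆G tr y∈T) e∈G)))
          (λ y∉X → ⊆-indep M ∈∪ʳ (parallel-replace (T∌S tr y∈T) y∉X e∈G e∉S (λ { refl → e∉T y∈T }) dep
              (proj₂ (claw-ext c y∈T y∉X)))) }
    }
    where
    indSX = proj₂ (claw-indep c)

  N-noclaw : ∀ {k} → NoClaw M G k → NoClaw N T k
  N-noclaw noclaw c = noclaw (claw-lift c)

  module _ (noclaw : NoClaw M G (suc ∣ S ∣)) where
    rest : Subset (size M)
    rest = (G ─ S) ─ T

    Partner : Fin (size M) → Fin (size M) → Set
    Partner y x = ¬ Indep M (S ⊹ y ⊹ x)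

    ∈rest : ∀ {x} → x ∈ rest → x ∈ G × x ∉ S × x ∉ T
    ∈rest x∈ = let x∈′ , x∉T = ∈─⁻ (G ─ S) T x∈ ; x∈G , x∉S = ∈─⁻ G S x∈′ in x∈G , x∉S , x∉T

    -- `S ⊹ y` has one element too many to be a claw. The element showing this is not in `T`, since
    -- representatives are independent in pairs over `S`.
    partner : ∀ {y} → y ∈ T → ∃ λ x → x ∈ rest × Partner y x
    partner {y} y∈ =
      case extension-of-nonclaw M G (S ⊹ y) (⊹-lub S⊆G (T⊆G tr y∈)) (indep-S⊹ (T⊆G tr y∈))
             (λ c → noclaw c (∣⊹∣ S (T∌S tr y∈))) of λ { (x , x∈G , x∉ , dep) →
      x , ∈─⁺ (∈─⁺ x∈G (x∉ ∘ ∈∪ˡ)) (λ x∈T → dep (T-pair tr y∈ x∈T λ { refl → x∉ ∈⊹ʳ })) , dep }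

    partner-injective : ∀ {y z x} → y ∈ T → z ∈ T → x ∈ rest → Partner y x → Partner z x → y ≡ z
    partner-injective y∈ z∈ x∈ p q = let x∈G , _ , x∉T = ∈rest x∈ in partner-unique y∈ z∈ x∈G x∉T p q

    ∣G∣ : ∣ G ∣ ≡ ∣ S ∣ + (∣ T ∣ + ∣ rest ∣)
    ∣G∣ = begin
      ∣ G ∣                          ≡⟨ ∣∩∣+∣─∣ G S ⟩
      ∣ G ∩ S ∣ + ∣ G ─ S ∣          ≡⟨ cong₂ _+_
          (cong ∣_∣ (⊆-antisym {i = G ∩ S} {j = S} (p∩q⊆q G S) λ x∈ → x∈p∩q⁺ (S⊆G x∈ , x∈)))
          (∣∩∣+∣─∣ (G ─ S) T) ⟩
      ∣ S ∣ + (∣ (G ─ S) ∩ T ∣ + ∣ rest ∣) ≡⟨ cong (λ X → ∣ S ∣ + (∣ X ∣ + ∣ rest ∣))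
          (⊆-antisym {i = (G ─ S) ∩ T} {j = T} (p∩q⊆q (G ─ S) T) λ x∈ →
          x∈p∩q⁺ (∈─⁺ (T⊆G tr x∈) (T∌S tr x∈) , x∈)) ⟩
      ∣ S ∣ + (∣ T ∣ + ∣ rest ∣)     ∎
      where open ≡-Reasoning

    ∣T∣≤∣rest∣ : ∣ T ∣ ≤ ∣ rest ∣
    ∣T∣≤∣rest∣ = ∣∣-injective {R = λ y x → x ∈ rest × Partner y x} T rest
      (λ y∈ → let x , x∈ , p = partner y∈ in x , x∈ , x∈ , p)
      (λ y∈ z∈ (x∈ , p) (_ , q) → partner-injective y∈ z∈ x∈ p q)

-- Strong induction on the rank, and for each rank induction on t: contracting a t-claw lowers the
-- rank, the absence of t-claws lowers t.
bound : ∀ t .{{_ : NonZero t}} M {G B} → Simple M G → Basis M G B → NoClaw M G (suc t) → f ∣ B ∣ t ≤ ∣ G ∣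
bound t M simple bas noclaw = <-rec (λ r → ∀ t → Goal r t) (λ r rec → go r (λ s s<r → rec s<r)) _ t M simple
    bas refl noclaw
  where
  Goal : ℕ → ℕ → Set₁
  Goal r t = .{{_ : NonZero t}} → ∀ M {G B} → Simple M G → Basis M G B → ∣ B ∣ ≡ r → NoClaw M G (suc t) →
      f r t ≤ ∣ G ∣

  go : ∀ r → (∀ s → s < r → ∀ t → Goal s t) → ∀ t → Goal r t
  go r rec t@(suc t′) M {G} {B} simple bas ∣B∣ noclaw = split (r <? t)
    (λ r<t → ≤-trans (≤-reflexive (trans (f-small r t r<t) (sym ∣B∣))) (p⊆q⇒∣p∣≤∣q∣ (basis⊆ bas)))
    λ r≮t → split (anySubset? (λ S → Claw? M G S ×-dec (∣ S ∣ ≟ t)))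
      (λ { (S , claw , ∣S∣) → withClaw claw ∣S∣ })
      λ ¬h → without t′ (go r rec t′) (≮⇒≥ r≮t) λ {S} c eq → ¬h (S , c , eq)
    where
    withClaw : ∀ {S} → Claw M G S → ∣ S ∣ ≡ t → f r t ≤ ∣ G ∣
    withClaw {S} claw ∣S∣ =
      case transversal M G claw of λ { (T , tr) →
      let open Contraction M G S T simple claw tr in
      case basis-extend N {G = T} (⊥⊆ {p = T}) (⊥-indep N) of λ { (B′ , _ , bas′) →
      let noclaw′ = subst (NoClaw M G ∘ suc) (sym ∣S∣) noclaw
          r≡ : r ≡ t + ∣ B′ ∣
          r≡ = trans (sym ∣B∣) (trans (basis-size M bas (N-basis bas′))
              (trans (∣S∪∣ (basis⊆ bas′)) (cong (_+ ∣ B′ ∣) ∣S∣)))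
          ih : f ∣ B′ ∣ t ≤ ∣ T ∣
          ih = rec ∣ B′ ∣ (≤-trans (s≤s (m≤n+m ∣ B′ ∣ t′)) (≤-reflexive (sym r≡))) t N N-simple bas′ refl
              (N-noclaw noclaw)
      in begin
        f r t                       ≡⟨ cong (λ x → f x t) r≡ ⟩
        f (t + ∣ B′ ∣) t             ≡⟨ f-step ∣ B′ ∣ t ⟩
        t + 2 * f ∣ B′ ∣ t           ≤⟨ +-monoʳ-≤ t (*-monoʳ-≤ 2 ih) ⟩
        t + 2 * ∣ T ∣               ≤⟨ +-monoʳ-≤ t
            (+-monoʳ-≤ ∣ T ∣ (≤-trans (≤-reflexive (+-identityʳ ∣ T ∣)) (∣T∣≤∣rest∣ noclaw′))) ⟩
        t + (∣ T ∣ + ∣ rest noclaw′ ∣) ≡⟨ cong (_+ (∣ T ∣ + ∣ rest noclaw′ ∣)) ∣S∣ ⟨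
        ∣ S ∣ + (∣ T ∣ + ∣ rest noclaw′ ∣) ≡⟨ ∣G∣ noclaw′ ⟨
        ∣ G ∣                       ∎ } }
      where open ≤-Reasoning
    without : ∀ t′ → (Goal r t′) → suc t′ ≤ r → NoClaw M G (suc t′) → f r (suc t′) ≤ ∣ G ∣
    -- At t = 1 there is no smaller t to fall back on, but singletons of a simple matroid are claws,
    -- so positive rank contradicts `no1`.
    without zero ih t≤r no1 =
      case ∣∣>0⇒∈ {p = B} (≤-trans t≤r (≤-reflexive (sym ∣B∣))) of λ { (x , x∈B) →
      contradiction (∣⁅x⁆∣≡1 x) (no1 (singleton-claw M G simple (basis⊆ bas x∈B))) }
    without (suc t″) ih t≤r nc = ≤-trans (<⇒≤ (f-anti (suc t″) r t≤r)) (ih M simple bas ∣B∣ nc)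

-- Binary projective geometries

module _ (M : Matroid) where
  private variable
    a b c d : Fin (size M)

  Collinear : (a b c : Fin (size M)) → Set
  Collinear a b c = ¬ Indep M (⁅ a ⁆ ⊹ b ⊹ c)

  collinear-swap : Collinear a b c → Collinear b a c
  collinear-swap dep = dep ∘ ⊆-indep M (⊹-mono (⊹-lub (⁅⁆⊆ ∈⊹ʳ) (∈∪ˡ (x∈⁅x⁆ _))))

  collinear-rotate : Collinear a b c → Collinear b c a
  collinear-rotate dep = dep ∘ ⊆-indep M (⊹-lub (⊹-lub (⁅⁆⊆ ∈⊹ʳ) (∈∪ˡ (∈∪ˡ (x∈⁅x⁆ _)))) (∈∪ˡ ∈⊹ʳ))

  abstract
    span : Subset (size M) → Subset (size M) → Subset (size M)
    span G I = ⟪ (λ x → (x ∈? G) ×-dec Spanned? M I x) ⟫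

    ∈span⁺ : ∀ {G I} → a ∈ G → Spanned M I a → a ∈ span G I
    ∈span⁺ {G = G} {I} a∈ sp = ∈⟪⟫⁺ (λ x → (x ∈? G) ×-dec Spanned? M I x) (a∈ , sp)

    ∈span⁻ : ∀ {G I} → a ∈ span G I → a ∈ G × Spanned M I a
    ∈span⁻ {G = G} {I} = ∈⟪⟫⁻ (λ x → (x ∈? G) ×-dec Spanned? M I x)

  module _ {G I : Subset (size M)} where
    span⊆ : span G I ⊆ G
    span⊆ = proj₁ ∘ ∈span⁻

    span-basis : I ⊆ G → Indep M I → Basis M (span G I) I
    span-basis I⊆G ind = record
      { basis⊆ = λ x∈ → ∈span⁺ (I⊆G x∈) (inj₁ x∈)
      ; basis-indep = ind
      ; basis-spans = proj₂ ∘ ∈span⁻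
      }

    span-closed : ∀ {X} → Indep M I → Indep M X → X ⊆ span G I → a ∈ G → Spanned M X a → a ∈ span G I
    span-closed indI indX X⊆ a∈ sp = ∈span⁺ a∈ (span-trans M indI indX (proj₂ ∘ ∈span⁻ ∘ X⊆) sp)

    -- An element of `G` that breaks the claw depends on it and therefore already lies in the span.
    span-noclaw : ∀ {k} → Indep M I → NoClaw M G k → NoClaw M (span G I) k
    span-noclaw indI noclaw {S} claw ∣S∣ =
      case extension-of-nonclaw M G S (span⊆ ∘ claw⊆ claw) (claw-indep claw) (λ c → noclaw c ∣S∣) of λ
          { (e , e∈ , e∉ , dep) →
      dep (claw-ext claw (span-closed indI (claw-indep claw) (claw⊆ claw) e∈ (inj₂ dep)) e∉) }

-- Equality for t = 1. Without 2-claws every line has at least three points; counting against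
-- hyperplanes shows that it has exactly three, and that coordinates are linear over the two-element
-- field.
module ProjectiveGeometry (M : Matroid) (C B₀ : Subset (size M)) (simple : Simple M C)
    (bas₀ : Basis M C B₀) (noclaw : NoClaw M C 2) (∣C∣ : ∣ C ∣ + 1 ≡ 2 ^ ∣ B₀ ∣) where

  ∣⁅a⁆⊹b∣ : ∀ {a b : Fin (size M)} → a ≢ b → ∣ ⁅ a ⁆ ⊹ b ∣ ≡ 2
  ∣⁅a⁆⊹b∣ {a} {b} a≢b = trans (∣⊹∣ ⁅ a ⁆ λ b∈ → a≢b (sym (x∈⁅y⁆⇒x≡y a b∈))) (cong suc (∣⁅x⁆∣≡1 a))

  third : ∀ {a b} → a ∈ C → b ∈ C → a ≢ b → ∃ λ c → c ∈ C × c ≢ a × c ≢ b × Collinear M a b c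
  third {a} {b} a∈ b∈ a≢b =
    case extension-of-nonclaw M C (⁅ a ⁆ ⊹ b) (⊹-lub (⁅⁆⊆ a∈) b∈) (simple a∈ b∈)
        (λ claw → noclaw claw (∣⁅a⁆⊹b∣ a≢b)) of λ { (c , c∈ , c∉ , dep) →
    c , c∈ , (λ { refl → c∉ (∈∪ˡ (x∈⁅x⁆ a)) }) , (λ { refl → c∉ ∈⊹ʳ }) , dep }

  line-collapse : ∀ {e c x x′} → e ∈ C → c ∈ C → x ≢ x′ → e ≢ x → e ≢ x′ →
                  Collinear M e c x → Collinear M e c x′ → Collinear M x x′ e
  line-collapse {e} {c} {x} {x′} e∈ c∈ x≢x′ e≢x e≢x′ col col′ ind = contradiction
    (≤-trans (≤-reflexive (sym (trans (∣⊹∣ (⁅ x ⁆ ⊹ x′) (∉⊹ (λ e∈x → e≢x (x∈⁅y⁆⇒x≡y x e∈x)) e≢x′))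
        (cong suc (∣⁅a⁆⊹b∣ x≢x′)))))
      (≤-trans (span-bound M {I = ⁅ e ⁆ ⊹ c} (simple e∈ c∈) ind λ y∈ →
          [ (λ y∈xx → [ (λ y∈x → inj₂ (subst (Collinear M e c) (sym (x∈⁅y⁆⇒x≡y x y∈x)) col))
                      , (λ { refl → inj₂ col′ }) ]′ (∈⊹⁻ ⁅ x ⁆ y∈xx))
          , (λ { refl → inj₁ (∈∪ˡ (x∈⁅x⁆ e)) }) ]′ (∈⊹⁻ (⁅ x ⁆ ⊹ x′) y∈))
        (≤-trans (SubsetLemmas.∣p∪⁅e⁆∣≤ ⁅ e ⁆ c) (≤-reflexive (cong suc (∣⁅x⁆∣≡1 e))))))
    λ { (s≤s (s≤s ())) }

  -- For e outside H, sending x ∈ H to a third point on the line e x injects H into the complement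
  -- of H + e.  By the size of C this is a bijection, so that every line meets H in one point or lies in H.
  module Hyperplane {B : Subset (size M)} {b : Fin (size M)} (bas : Basis M C B) (b∈B : b ∈ B) where
    I H : Subset (size M)
    I = B - b
    H = span M C I

    indI : Indep M I
    indI = ⊆-indep M (-⊆ {p = B}) (basis-indep bas)

    I⊆C : I ⊆ C
    I⊆C = basis⊆ bas ∘ -⊆ {p = B}

    H-line : ∀ {x y z} → x ∈ H → y ∈ H → z ∈ C → Collinear M x y z → z ∈ H
    H-line x∈ y∈ z∈ col = span-closed M indI (simple (span⊆ M x∈) (span⊆ M y∈)) (⊹-lub (⁅⁆⊆ x∈) y∈) z∈
        (inj₂ col)

    module _ {e : Fin (size M)} (e∈ : e ∈ C) (e∉H : e ∉ H) where
      E : Subset (size M)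
      E = (C ─ H) - e

      ∈E⁻ : ∀ {z} → z ∈ E → z ∈ C × z ∉ H × z ≢ e
      ∈E⁻ z∈ = let z∈′ , z≢e = ∈-⁻ {p = C ─ H} z∈ ; z∈C , z∉H = ∈─⁻ C H z∈′ in z∈C , z∉H , z≢e

      third∈E : ∀ {x c} → x ∈ H → c ∈ C → c ≢ e → Collinear M e x c → c ∈ E
      third∈E x∈ c∈ c≢e col = ∈-⁺ (∈─⁺ c∈ λ c∈H → e∉H (H-line x∈ c∈H e∈ (collinear-rotate M col))) c≢e

      unique : ∀ {x x′ c} → x ∈ H → x′ ∈ H → c ∈ C → Collinear M e x c → Collinear M e x′ c → x ≡ x′
      unique {x} {x′} x∈ x′∈ c∈ col col′ = decidable-stable (x ≟ᶠ x′) λ x≢x′ →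
        e∉H (H-line x∈ x′∈ e∈ (line-collapse e∈ c∈ x≢x′ (λ { refl → e∉H x∈ }) (λ { refl → e∉H x′∈ })
          (flip-col col) (flip-col col′)))
        where
        flip-col : ∀ {y c} → Collinear M e y c → Collinear M e c y
        flip-col = collinear-swap M ∘ collinear-rotate M ∘ collinear-rotate M

      third-H : ∀ {x} → x ∈ H → ∃ λ c → c ∈ E × Collinear M e x c
      third-H x∈ = case third e∈ (span⊆ M x∈) (λ { refl → e∉H x∈ }) of λ { (c , c∈ , c≢e , _ , col) →
        c , third∈E x∈ c∈ c≢e col , col }

      -- With ρ the rank, the bound for t = 1 gives |H| + 1 ≥ 2^(ρ - 1), while |C| + 1 = 2^ρ. So at
      -- most |H| + 1 points lie outside `H`, and e is one of them.
      ∣E∣≤∣H∣ : ∣ E ∣ ≤ ∣ H ∣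
      ∣E∣≤∣H∣ = +-cancelˡ-≤ (suc (suc ∣ H ∣)) ∣ E ∣ ∣ H ∣ (begin
        suc (suc ∣ H ∣) + ∣ E ∣        ≡⟨ cong suc (+-suc ∣ H ∣ ∣ E ∣) ⟨
        suc (∣ H ∣ + suc ∣ E ∣)        ≡⟨ cong (λ x → suc (∣ H ∣ + x)) (∣-∣ (∈─⁺ e∈ e∉H)) ⟨
        suc (∣ H ∣ + ∣ C ─ H ∣)        ≡⟨ cong (λ X → suc (∣ X ∣ + ∣ C ─ H ∣))
            (⊆-antisym {i = C ∩ H} {j = H} (p∩q⊆q C H) (λ x∈ → x∈p∩q⁺ (span⊆ M x∈ , x∈))) ⟨
        suc (∣ C ∩ H ∣ + ∣ C ─ H ∣)    ≡⟨ cong suc (∣∩∣+∣─∣ C H) ⟨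
        suc ∣ C ∣                      ≡⟨ +-comm 1 ∣ C ∣ ⟩
        ∣ C ∣ + 1                      ≡⟨ ∣C∣ ⟩
        2 ^ ∣ B₀ ∣                     ≡⟨ cong (2 ^_) (trans (basis-size M bas₀ bas) (∣-∣ b∈B)) ⟩
        2 * 2 ^ ∣ I ∣                  ≡⟨ cong (2 *_) (f-one ∣ I ∣) ⟨
        2 * (f ∣ I ∣ 1 + 1)            ≤⟨ *-monoʳ-≤ 2
            (+-monoˡ-≤ 1 (bound 1 M (λ x∈ y∈ → simple (span⊆ M x∈) (span⊆ M y∈)) (span-basis M I⊆C indI)
            (span-noclaw M indI noclaw))) ⟩
        2 * (∣ H ∣ + 1)                ≡⟨ cong₂ _+_ (+-comm ∣ H ∣ 1) (trans (+-identityʳ _) (+-comm ∣ H ∣ 1))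
            ⟩
        suc ∣ H ∣ + suc ∣ H ∣          ≡⟨ cong suc (+-suc ∣ H ∣ ∣ H ∣) ⟩
        suc (suc ∣ H ∣) + ∣ H ∣        ∎)
        where open ≤-Reasoning

      -- `Q` prescribes which third point is assigned to x. Every assignment is injective by
      -- `unique` and hence onto `E` by counting, whatever values are prescribed.
      hits : ∀ {ℓ} {Q : Fin (size M) → Fin (size M) → Set ℓ} → (∀ x y → Dec (Q x y)) →
             (∀ {x} → x ∈ H → ∃ λ c → c ∈ E × Collinear M e x c × Q x c) →
             ∀ {c} → c ∈ E → ∃ λ x → x ∈ H × Collinear M e x c × Q x c
      hits {Q = Q} Q? tot c∈ =
        case ∣∣-surjective {R = λ x c → c ∈ E × Collinear M e x c × Q x c} H E
               (λ x c → (c ∈? E) ×-dec ¬? (Indep? M _) ×-dec Q? x c)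
               (λ x∈ → case tot x∈ of λ { (c , c∈ , r) → c , c∈ , c∈ , r })
               (λ { x∈ x′∈ (c∈ , col , _) (_ , col′ , _) → unique x∈ x′∈ (proj₁ (∈E⁻ c∈)) col col′ })
               ∣E∣≤∣H∣ c∈ of λ { (x , x∈ , _ , r) → x , x∈ , r }

      hit : ∀ {c} → c ∈ C → c ∉ H → c ≢ e → ∃ λ x → x ∈ H × Collinear M e x c
      hit c∈ c∉ c≢e = case hits {Q = λ x _ → x ≡ x} (λ _ _ → yes refl)
          (λ x∈ → case third-H x∈ of λ { (c , c∈ , col) → c , c∈ , col , refl }) (∈-⁺ (∈─⁺ c∈ c∉) c≢e) of
        λ { (x , x∈ , col , _) → x , x∈ , col }

      -- Prescribe c as the image of a. Then c′ is the image of some x in `H`; both x and a are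
      -- collinear with e and c′, so x = a and c′ = c.
      third-unique′ : ∀ {a c c′} → a ∈ H → c ∈ C → c′ ∈ C → c ≢ e → c′ ≢ e →
                      Collinear M e a c → Collinear M e a c′ → c′ ≡ c
      third-unique′ {a} {c} {c′} a∈ c∈ c′∈ c≢e c′≢e col col′ =
        case hits {Q = λ x y → x ≡ a → y ≡ c} (λ x y → (x ≟ᶠ a) →-dec (y ≟ᶠ c))
          (λ {x} x∈ → split (x ≟ᶠ a)
            (λ { refl → c , third∈E a∈ c∈ c≢e col , col , λ _ → refl })
            (λ x≢a → case third-H x∈ of λ { (y , y∈ , col″) → y , y∈ , col″ , λ x≡a →
                contradiction x≡a x≢a }))
          (third∈E a∈ c′∈ c′≢e col′) of
        λ { (x , x∈ , col″ , eq) → eq (unique x∈ a∈ c′∈ col″ col′) }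

  third-unique : ∀ {a e c c′} → a ∈ C → e ∈ C → a ≢ e → c ∈ C → c′ ∈ C → c ≢ e → c′ ≢ e →
                 Collinear M e a c → Collinear M e a c′ → c′ ≡ c
  third-unique {a} {e} a∈ e∈ a≢e c∈ c′∈ c≢e c′≢e col col′ =
    -- The hyperplane spanned by `B - e` contains a and misses e.
    case basis-extend M (⊹-lub (⁅⁆⊆ a∈) e∈) (simple a∈ e∈) of λ { (B , ae⊆B , bas) →
    Hyperplane.third-unique′ bas (ae⊆B ∈⊹ʳ) e∈
      (λ e∈H → [ ∉- {p = B} , (λ dep → dep (⊆-indep M (⊹-lub (-⊆ {p = B}) (ae⊆B ∈⊹ʳ)) (basis-indep bas))) ]′
          (proj₂ (∈span⁻ M e∈H)))
      (∈span⁺ M a∈ (inj₁ (∈-⁺ (ae⊆B (∈∪ˡ (x∈⁅x⁆ a))) a≢e))) c∈ c′∈ c≢e c′≢e col col′ }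

  abstract
    -- The coordinate at b in the basis `B` over the two-element field, read off from the hyperplane
    -- spanned by the rest of the basis.
    χ : Subset (size M) → Fin (size M) → Fin (size M) → Bool
    χ B b x = not (does (x ∈? span M C (B - b)))

    χ-∈ : ∀ {B b x} → x ∈ span M C (B - b) → χ B b x ≡ false
    χ-∈ {B} {b} {x} x∈ = cong not (dec-true (x ∈? span M C (B - b)) x∈)

    χ-∉ : ∀ {B b x} → x ∉ span M C (B - b) → χ B b x ≡ true
    χ-∉ {B} {b} {x} x∉ = cong not (dec-false (x ∈? span M C (B - b)) x∉)

  -- Linear functionals over the two-element field, expressed on `C` through lines.
  Additive : (Fin (size M) → Bool) → Set
  Additive g = ∀ a b c → a ∈ C → b ∈ C → c ∈ C → a ≢ b → c ≢ a → c ≢ b → Collinear M a b c → g c ≡ g a xor g b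

  module _ {B : Subset (size M)} {b : Fin (size M)} (bas : Basis M C B) (b∈ : b ∈ B) where
    open Hyperplane bas b∈

    χ-in : ∀ {x} → x ∈ H → χ B b x ≡ false
    χ-in = χ-∈

    χ-out : ∀ {x} → x ∉ H → χ B b x ≡ true
    χ-out = χ-∉

    χ-additive : Additive (χ B b)
    χ-additive x y z x∈ y∈ z∈ x≢y z≢x z≢y col = split (x ∈? H)
      (λ x∈H → split (y ∈? H)
        (λ y∈H → trans (χ-in (H-line x∈H y∈H z∈ col)) (sym (cong₂ _xor_ (χ-in x∈H) (χ-in y∈H))))
        (λ y∉H → trans (χ-out λ z∈H → y∉H (H-line z∈H x∈H y∈ (collinear-rotate M (collinear-rotate M col))))
            (sym (cong₂ _xor_ (χ-in x∈H) (χ-out y∉H)))))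
      (λ x∉H → split (y ∈? H)
        (λ y∈H → trans (χ-out λ z∈H → x∉H (H-line y∈H z∈H x∈ (collinear-rotate M col)))
            (sym (cong₂ _xor_ (χ-out x∉H) (χ-in y∈H))))
        -- With x and y both outside `H`, the line through them meets `H` in some w, and
        -- `third-unique` identifies w with z.
        (λ y∉H → trans (χ-in (case hit x∈ x∉H y∈ y∉H (x≢y ∘ sym) of λ { (w , w∈H , col′) →
           subst (_∈ H) (third-unique y∈ x∈ (x≢y ∘ sym) z∈ (span⊆ M w∈H) z≢x (λ { refl → x∉H w∈H }) col
             (collinear-swap M (collinear-rotate M (collinear-rotate M col′)))) w∈H }))
           (sym (cong₂ _xor_ (χ-out x∉H) (χ-out y∉H)))))

    χ-self : χ B b b ≡ true
    χ-self = χ-out λ b∈H → [ ∉- {p = B} , (λ dep → dep (⊆-indep M (⊹-lub (-⊆ {p = B}) b∈) (basis-indep bas)))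
        ]′ (proj₂ (∈span⁻ M b∈H))

    χ-other : ∀ {x} → x ∈ B → x ≢ b → χ B b x ≡ false
    χ-other x∈ x≢b = χ-in (∈span⁺ M (basis⊆ bas x∈) (inj₁ (∈-⁺ x∈ x≢b)))

    χ≡false⇒spanned : ∀ {x} → χ B b x ≡ false → Spanned M I x
    χ≡false⇒spanned {x} eq = split (x ∈? H) (proj₂ ∘ ∈span⁻ M) λ x∉ →
        contradiction (trans (sym (χ-out x∉)) eq) λ ()

  -- A point p outside the basis can be exchanged for some e in it; then `B - e` does not span p,
  -- and the coordinate of p at e is one.
  χ-separates : ∀ {B} → Basis M C B → ∀ {p} → p ∈ C → ¬ (∀ {b} → b ∈ B → χ B b p ≡ false)
  χ-separates {B} bas {p} p∈ zero′ = split (p ∈? B)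
    (λ p∈B → contradiction (trans (sym (χ-self bas p∈B)) (zero′ p∈B)) λ ())
    λ p∉B → [ p∉B , (λ dep → case exchange M {J = ⊥} (basis-indep bas) ⊥⊆ p∉B
                  (⊆-indep M (∪-lub ⊥⊆ id) (indep-⁅⁆ M simple p∈)) dep of λ { (e , e∈B , _ , ind) →
        [ p∉B ∘ -⊆ {p = B} , (λ dep′ → dep′ ind) ]′ (χ≡false⇒spanned bas e∈B (zero′ e∈B)) }) ]′
            (basis-spans bas p∈)

  -- If x and y had equal coordinates, the third point on their line would have only zero
  -- coordinates.
  χ-injective : ∀ {B} → Basis M C B → ∀ {x y} → x ∈ C → y ∈ C → (∀ {b} → b ∈ B → χ B b x ≡ χ B b y) → x ≡ y
  χ-injective {B} bas {x} {y} x∈ y∈ same = decidable-stable (x ≟ᶠ y) λ x≢y →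
    case third x∈ y∈ x≢y of λ { (z , z∈ , z≢x , z≢y , col) →
    χ-separates bas z∈ λ {b} b∈ → trans (χ-additive bas b∈ x y z x∈ y∈ z∈ x≢y z≢x z≢y col)
      (trans (cong (_xor χ B b y) (same b∈)) (xor-same (χ B b y))) }

-- Binary coordinates and the embedding of `PG`

lookup-injective : ∀ {a} {A : Set a} {xs : List A} → Unique xs → ∀ {i j} → List.lookup xs i ≡ List.lookup xs j
    → i ≡ j
lookup-injective (_ ∷ _)       {zero}  {zero}  _  = refl
lookup-injective (x∉ ∷ _)      {zero}  {suc j} eq = contradiction eq (All.lookup x∉ (∈-lookup j))
lookup-injective (x∉ ∷ _)      {suc i} {zero}  eq = contradiction (sym eq) (All.lookup x∉ (∈-lookup i))
lookup-injective (_ ∷ unique)  {suc i} {suc j} eq = cong suc (lookup-injective unique eq)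

bitVectors-unique : ∀ k → Unique (bitVectors k)
bitVectors-unique zero = [] ∷ []
bitVectors-unique (suc k) = Unique.++⁺ (Unique.map⁺ (λ { refl → refl }) (bitVectors-unique k))
  (Unique.map⁺ (λ { refl → refl }) (bitVectors-unique k))
  λ { (p , q) → case (∈-map⁻ (false ∷_) p , ∈-map⁻ (true ∷_) q) of λ { ((_ , _ , refl) , (_ , _ , ())) } }

∈-bitVectors : ∀ {k} (v : Vec Bool k) → v ∈ˡ bitVectors k
∈-bitVectors [] = here refl
∈-bitVectors (false ∷ v) = ∈-++⁺ˡ (∈-map⁺ (false ∷_) (∈-bitVectors v))
∈-bitVectors {suc k} (true ∷ v) = ∈-++⁺ʳ (List.map (false ∷_) (bitVectors k))
    (∈-map⁺ (true ∷_) (∈-bitVectors v))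

enum : ∀ {n} (p : Subset n) → Fin ∣ p ∣ → Fin n
enum (true ∷ p)  zero    = zero
enum (true ∷ p)  (suc i) = suc (enum p i)
enum (false ∷ p) i       = suc (enum p i)

enum-∈ : ∀ {n} (p : Subset n) i → enum p i ∈ p
enum-∈ (true ∷ p)  zero    = here
enum-∈ (true ∷ p)  (suc i) = there (enum-∈ p i)
enum-∈ (false ∷ p) i       = there (enum-∈ p i)

enum-surjective : ∀ {n} (p : Subset n) {x} → x ∈ p → ∃ λ i → enum p i ≡ x
enum-surjective (true ∷ p)  here       = zero , refl
enum-surjective (true ∷ p)  (there x∈) = let i , eq = enum-surjective p x∈ in suc i , cong suc eq
enum-surjective (false ∷ p) (there x∈) = let i , eq = enum-surjective p x∈ in i , cong suc eq

enum-injective : ∀ {n} (p : Subset n) {i j} → enum p i ≡ enum p j → i ≡ j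
enum-injective (true ∷ p)  {zero}  {zero}  eq = refl
enum-injective (true ∷ p)  {suc i} {suc j} eq = cong suc (enum-injective p (suc-injectiveᶠ eq))
enum-injective (false ∷ p) eq = enum-injective p (suc-injectiveᶠ eq)

preimage : ∀ {m n} → (Fin m → Fin n) → Subset n → Subset m
preimage φ J = tabulate (lookup J ∘ φ)

module _ {m n : ℕ} (φ : Fin m → Fin n) (J : Subset n) where
  ∈-preimage⁺ : ∀ {i} → φ i ∈ J → i ∈ preimage φ J
  ∈-preimage⁺ {i} φi∈ = lookup⇒[]= i _ (trans (lookup∘tabulate (lookup J ∘ φ) i) ([]=⇒lookup φi∈))

  ∈-preimage⁻ : ∀ {i} → i ∈ preimage φ J → φ i ∈ J
  ∈-preimage⁻ {i} i∈ = lookup⇒[]= (φ i) J (trans (sym (lookup∘tabulate (lookup J ∘ φ) i)) ([]=⇒lookup i∈))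

-- An isomorphism from N onto the restriction of M to C.
record Embedding (N M : Matroid) (C : Subset (size M)) : Set where
  field
    φ            : Fin (size N) → Fin (size M)
    φ-∈          : ∀ i → φ i ∈ C
    φ-injective  : ∀ {i j} → φ i ≡ φ j → i ≡ j
    φ-surjective : ∀ {x} → x ∈ C → ∃ λ i → φ i ≡ x
    φ-indep      : ∀ {J} → J ⊆ C → Indep M J ⇔ Indep N (preimage φ J)

xsum : ∀ {m} → (Fin m → Bool) → Subset m → Bool
xsum g []          = false
xsum g (true ∷ c)  = g zero xor xsum (g ∘ suc) c
xsum g (false ∷ c) = xsum (g ∘ suc) c

xsum-cong : ∀ {m} {g h : Fin m → Bool} → (∀ i → g i ≡ h i) → ∀ c → xsum g c ≡ xsum h c
xsum-cong eq []          = refl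
xsum-cong eq (true ∷ c)  = cong₂ _xor_ (eq zero) (xsum-cong (eq ∘ suc) c)
xsum-cong eq (false ∷ c) = xsum-cong (eq ∘ suc) c

xsum-none : ∀ {m} {g : Fin m → Bool} c → (∀ {i} → i ∈ c → g i ≡ false) → xsum g c ≡ false
xsum-none []          none = refl
xsum-none (true ∷ c)  none = cong₂ _xor_ (none here) (xsum-none c (none ∘ there))
xsum-none (false ∷ c) none = xsum-none c (none ∘ there)

xsum-one : ∀ {m} {g : Fin m → Bool} c {i} → i ∈ c → g i ≡ true → (∀ {j} → j ∈ c → j ≢ i → g j ≡ false) →
    xsum g c ≡ true
xsum-one (true ∷ c) here one none = cong₂ _xor_ one (xsum-none c λ j∈ → none (there j∈) λ ())
xsum-one (true ∷ c) (there i∈) one none =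
  cong₂ _xor_ (none here λ ()) (xsum-one c i∈ one λ j∈ j≢ → none (there j∈) λ { refl → j≢ refl })
xsum-one (false ∷ c) (there i∈) one none = xsum-one c i∈ one λ j∈ j≢ → none (there j∈) λ { refl → j≢ refl }

lookup-combination : ∀ {k m} (v : Fin m → Vec Bool k) c i → lookup (combination v c) i ≡ xsum
    (λ j → lookup (v j) i) c
lookup-combination v []          i = lookup-replicate i false
lookup-combination v (true ∷ c)  i = trans (lookup-zipWith _xor_ i (v zero) _)
    (cong (lookup (v zero) i xor_) (lookup-combination (v ∘ suc) c i))
lookup-combination v (false ∷ c) i = lookup-combination (v ∘ suc) c i

module PGEmbedding (M : Matroid) (C B₀ : Subset (size M)) (simple : Simple M C)
    (bas₀ : Basis M C B₀) (noclaw : NoClaw M C 2) (∣C∣ : ∣ C ∣ + 1 ≡ 2 ^ ∣ B₀ ∣) where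
  open ProjectiveGeometry M C B₀ simple bas₀ noclaw ∣C∣
  open BinaryLemmas

  ρ : ℕ
  ρ = ∣ B₀ ∣

  -- The sum of two distinct points is the third point on their line.
  sum-point : ∀ {m} (w : Fin m → Fin (size M)) → (∀ i → w i ∈ C) → ∀ c →
    (∀ {g} → Additive g → xsum (g ∘ w) c ≡ false) ⊎
    (∃ λ p → p ∈ C × (∀ {g} → Additive g → g p ≡ xsum (g ∘ w) c))
  sum-point w w∈ [] = inj₁ λ _ → refl
  sum-point w w∈ (false ∷ c) = sum-point (w ∘ suc) (w∈ ∘ suc) c
  sum-point w w∈ (true ∷ c) = case sum-point (w ∘ suc) (w∈ ∘ suc) c of λ
    { (inj₁ z) → inj₂ (w zero , w∈ zero , λ {g} add →
        sym (trans (cong (g (w zero) xor_) (z add)) (xor-identityʳ _)))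
    ; (inj₂ (p , p∈ , eq)) → split (w zero ≟ᶠ p)
        (λ { refl → inj₁ λ {g} add → trans (cong (g p xor_) (sym (eq add))) (xor-same (g p)) })
        (λ w≢p → case third (w∈ zero) p∈ w≢p of λ { (q , q∈ , q≢w , q≢p , col) →
          inj₂ (q , q∈ , λ {g} add → trans (add _ _ _ (w∈ zero) p∈ q∈ w≢p q≢w q≢p col)
              (cong (g (w zero) xor_) (eq add))) }) }

  coord : Fin (size M) → Vec Bool ρ
  coord x = tabulate λ i → χ B₀ (enum B₀ i) x

  lookup-coord : ∀ x i → lookup (coord x) i ≡ χ B₀ (enum B₀ i) x
  lookup-coord x i = lookup∘tabulate (λ i → χ B₀ (enum B₀ i) x) i

  coord-functional : ∀ {x} (y : Vec Bool ρ) → coord x ≡ y → ∀ {b} (b∈ : b ∈ B₀) →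
                     χ B₀ b x ≡ lookup y (proj₁ (enum-surjective B₀ b∈))
  coord-functional {x} y eq b∈ = trans (cong (λ b → χ B₀ b x) (sym (proj₂ (enum-surjective B₀ b∈))))
    (trans (sym (lookup-coord x _)) (cong (λ y → lookup y _) eq))

  coord-injective : ∀ {x y} → x ∈ C → y ∈ C → coord x ≡ coord y → x ≡ y
  coord-injective {x} {y} x∈ y∈ eq = χ-injective bas₀ x∈ y∈ λ b∈ →
    trans (coord-functional {x} (coord y) eq b∈) (sym (coord-functional {y} (coord y) refl b∈))

  coord-nonzero : ∀ {x} → x ∈ C → coord x ≢ 𝟎
  coord-nonzero {x} x∈ eq = χ-separates bas₀ x∈ λ b∈ → trans (coord-functional {x} 𝟎 eq b∈)
      (lookup-replicate (proj₁ (enum-surjective B₀ b∈)) false)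

  points : List (Vec Bool ρ)
  points = nonzeroVectors ρ

  point : Fin (size (PG ρ)) → Vec Bool ρ
  point = List.lookup points

  index : ∀ {x} → x ∈ C → ∃ λ i → point i ≡ coord x
  index {x} x∈ = let p = ∈-filter⁺ (λ y → ¬? (y ≟ᵛ 𝟎)) (∈-bitVectors (coord x)) (coord-nonzero x∈)
                 in Any.index p , sym (lookup-index p)

  abstract
    -- `coord` maps `C` injectively into the nonzero vectors, and both sets have 2^ρ - 1 elements.
    realise : ∀ i → ∃ λ x → x ∈ C × point i ≡ coord x
    realise i = ∣∣-surjective {R = λ x i → point i ≡ coord x} C ⊤ (λ x i → point i ≟ᵛ coord x)
      (λ x∈ → let i , eq = index x∈ in i , ∈⊤ , eq)
      (λ x∈ y∈ p q → coord-injective x∈ y∈ (trans (sym p) q))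
      (≤-reflexive (trans (∣⊤∣≡n (size (PG ρ))) (+-cancelʳ-≡ 1 _ _ (trans (SizeLemmas.size-PG ρ) (sym ∣C∣)))))
          (∈⊤ {x = i})

  φ : Fin (size (PG ρ)) → Fin (size M)
  φ i = proj₁ (realise i)

  φ∈ : ∀ i → φ i ∈ C
  φ∈ i = proj₁ (proj₂ (realise i))

  point-φ : ∀ i → point i ≡ coord (φ i)
  point-φ i = proj₂ (proj₂ (realise i))

  φ-inj : ∀ {i j} → φ i ≡ φ j → i ≡ j
  φ-inj {i} {j} eq = lookup-injective (Unique.filter⁺ (λ y → ¬? (y ≟ᵛ 𝟎)) (bitVectors-unique ρ))
    (trans (point-φ i) (trans (cong coord eq) (sym (point-φ j))))

  φ-surj : ∀ {x} → x ∈ C → ∃ λ i → φ i ≡ x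
  φ-surj {x} x∈ = let i , eq = index x∈ in i , coord-injective (φ∈ i) x∈ (trans (sym (point-φ i)) eq)

  lookup-sum : ∀ c i → lookup (combination point c) i ≡ xsum (χ B₀ (enum B₀ i) ∘ φ) c
  lookup-sum c i = trans (lookup-combination point c i)
    (xsum-cong (λ j → trans (cong (λ y → lookup y i) (point-φ j)) (lookup-coord (φ j) i)) c)

  sum≡coord : ∀ c p → (∀ {g} → Additive g → g p ≡ xsum (g ∘ φ) c) → combination point c ≡ coord p
  sum≡coord c p eq = Pointwise-≡⇒≡ (ext λ i → trans (lookup-sum c i)
    (trans (sym (eq (χ-additive bas₀ (enum-∈ B₀ i)))) (sym (lookup-coord p i))))

  -- A vanishing combination containing i is tested against the coordinate at `φ i` of a basis
  -- containing `J`, which is one at i and zero at the other members. This basis depends on `J`,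
  -- which is why `sum-point` speaks of all additive functionals and not only of the coordinates of
  -- `B₀`.
  indep⇒linIndep : ∀ {J} → J ⊆ C → Indep M J → LinIndep point (preimage φ J)
  indep⇒linIndep {J} J⊆C ind c c⊆ sum≡𝟎 = decidable-stable (c ≟ᵛ ⊥) λ c≢⊥ →
    case ⊈⇒∃ {p = c} {q = ⊥} (λ c⊆⊥ → c≢⊥ (⊆-antisym c⊆⊥ ⊥⊆)) of λ { (i , i∈c , _) →
    case sum-point φ φ∈ c of λ
      { (inj₂ (p , p∈ , eq)) → coord-nonzero p∈ (trans (sym (sum≡coord c p eq)) sum≡𝟎)
      ; (inj₁ z) → case basis-extend M J⊆C ind of λ { (B , J⊆B , bas) →
          let i∈B = J⊆B (∈-preimage⁻ φ J (c⊆ i∈c)) in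
          contradiction (trans (sym (xsum-one c i∈c (χ-self bas i∈B) λ j∈ j≢i →
              χ-other bas i∈B (J⊆B (∈-preimage⁻ φ J (c⊆ j∈))) (j≢i ∘ φ-inj)))
            (z (χ-additive bas i∈B))) λ () } } }

  -- x is the sum of those elements of a basis containing `I` at which its coordinate is one. They
  -- lie in `I`: for a basis element b outside `I`, the hyperplane at b contains `I` and so x.
  dependence : ∀ {I x} → I ⊆ C → x ∈ C → x ∉ I → Indep M I → Spanned M I x →
    ∃ λ c → (∀ i → i ∈ c → φ i ∈ I) × combination point c ≡ coord x
  dependence {I} {x} I⊆C x∈ x∉I ind sp = case basis-extend M I⊆C ind of λ { (B , I⊆B , bas) →
    let P? = λ i → (φ i ∈? B) ×-dec (χ B (φ i) x ≟ᵇ true)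
        c = ⟪ P? ⟫
        ∈c⁻ : ∀ {i} → i ∈ c → φ i ∈ B × χ B (φ i) x ≡ true
        ∈c⁻ = ∈⟪⟫⁻ P?
        xsum≡ : ∀ {b} → b ∈ B → xsum (χ B b ∘ φ) c ≡ χ B b x
        xsum≡ {b} b∈ = case φ-surj (basis⊆ bas b∈) of λ { (j , refl) → split (j ∈? c)
          (λ j∈c → trans (xsum-one c j∈c (χ-self bas b∈) λ k∈ k≢j → χ-other bas b∈ (proj₁ (∈c⁻ k∈))
              (k≢j ∘ φ-inj)) (sym (proj₂ (∈c⁻ j∈c))))
          (λ j∉c → trans (xsum-none c λ k∈ → χ-other bas b∈ (proj₁ (∈c⁻ k∈)) λ φk≡φj →
              j∉c (subst (_∈ c) (φ-inj φk≡φj) k∈))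
            (sym (¬true (χ B b x) λ χ≡true → j∉c (∈⟪⟫⁺ P? (b∈ , χ≡true))))) }
        inI : ∀ {i} → i ∈ c → φ i ∈ I
        inI {i} i∈ = decidable-stable (φ i ∈? I) λ φi∉I → contradiction
          (trans (sym (proj₂ (∈c⁻ i∈)))
              (χ-spanned bas (proj₁ (∈c⁻ i∈)) x∈ (span-mono M (λ y∈ → ∈-⁺ (I⊆B y∈) (∈∉⇒≢ y∈ φi∉I)) sp))) λ ()
    in case sum-point φ φ∈ c of λ
      { (inj₁ z) → contradiction (λ {b} b∈ → trans (sym (xsum≡ b∈)) (z (χ-additive bas b∈)))
          (χ-separates bas x∈)
      ; (inj₂ (p , p∈ , eq)) → c , (λ _ → inI) , trans (sum≡coord c p eq)
          (cong coord (χ-injective bas p∈ x∈ λ b∈ → trans (eq (χ-additive bas b∈)) (xsum≡ b∈))) } }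
    where
    ¬true : ∀ b → b ≢ true → b ≡ false
    ¬true false _ = refl
    ¬true true ¬t = contradiction refl ¬t
    χ-spanned : ∀ {B b} (bas : Basis M C B) (b∈ : b ∈ B) → ∀ {x} → x ∈ C → Spanned M (B - b) x →
        χ B b x ≡ false
    χ-spanned bas b∈ x∈ sp = χ-in bas b∈ (∈span⁺ M x∈ sp)

  -- If `J` is dependent, some x in `J` lies outside a basis of `J`. Adding x to its expansion in
  -- that basis gives a vanishing combination, and not the empty one, because the expansion avoids
  -- x.
  linIndep⇒indep : ∀ {J} → J ⊆ C → LinIndep point (preimage φ J) → Indep M J
  linIndep⇒indep {J} J⊆C lin = decidable-stable (Indep? M J) λ dep →
    case basis-extend M {G = J} (⊥⊆ {p = J}) (⊥-indep M) of λ { (I , _ , basJ) →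
    case ⊈⇒∃ {p = J} {q = I} (λ J⊆I → dep (⊆-indep M J⊆I (basis-indep basJ))) of λ { (x , x∈J , x∉I) →
    case φ-surj (J⊆C x∈J) of λ { (i , refl) →
    case dependence (J⊆C ∘ basis⊆ basJ) (J⊆C x∈J) x∉I (basis-indep basJ) (basis-spans basJ x∈J) of λ
        { (c , c⊆ , eq) →
    let d = c +ᵛ ⁅ i ⁆
        d≡⊥ : d ≡ ⊥
        d≡⊥ = lin d (+ᵛ-⊆ {c = c} {d = ⁅ i ⁆} (λ j∈ → ∈-preimage⁺ φ J (basis⊆ basJ (c⊆ _ j∈)))
            (⁅⁆⊆ (∈-preimage⁺ φ J x∈J)))
          (trans (combination-+ point c ⁅ i ⁆)
              (trans (cong₂ _+ᵛ_ eq (trans (combination-⁅⁆ point i) (point-φ i))) (+ᵛ-self (coord (φ i)))))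
    in x∉I (c⊆ i (subst (i ∈_) (sym (+ᵛ≡𝟎⇒≡ c ⁅ i ⁆ d≡⊥)) (x∈⁅x⁆ i))) } } } }

  PG-embedding : Embedding (PG ρ) M C
  PG-embedding = record
    { φ = φ ; φ-∈ = φ∈ ; φ-injective = φ-inj ; φ-surjective = φ-surj
    ; φ-indep = λ J⊆C → mk⇔ (indep⇒linIndep J⊆C) (linIndep⇒indep J⊆C) }

-- Direct sums

open Embedding

∣preimage∣ : ∀ {m n} (φ : Fin m → Fin n) J → (∀ {i j} → φ i ≡ φ j → i ≡ j) → (∀ {x} → x ∈ J → ∃ λ i → φ i ≡ x)
    →
             ∣ preimage φ J ∣ ≡ ∣ J ∣
∣preimage∣ φ J inj surj = ≤-antisym
  (∣∣-injective {R = λ i x → φ i ≡ x} (preimage φ J) J (λ i∈ → _ , ∈-preimage⁻ φ J i∈ , refl)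
      (λ _ _ p q → inj (trans p (sym q))))
  (∣∣-injective {R = λ x i → φ i ≡ x} J (preimage φ J)
    (λ x∈ → case surj x∈ of λ { (i , refl) → i , ∈-preimage⁺ φ J x∈ , refl }) (λ _ _ p q → trans (sym p) q))

module _ {N M : Matroid} where
  embedding-size : ∀ {C} → Embedding N M C → size N ≡ ∣ C ∣
  embedding-size {C} E = begin
    size N                  ≡⟨ ∣⊤∣≡n (size N) ⟨
    ∣ ⊤ {size N} ∣          ≡⟨ cong ∣_∣
        (⊆-antisym {i = ⊤} {j = preimage (φ E) C} (λ {i} _ → ∈-preimage⁺ (φ E) C (φ-∈ E i)) ⊆⊤) ⟩
    ∣ preimage (φ E) C ∣    ≡⟨ ∣preimage∣ (φ E) C (φ-injective E) (φ-surjective E) ⟩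
    ∣ C ∣                   ∎
    where open ≡-Reasoning

  embedding⇒≅ : Embedding N M ⊤ → M ≅ N
  embedding⇒≅ E = permutation (λ x → proj₁ (φ-surjective E {x} ∈⊤)) (φ E)
      (λ i → φ-injective E (proj₂ (φ-surjective E ∈⊤)))
      (λ x → proj₂ (φ-surjective E ∈⊤)) ,
    λ I → φ-indep E {I} ⊆⊤

∅-embedding : ∀ M → Embedding empty M ⊥
∅-embedding M = record
  { φ = λ () ; φ-∈ = λ () ; φ-injective = λ { {()} } ; φ-surjective = λ x∈ → contradiction x∈ ∉⊥
  ; φ-indep = λ {J} J⊆ → mk⇔ (λ _ → z≤n) (λ _ → ⊆-indep M J⊆ (⊥-indep M)) }

U-embedding : ∀ M k {C} → (∀ {J} → J ⊆ C → Indep M J ⇔ ∣ J ∣ ≤ k) → Embedding (U k ∣ C ∣) M C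
U-embedding M k {C} indep = record
  { φ = enum C ; φ-∈ = enum-∈ C ; φ-injective = enum-injective C ; φ-surjective = enum-surjective C
  ; φ-indep = λ {J} J⊆ →
      let open Equivalence (indep J⊆)
          eq = ∣preimage∣ (enum C) J (enum-injective C) (enum-surjective C ∘ J⊆) in
      mk⇔ (≤-trans (≤-reflexive eq) ∘ to) (from ∘ ≤-trans (≤-reflexive (sym eq))) }

module _ {M N₁ N₂ : Matroid} {C₁ C₂ : Subset (size M)} (E₁ : Embedding N₁ M C₁) (E₂ : Embedding N₂ M C₂)
         (disjoint : ∀ {x} → x ∈ C₁ → x ∉ C₂)
         (separate : ∀ {J} → J ⊆ C₁ ∪ C₂ → Indep M (J ∩ C₁) → Indep M (J ∩ C₂) → Indep M J) where
  private
    m = size N₁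
    n = size N₂

    φ⊕ : Fin (m + n) → Fin (size M)
    φ⊕ i = [ φ E₁ , φ E₂ ]′ (splitAt m i)

    φ⊕-↑ˡ : ∀ i → φ⊕ (i ↑ˡ n) ≡ φ E₁ i
    φ⊕-↑ˡ i = cong [ φ E₁ , φ E₂ ]′ (splitAt-↑ˡ m i n)

    φ⊕-↑ʳ : ∀ i → φ⊕ (m ↑ʳ i) ≡ φ E₂ i
    φ⊕-↑ʳ i = cong [ φ E₁ , φ E₂ ]′ (splitAt-↑ʳ m n i)

    data View : Fin (m + n) → Set where
      left  : ∀ i → View (i ↑ˡ n)
      right : ∀ i → View (m ↑ʳ i)

    view : ∀ i → View i
    view i with splitAt m i in eq
    ... | inj₁ j = subst View (splitAt⁻¹-↑ˡ eq) (left j)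
    ... | inj₂ j = subst View (splitAt⁻¹-↑ʳ eq) (right j)

    injective : ∀ {i j} → φ⊕ i ≡ φ⊕ j → i ≡ j
    injective {i} {j} eq with view i | view j
    ... | left a  | left b  = cong (_↑ˡ n) (φ-injective E₁ (trans (sym (φ⊕-↑ˡ a)) (trans eq (φ⊕-↑ˡ b))))
    ... | right a | right b = cong (m ↑ʳ_) (φ-injective E₂ (trans (sym (φ⊕-↑ʳ a)) (trans eq (φ⊕-↑ʳ b))))
    ... | left a  | right b = contradiction (subst (_∈ C₂) (trans (sym (φ⊕-↑ʳ b)) (trans (sym eq) (φ⊕-↑ˡ a)))
        (φ-∈ E₂ b)) (disjoint (φ-∈ E₁ a))
    ... | right a | left b  = contradiction
        (subst (_∈ C₂) (trans (sym (φ⊕-↑ʳ a)) (trans eq (φ⊕-↑ˡ b))) (φ-∈ E₂ a)) (disjoint (φ-∈ E₁ b))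

    take-preimage : ∀ J → take m (preimage φ⊕ J) ≡ preimage (φ E₁) (J ∩ C₁)
    take-preimage J = ⊆-antisym
      (λ {i} i∈ → ∈-preimage⁺ (φ E₁) (J ∩ C₁)
          (x∈p∩q⁺ (subst (_∈ J) (φ⊕-↑ˡ i) (∈-preimage⁻ φ⊕ J (∈-take⁻ (preimage φ⊕ J) i∈)) , φ-∈ E₁ i)))
      (λ {i} i∈ → ∈-take⁺ (preimage φ⊕ J)
          (∈-preimage⁺ φ⊕ J (subst (_∈ J) (sym (φ⊕-↑ˡ i)) (p∩q⊆p J C₁ (∈-preimage⁻ (φ E₁) (J ∩ C₁) i∈)))))
      where open DirectSumLemmas

    drop-preimage : ∀ J → drop m (preimage φ⊕ J) ≡ preimage (φ E₂) (J ∩ C₂)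
    drop-preimage J = ⊆-antisym
      (λ {i} i∈ → ∈-preimage⁺ (φ E₂) (J ∩ C₂)
          (x∈p∩q⁺ (subst (_∈ J) (φ⊕-↑ʳ i) (∈-preimage⁻ φ⊕ J (∈-drop⁻ m (preimage φ⊕ J) i∈)) , φ-∈ E₂ i)))
      (λ {i} i∈ → ∈-drop⁺ m (preimage φ⊕ J)
          (∈-preimage⁺ φ⊕ J (subst (_∈ J) (sym (φ⊕-↑ʳ i)) (p∩q⊆p J C₂ (∈-preimage⁻ (φ E₂) (J ∩ C₂) i∈)))))
      where open DirectSumLemmas

    indep-to : ∀ {J} → Indep M J → Indep (N₁ ⊕ N₂) (preimage φ⊕ J)
    indep-to {J} ind =
      subst (Indep N₁) (sym (take-preimage J))
          (Equivalence.to (φ-indep E₁ (p∩q⊆q J C₁)) (⊆-indep M (p∩q⊆p J C₁) ind)) ,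
      subst (Indep N₂) (sym (drop-preimage J))
          (Equivalence.to (φ-indep E₂ (p∩q⊆q J C₂)) (⊆-indep M (p∩q⊆p J C₂) ind))

    indep-from : ∀ {J} → J ⊆ C₁ ∪ C₂ → Indep (N₁ ⊕ N₂) (preimage φ⊕ J) → Indep M J
    indep-from {J} J⊆ (ind₁ , ind₂) = separate J⊆
      (Equivalence.from (φ-indep E₁ (p∩q⊆q J C₁)) (subst (Indep N₁) (take-preimage J) ind₁))
      (Equivalence.from (φ-indep E₂ (p∩q⊆q J C₂)) (subst (Indep N₂) (drop-preimage J) ind₂))

  ⊕-embedding : Embedding (N₁ ⊕ N₂) M (C₁ ∪ C₂)
  ⊕-embedding = record
    { φ = φ⊕
    ; φ-∈ = λ i → case view i of λ
        { (left a) → ∈∪ˡ (subst (_∈ C₁) (sym (φ⊕-↑ˡ a)) (φ-∈ E₁ a))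
        ; (right a) → ∈∪ʳ (subst (_∈ C₂) (sym (φ⊕-↑ʳ a)) (φ-∈ E₂ a)) }
    ; φ-injective = injective
    ; φ-surjective = λ x∈ → [ (λ x∈₁ →
        case φ-surjective E₁ x∈₁ of λ { (a , eq) → a ↑ˡ n , trans (φ⊕-↑ˡ a) eq })
                            , (λ x∈₂ → case φ-surjective E₂ x∈₂ of λ
                                { (a , eq) → m ↑ʳ a , trans (φ⊕-↑ʳ a) eq }) ]′ (x∈p∪q⁻ C₁ C₂ x∈)
    ; φ-indep = λ J⊆ → mk⇔ indep-to (indep-from J⊆)
    }

-- Direct sums along a colouring

module _ {n m : ℕ} (G : Subset n) (col : Fin n → Fin m) where
  abstract
    cls : Fin m → Subset n
    cls e = ⟪ (λ x → (x ∈? G) ×-dec (col x ≟ᶠ e)) ⟫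

    ∈cls⁺ : ∀ {x e} → x ∈ G → col x ≡ e → x ∈ cls e
    ∈cls⁺ {e = e} x∈ eq = ∈⟪⟫⁺ (λ x → (x ∈? G) ×-dec (col x ≟ᶠ e)) (x∈ , eq)

    ∈cls⁻ : ∀ {x e} → x ∈ cls e → x ∈ G × col x ≡ e
    ∈cls⁻ {e = e} = ∈⟪⟫⁻ (λ x → (x ∈? G) ×-dec (col x ≟ᶠ e))

-- This makes `M` restricted to `G` the direct sum of its colour classes; the converse implication
-- is heredity.
Separated : ∀ {m} (M : Matroid) (G : Subset (size M)) (col : Fin (size M) → Fin m) → Set
Separated M G col = ∀ W → W ⊆ G → (∀ e → Indep M (W ∩ cls G col e)) → Indep M W

module _ {m : ℕ} (M : Matroid) (G : Subset (size M)) (col : Fin (size M) → Fin m) (sep : Separated M G col)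
    where
  open DecMembership (_≟ᶠ_ {m}) using () renaming (_∈?_ to _∈ˡ?_)

  private
    C = cls G col

    abstract
      Cs : List (Fin m) → Subset (size M)
      Cs es = ⟪ (λ x → (x ∈? G) ×-dec (col x ∈ˡ? es)) ⟫

      ∈Cs⁺ : ∀ {es x} → x ∈ G → col x ∈ˡ es → x ∈ Cs es
      ∈Cs⁺ {es} x∈ e∈ = ∈⟪⟫⁺ (λ x → (x ∈? G) ×-dec (col x ∈ˡ? es)) (x∈ , e∈)

      ∈Cs⁻ : ∀ {es x} → x ∈ Cs es → x ∈ G × col x ∈ˡ es
      ∈Cs⁻ {es} = ∈⟪⟫⁻ (λ x → (x ∈? G) ×-dec (col x ∈ˡ? es))

    embed : ∀ {es Ns} → Unique es → Pointwise (λ e N → Embedding N M (C e)) es Ns → Embedding (⨁ Ns) M (Cs es)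
    embed [] [] = subst (Embedding empty M) (⊆-antisym ⊥⊆ λ x∈ → case proj₂ (∈Cs⁻ {es = []} x∈) of λ ())
        (∅-embedding M)
    embed {e ∷ es} (e∉es ∷ unique) (E ∷ Es) = subst (Embedding _ M)
        (⊆-antisym {i = C e ∪ Cs es} {j = Cs (e ∷ es)} to from)
      (⊕-embedding E (embed unique Es) disjoint separate)
      where
      to : C e ∪ Cs es ⊆ Cs (e ∷ es)
      to = ∪-lub (λ x∈ → let x∈G , eq = ∈cls⁻ G col x∈ in ∈Cs⁺ x∈G (here eq))
                 (λ x∈ → let x∈G , c∈ = ∈Cs⁻ x∈ in ∈Cs⁺ x∈G (there c∈))
      from : Cs (e ∷ es) ⊆ C e ∪ Cs es
      from x∈ = case ∈Cs⁻ {es = e ∷ es} x∈ of λ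
          { (x∈G , here eq) → ∈∪ˡ (∈cls⁺ G col x∈G eq) ; (x∈G , there c∈) → ∈∪ʳ (∈Cs⁺ x∈G c∈) }
      disjoint : ∀ {x} → x ∈ C e → x ∉ Cs es
      disjoint x∈ x∈′ = All.lookup e∉es (proj₂ (∈Cs⁻ x∈′)) (sym (proj₂ (∈cls⁻ G col x∈)))
      separate : ∀ {J} → J ⊆ C e ∪ Cs es → Indep M (J ∩ C e) → Indep M (J ∩ Cs es) → Indep M J
      separate {J} J⊆ ind₁ ind₂ = sep J (proj₁ ∘ ∈Cs⁻ {es = e ∷ es} ∘ to ∘ J⊆) λ f → split (f ≟ᶠ e)
        (λ { refl → ind₁ })
        (λ f≢e → ⊆-indep M {J = J ∩ Cs es} (λ x∈ → case x∈p∩q⁻ J (C f) x∈ of λ { (x∈J , x∈f) →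
          x∈p∩q⁺ (x∈J , [ (λ x∈e → contradiction
              (trans (sym (proj₂ (∈cls⁻ G col x∈f))) (proj₂ (∈cls⁻ G col x∈e))) f≢e) , id ]′
                         (x∈p∪q⁻ (C e) (Cs es) (J⊆ x∈J))) }) ind₂)

  ⨁-embedding : ∀ {es Ns} → Unique es → (∀ {x} → x ∈ G → col x ∈ˡ es) →
                Pointwise (λ e N → Embedding N M (cls G col e)) es Ns → Embedding (⨁ Ns) M G
  ⨁-embedding {es} unique all Es = subst (Embedding _ M)
    (⊆-antisym {i = Cs es} {j = G} (proj₁ ∘ ∈Cs⁻) (λ x∈ → ∈Cs⁺ x∈ (all x∈))) (embed unique Es)

module _ (M : Matroid) where
  -- Enlarge `X` from `Y` to |Y| elements. At most |Y ∩ C| of them lie in `C`, so all of `Y ─ C`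
  -- must be among the rest.
  swap-indep : ∀ {Y X} C → Indep M Y → Indep M X → X ⊆ C → (∀ {x} → x ∈ C → Spanned M (Y ∩ C) x) →
      Indep M ((Y ─ C) ∪ X)
  swap-indep {Y} {X} C indY indX X⊆C sp =
    case aug-to M indX indY (≤-trans (span-bound M indYC indX (sp ∘ X⊆C)) (∣p∩q∣≤∣p∣ Y C)) of λ
        { (K , X⊆K , K⊆ , indK , ∣K∣) →
    let KC≤ : ∣ K ∩ C ∣ ≤ ∣ Y ∩ C ∣
        KC≤ = span-bound M indYC (⊆-indep M (p∩q⊆p K C) indK) (sp ∘ p∩q⊆q K C)
        K─C⊆ : K ─ C ⊆ Y ─ C
        K─C⊆ = λ x∈ → case ∈─⁻ K C x∈ of λ
            { (x∈K , x∉C) → ∈─⁺ ([ (λ x∈X → contradiction (X⊆C x∈X) x∉C) , id ]′ (x∈p∪q⁻ X Y (K⊆ x∈K))) x∉C }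
        Y─C≤ : ∣ Y ─ C ∣ ≤ ∣ K ─ C ∣
        Y─C≤ = +-cancelˡ-≤ (∣ K ∩ C ∣) _ _ (≤-trans (+-monoˡ-≤ (∣ Y ─ C ∣) KC≤)
          (≤-reflexive (trans (sym (∣∩∣+∣─∣ Y C)) (trans (sym ∣K∣) (∣∩∣+∣─∣ K C)))))
    in ⊆-indep M (∪-lub (p─q⊆p K C ∘ ⊆∧∣∣≥⇒⊇ K─C⊆ Y─C≤) X⊆K) indK }
    where
    indYC : Indep M (Y ∩ C)
    indYC = ⊆-indep M (p∩q⊆p Y C) indY

  -- Trade B for W one class at a time.
  spanning⇒separated : ∀ {m G B} (col : Fin (size M) → Fin m) → Indep M B →
      (∀ {x e} → x ∈ cls G col e → Spanned M (B ∩ cls G col e) x) → Separated M G col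
  spanning⇒separated {m} {G} {B} col indB sp W W⊆G indW =
    ⊆-indep M (λ x∈ → ∈⟪⟫⁺ (P? _) (W⊆G x∈ , inj₁ (toℕ<n (col _) , x∈))) (partial m ≤-refl)
    where
    C = cls G col
    P : ℕ → Fin (size M) → Set
    P i x = x ∈ G × ((toℕ (col x) < i × x ∈ W) ⊎ (i ≤ toℕ (col x) × x ∈ B))
    P? : ∀ i → Decidable (P i)
    P? i x = (x ∈? G) ×-dec (((toℕ (col x) <? i) ×-dec (x ∈? W)) ⊎-dec ((i ≤? toℕ (col x)) ×-dec (x ∈? B)))
    partial : ∀ i → i ≤ m → Indep M ⟪ P? i ⟫
    partial zero le = ⊆-indep M
        (λ x∈ → case proj₂ (∈⟪⟫⁻ (P? 0) x∈) of λ { (inj₁ (() , _)) ; (inj₂ (_ , x∈B)) → x∈B }) indB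
    partial (suc i) i<n = ⊆-indep M ⊆swapped (swap-indep (C e) (partial i (<⇒≤ i<n)) (indW e) (p∩q⊆q W (C e))
        λ x∈ → span-mono M sub (sp x∈))
      where
      e = fromℕ< i<n
      col≡e : ∀ {x} → x ∈ C e → toℕ (col x) ≡ i
      col≡e x∈ = trans (cong toℕ (proj₂ (∈cls⁻ G col x∈))) (toℕ-fromℕ< i<n)
      sub : B ∩ C e ⊆ ⟪ P? i ⟫ ∩ C e
      sub x∈ = case x∈p∩q⁻ B (C e) x∈ of λ { (x∈B , x∈e) →
        x∈p∩q⁺ (∈⟪⟫⁺ (P? i) (proj₁ (∈cls⁻ G col x∈e) , inj₂ (≤-reflexive (sym (col≡e x∈e)) , x∈B)) , x∈e) }
      ⊆swapped : ⟪ P? (suc i) ⟫ ⊆ (⟪ P? i ⟫ ─ C e) ∪ (W ∩ C e)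
      ⊆swapped {x} x∈ = case ∈⟪⟫⁻ (P? (suc i)) x∈ of λ
        { (x∈G , inj₂ (i< , x∈B)) →
            ∈∪ˡ (∈─⁺ (∈⟪⟫⁺ (P? i) (x∈G , inj₂ (<⇒≤ i< , x∈B))) λ x∈e → <⇒≢ i< (sym (col≡e x∈e)))
        ; (x∈G , inj₁ (<i , x∈W)) → split (x ∈? C e)
            (λ x∈e → ∈∪ʳ (x∈p∩q⁺ (x∈W , x∈e)))
            (λ x∉e → ∈∪ˡ (∈─⁺ (∈⟪⟫⁺ (P? i)
                (x∈G , inj₁ (≤∧≢⇒< (≤-pred <i)
                (λ eq → x∉e (∈cls⁺ G col x∈G (toℕ-injective (trans eq (sym (toℕ-fromℕ< i<n)))))) , x∈W)))
                x∉e)) }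

-- Decompositions into projective geometries

elements : ∀ {n} → Subset n → List (Fin n)
elements p = List.tabulate (enum p)

module _ {n : ℕ} (p : Subset n) where
  length-elements : length (elements p) ≡ ∣ p ∣
  length-elements = length-tabulate (enum p)

  ∈-elements⁺ : ∀ {x} → x ∈ p → x ∈ˡ elements p
  ∈-elements⁺ x∈ = case enum-surjective p x∈ of λ { (i , refl) → ∈-tabulate⁺ {f = enum p} i }

  ∈-elements⁻ : ∀ {x} → x ∈ˡ elements p → x ∈ p
  ∈-elements⁻ x∈ = case ∈-tabulate⁻ x∈ of λ { (i , refl) → enum-∈ p i }

  elements-unique : Unique (elements p)
  elements-unique = Unique.tabulate⁺ (enum-injective p)

module _ {a b r} {A : Set a} {B : Set b} {R : A → B → Set r} where
  pointwise-replicate : ∀ {xs y} → (∀ {x} → x ∈ˡ xs → R x y) → Pointwise R xs (replicate (length xs) y)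
  pointwise-replicate {[]}     h = []
  pointwise-replicate {x ∷ xs} h = h (here refl) ∷ pointwise-replicate (h ∘ there)

-- The structure carried by the induction, with k = r / t. One independent `B` meeting every class
-- in a basis encodes the direct sum; size and absence of 2-claws make each class a projective
-- geometry, possibly empty. How many classes have rank k + 1 is recovered from the total size.
record Decomposition (M : Matroid) (G : Subset (size M)) (t k : ℕ) : Set where
  field
    {m}         : ℕ
    colours     : Subset m
    ∣colours∣   : ∣ colours ∣ ≡ t
    col         : Fin (size M) → Fin m
    col-∈       : ∀ {x} → x ∈ G → col x ∈ colours
    B           : Subset (size M)
    B-indep     : Indep M B
    class-basis : ∀ e → Basis M (cls G col e) (B ∩ cls G col e)
    class-rank  : ∀ {e} → e ∈ colours → ∣ B ∩ cls G col e ∣ ≡ k ⊎ ∣ B ∩ cls G col e ∣ ≡ suc k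
    class-size  : ∀ {e} → e ∈ colours → ∣ cls G col e ∣ + 1 ≡ 2 ^ ∣ B ∩ cls G col e ∣
    class-noclaw : ∀ {e} → e ∈ colours → NoClaw M (cls G col e) 2

  separated : Separated M G col
  separated = spanning⇒separated M col B-indep λ {x} {e} → basis-spans (class-basis e)

size-⨁-PG₂ : ∀ u v k → size (⨁ (map PG (replicate u k ++ replicate v (suc k)))) + (u + v) ≡ (u + v + v) * 2 ^
    k
size-⨁-PG₂ u v k = begin
  size (⨁ (map PG ks)) + (u + v)       ≡⟨ cong (size (⨁ (map PG ks)) +_)
      (trans (length-++ (replicate u k)) (cong₂ _+_ (length-replicate u) (length-replicate v))) ⟨
  size (⨁ (map PG ks)) + length ks     ≡⟨ SizeLemmas.size-⨁-PG ks ⟩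
  sum (map (2 ^_) ks)                   ≡⟨ cong sum
      (trans (map-++ (2 ^_) (replicate u k) _)
      (cong₂ _++_ (map-replicate (2 ^_) u k) (map-replicate (2 ^_) v (suc k)))) ⟩
  sum (replicate u (2 ^ k) ++ replicate v (2 ^ suc k)) ≡⟨ sum-++ (replicate u (2 ^ k)) _ ⟩
  sum (replicate u (2 ^ k)) + sum (replicate v (2 ^ suc k)) ≡⟨ cong₂ _+_ (SizeLemmas.sum-replicate u _)
      (SizeLemmas.sum-replicate v _) ⟩
  u * 2 ^ k + v * (2 * 2 ^ k)          ≡⟨ solve 3
      (λ u v P → u :* P :+ v :* (con 2 :* P) := (u :+ v :+ v) :* P) refl u v (2 ^ k) ⟩
  (u + v + v) * 2 ^ k                  ∎
  where
  open ≡-Reasoning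
  open +-*-Solver
  ks = replicate u k ++ replicate v (suc k)

module _ (M : Matroid) (r t : ℕ) .{{_ : NonZero t}} (simple : Simple M ⊤) (D : Decomposition M ⊤ t (r / t))
         (size≡f : size M ≡ f r t) where
  open Decomposition D
  private
    k = r / t

    C : Fin m → Subset (size M)
    C = cls ⊤ col

    rank? : ∀ j → Decidable (λ e → e ∈ colours × ∣ B ∩ C e ∣ ≡ j)
    rank? j e = (e ∈? colours) ×-dec (∣ B ∩ C e ∣ ≟ j)

    Low High : Subset m
    Low = ⟪ rank? k ⟫
    High = ⟪ rank? (suc k) ⟫

    u = length (elements Low)
    v = length (elements High)

    disjoint : ∀ {x} → x ∈ Low → x ∉ High
    disjoint x∈ x∈′ = 1+n≢n (trans (sym (proj₂ (∈⟪⟫⁻ (rank? (suc k)) x∈′))) (proj₂ (∈⟪⟫⁻ (rank? k) x∈)))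

    colours⊆ : colours ⊆ Low ∪ High
    colours⊆ e∈ = [ (λ eq → ∈∪ˡ (∈⟪⟫⁺ (rank? k) (e∈ , eq))) , (λ eq → ∈∪ʳ (∈⟪⟫⁺ (rank? (suc k)) (e∈ , eq))) ]′
        (class-rank e∈)

    u+v≡t : u + v ≡ t
    u+v≡t = begin
      u + v                  ≡⟨ cong₂ _+_ (length-elements Low) (length-elements High) ⟩
      ∣ Low ∣ + ∣ High ∣     ≡⟨ ∣∪∣-disjoint Low High disjoint ⟨
      ∣ Low ∪ High ∣         ≡⟨ cong ∣_∣
          (⊆-antisym {i = Low ∪ High} {j = colours}
          (∪-lub (proj₁ ∘ ∈⟪⟫⁻ (rank? k)) (proj₁ ∘ ∈⟪⟫⁻ (rank? (suc k)))) colours⊆) ⟩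
      ∣ colours ∣            ≡⟨ ∣colours∣ ⟩
      t                      ∎
      where open ≡-Reasoning

    class-embedding : ∀ {e j} → e ∈ colours × ∣ B ∩ C e ∣ ≡ j → Embedding (PG j) M (C e)
    class-embedding {e} (e∈ , refl) = PGEmbedding.PG-embedding M (C e) (B ∩ C e) (λ _ _ → simple ∈⊤ ∈⊤)
      (class-basis e) (class-noclaw e∈) (class-size e∈)

    low-embedding : ∀ {e} → e ∈ˡ elements Low → Embedding (PG k) M (C e)
    low-embedding e∈ = class-embedding (∈⟪⟫⁻ (rank? k) (∈-elements⁻ Low e∈))

    high-embedding : ∀ {e} → e ∈ˡ elements High → Embedding (PG (suc k)) M (C e)
    high-embedding e∈ = class-embedding (∈⟪⟫⁻ (rank? (suc k)) (∈-elements⁻ High e∈))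

    ks = replicate u k ++ replicate v (suc k)

    map-PG : map PG ks ≡ replicate u (PG k) ++ replicate v (PG (suc k))
    map-PG = trans (map-++ PG (replicate u k) _)
        (cong₂ _++_ (map-replicate PG u k) (map-replicate PG v (suc k)))

    embedding : Embedding (⨁ (map PG ks)) M ⊤
    embedding = ⨁-embedding M ⊤ col separated
      (Unique.++⁺ (elements-unique Low) (elements-unique High) λ
          { (p , q) → disjoint (∈-elements⁻ Low p) (∈-elements⁻ High q) })
      (λ x∈ → [ ∈-++⁺ˡ ∘ ∈-elements⁺ Low , ∈-++⁺ʳ (elements Low) ∘ ∈-elements⁺ High ]′
          (x∈p∪q⁻ Low High (colours⊆ (col-∈ x∈))))
      (subst (Pointwise _ _) (sym map-PG)
          (++⁺ (pointwise-replicate low-embedding) (pointwise-replicate high-embedding)))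

    -- As u + v = t, the size plus t equals (t + v) * 2^k; comparing with `f+t` determines v.
    v≡a : v ≡ r % t
    v≡a = +-cancelˡ-≡ t v (r % t) (*-cancelʳ-≡ (t + v) (t + r % t) (2 ^ k) {{m^n≢0 2 k}} (begin
      (t + v) * 2 ^ k                       ≡⟨ cong (λ x → (x + v) * 2 ^ k) u+v≡t ⟨
      (u + v + v) * 2 ^ k                   ≡⟨ size-⨁-PG₂ u v k ⟨
      size (⨁ (map PG ks)) + (u + v)        ≡⟨ cong₂ _+_
          (trans (embedding-size embedding) (trans (∣⊤∣≡n (size M)) size≡f)) u+v≡t ⟩
      f r t + t                             ≡⟨ f+t r t ⟩
      (t + r % t) * 2 ^ k                   ∎))
      where open ≡-Reasoning

    ks≡parts : ks ≡ parts r t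
    ks≡parts = cong₂ (λ u v → replicate u k ++ replicate v (suc k))
      (trans (sym (m+n∸n≡m u v)) (cong₂ _∸_ u+v≡t v≡a)) v≡a

  decomposition⇒≅ : M ≅ 𝐌 r t
  decomposition⇒≅ = subst (λ ks → M ≅ ⨁ (map PG ks)) ks≡parts (embedding⇒≅ embedding)

-- Matroids attaining the bound

module Tight (M : Matroid) (G S T : Subset (size M)) (simple : Simple M G) (claw : Claw M G S)
             (tr : Transversal M G S T) (noclaw : NoClaw M G (suc ∣ S ∣)) where
  open Contraction M G S T simple claw tr

  -- Together with the injection of `T` into `rest`, this says that each parallel class of M / S
  -- consists of exactly y and `pair y`.
  module _ (tight : ∣ rest noclaw ∣ ≤ ∣ T ∣) where
    abstract
      pairing : ∃ λ (g : Fin (size M) → Fin (size M)) → ∀ y → y ∈ T → g y ∈ rest noclaw × Partner noclaw y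
          (g y)
      pairing = choose T id (partner noclaw)

    pair : Fin (size M) → Fin (size M)
    pair = proj₁ pairing

    module _ {y : Fin (size M)} (y∈ : y ∈ T) where
      pair-∈rest : pair y ∈ rest noclaw
      pair-∈rest = proj₁ (proj₂ pairing y y∈)

      pair-dep : ¬ Indep M (S ⊹ y ⊹ pair y)
      pair-dep = proj₂ (proj₂ pairing y y∈)

      pair-∈G : pair y ∈ G
      pair-∈G = proj₁ (∈rest noclaw pair-∈rest)

      pair-∉S : pair y ∉ S
      pair-∉S = proj₁ (proj₂ (∈rest noclaw pair-∈rest))

      pair-∉T : pair y ∉ T
      pair-∉T = proj₂ (proj₂ (∈rest noclaw pair-∈rest))

      pair-≢ : pair y ≢ y
      pair-≢ eq = pair-∉T (subst (_∈ T) (sym eq) y∈)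

    pair-injective : ∀ {y z} → y ∈ T → z ∈ T → pair y ≡ pair z → y ≡ z
    pair-injective {y} {z} y∈ z∈ eq = partner-injective noclaw y∈ z∈ (pair-∈rest y∈) (pair-dep y∈)
      (subst (Partner noclaw z) (sym eq) (pair-dep z∈))

    -- x lies in the parallel class of y in M / S.
    Over : (y x : Fin (size M)) → Set
    Over y x = x ≡ y ⊎ x ≡ pair y

    abstract
      cover : ∀ {x} → x ∈ G → x ∉ S → ∃ λ y → y ∈ T × Over y x
      cover {x} x∈G x∉S = split (x ∈? T) (λ x∈T → x , x∈T , inj₁ refl) λ x∉T →
        case ∣∣-surjective {R = λ y x → pair y ≡ x} T (rest noclaw) (λ y x → pair y ≟ᶠ x)
               (λ y∈ → _ , pair-∈rest y∈ , refl) (λ y∈ z∈ p q → pair-injective y∈ z∈ (trans p (sym q))) tight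
               (∈─⁺ (∈─⁺ x∈G x∉S) x∉T) of λ { (y , y∈ , eq) → y , y∈ , inj₂ (sym eq) }

    module _ {y x : Fin (size M)} (y∈ : y ∈ T) where
      over-∈G : Over y x → x ∈ G
      over-∈G = [ (λ { refl → T⊆G tr y∈ }) , (λ { refl → pair-∈G y∈ }) ]′

      over-∉S : Over y x → x ∉ S
      over-∉S = [ (λ { refl → T∌S tr y∈ }) , (λ { refl → pair-∉S y∈ }) ]′

      indep-over : ∀ {W} → Over y x → y ∉ W → Indep M (S ∪ (W ⊹ y)) → Indep M (S ∪ (W ⊹ x))
      indep-over (inj₁ refl) y∉W ind = ind
      indep-over (inj₂ refl) y∉W ind = parallel-replace (T∌S tr y∈) y∉W (pair-∈G y∈) (pair-∉S y∈) (pair-≢ y∈)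
          (pair-dep y∈) ind

    over-unique : ∀ {y z x} → y ∈ T → z ∈ T → Over y x → Over z x → y ≡ z
    over-unique y∈ z∈ (inj₁ refl) (inj₁ refl) = refl
    over-unique y∈ z∈ (inj₁ refl) (inj₂ eq)   = contradiction (subst (_∈ T) eq y∈) (pair-∉T z∈)
    over-unique y∈ z∈ (inj₂ refl) (inj₁ eq)   = contradiction (subst (_∈ T) (sym eq) z∈) (pair-∉T y∈)
    over-unique y∈ z∈ (inj₂ refl) (inj₂ eq)   = pair-injective y∈ z∈ eq

    -- e belongs to the circuit contained in S ∪ {y , pair y}.
    Supp : (e y : Fin (size M)) → Set
    Supp e y = e ∈ S × Indep M ((S - e) ⊹ y ⊹ pair y)

    Supp? : ∀ e y → Dec (Supp e y)
    Supp? e y = (e ∈? S) ×-dec Indep? M ((S - e) ⊹ y ⊹ pair y)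

    -- Exchanging `pair y` into `S ⊹ y` while keeping `J ⊹ y` removes an element of the circuit,
    -- necessarily one of `S`. Thus `J` cannot contain the whole support.
    supp-outside : ∀ {y J} → y ∈ T → J ⊆ S → Indep M (J ⊹ y ⊹ pair y) → ∃ λ e → Supp e y × e ∉ J
    supp-outside {y} {J} y∈ J⊆S ind =
      case exchange M {I = S ⊹ y} {J = J ⊹ y} (indep-S⊹ (T⊆G tr y∈)) (⊹-mono J⊆S)
          (∉⊹ (pair-∉S y∈) (pair-≢ y∈)) ind (pair-dep y∈) of
      λ { (e , e∈ , e∉ , ind′) →
        let e≢y = λ e≡y → e∉ (subst (_∈ J ⊹ y) (sym e≡y) ∈⊹ʳ) in
        e , ( [ id , (λ e≡y → contradiction e≡y e≢y) ]′ (∈⊹⁻ S e∈)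
            , ⊆-indep M (⊹-mono (⊹-lub
                (λ x∈ → let x∈S , x≢e = ∈-⁻ {p = S} x∈ in ∈-⁺ (∈∪ˡ x∈S) x≢e)
                (∈-⁺ ∈⊹ʳ (e≢y ∘ sym)))) ind′)
          , e∉ ∘ ∈∪ˡ }

    supp-nonempty : ∀ {y} → y ∈ T → ∃ λ e → Supp e y
    supp-nonempty {y} y∈ = case supp-outside {J = ⊥} y∈ ⊥⊆
        (⊆-indep M (⊹-mono (∪-lub ⊥⊆ id)) (simple (T⊆G tr y∈) (pair-∈G y∈))) of
      λ { (e , supp , _) → e , supp }

    -- The condition on x says that y and z span a two-point line of N. For `X` to be a claw the
    -- delicate elements are the partners: if `X ⊹ pair w` were dependent, `dep-∩` would place the
    -- circuit of w and `pair w` in `(S - e) ⊹ w ⊹ pair w` when w is y or z, against e being in both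
    -- supports, and in `S ⊹ pair w` otherwise, against the claw `S`.
    supp-disjoint : ∀ {y z} → y ∈ T → z ∈ T → y ≢ z →
        (∀ {x} → x ∈ T → x ≢ y → x ≢ z → Indep M (S ⊹ y ⊹ z ⊹ x)) →
                    ∀ {e} → Supp e y → ¬ Supp e z
    supp-disjoint {y} {z} y∈ z∈ y≢z line {e} (e∈ , suppy) (_ , suppz) = noclaw X-claw ∣X∣
      where
      X = (S - e) ⊹ y ⊹ z
      S-e⊆S : S - e ⊆ S
      S-e⊆S = -⊆ {p = S}
      X⊆ : X ⊆ S ⊹ y ⊹ z
      X⊆ = ⊹-mono (⊹-mono S-e⊆S)
      indSyz : Indep M (S ⊹ y ⊹ z)
      indSyz = T-pair tr y∈ z∈ y≢z
      ∣X∣ : ∣ X ∣ ≡ suc ∣ S ∣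
      ∣X∣ = trans (∣⊹∣ ((S - e) ⊹ y) (∉⊹ (T∌S tr z∈ ∘ S-e⊆S) (y≢z ∘ sym)))
              (cong suc (trans (∣⊹∣ (S - e) (T∌S tr y∈ ∘ S-e⊆S)) (sym (∣-∣ e∈))))
      pairs : ∀ {w} → w ∈ T → Indep M (X ⊹ pair w)
      pairs {w} w∈ = decidable-stable (Indep? M (X ⊹ pair w)) λ dep →
        dep-∩ M {I = S ⊹ y ⊹ z ⊹ w} (S ⊹ w) X indI
            (∉⊹ (∉⊹ (∉⊹ (pair-∉S w∈) (pair≢ y∈)) (pair≢ z∈)) (pair≢ w∈))
          (⊹-mono (∈∪ˡ ∘ ∈∪ˡ)) (∈∪ˡ ∘ X⊆) (pair-dep w∈) dep
          (split (w ≟ᶠ y) (λ { refl → ⊆-indep M (⊹-mono ∩-w) suppy }) λ w≢y →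
           split (w ≟ᶠ z) (λ { refl → ⊆-indep M (⊹-mono ∩-w) suppz }) λ w≢z →
           ⊆-indep M (⊹-mono λ v∈ → S-e⊆S (∩-other v∈ w≢y w≢z)) (indep-S⊹ (pair-∈G w∈)))
        where
        pair≢ : ∀ {v} → v ∈ T → pair w ≢ v
        pair≢ v∈ eq = pair-∉T w∈ (subst (_∈ T) (sym eq) v∈)
        indI : Indep M (S ⊹ y ⊹ z ⊹ w)
        indI = split (w ≟ᶠ y) (λ { refl → ⊆-indep M (⊹-lub id (∈∪ˡ ∈⊹ʳ)) indSyz }) λ w≢y →
               split (w ≟ᶠ z) (λ { refl → ⊆-indep M (⊹-lub id ∈⊹ʳ) indSyz }) λ w≢z → line w∈ w≢y w≢z
        data In (v : Fin (size M)) : Set where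
          in-S : v ∈ S - e → In v
          is-y : v ≡ y → v ≡ w → In v
          is-z : v ≡ z → v ≡ w → In v
        view : ∀ {v} → v ∈ (S ⊹ w) ∩ X → In v
        view {v} v∈ = case x∈p∩q⁻ (S ⊹ w) X v∈ of λ { (v∈Sw , v∈X) →
          [ (λ v∈′ → [ in-S , (λ v≡y → [ (λ v∈S → contradiction (subst (_∈ S) v≡y v∈S) (T∌S tr y∈)) , is-y v≡y
              ]′ (∈⊹⁻ S v∈Sw)) ]′ (∈⊹⁻ (S - e) v∈′))
          , (λ v≡z → [ (λ v∈S → contradiction (subst (_∈ S) v≡z v∈S) (T∌S tr z∈)) , is-z v≡z ]′ (∈⊹⁻ S v∈Sw))
              ]′ (∈⊹⁻ ((S - e) ⊹ y) v∈X) }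
        ∩-w : ∀ {v} → v ∈ (S ⊹ w) ∩ X → v ∈ (S - e) ⊹ w
        ∩-w v∈ = case view v∈ of λ { (in-S p) → ∈∪ˡ p ; (is-y _ refl) → ∈⊹ʳ ; (is-z _ refl) → ∈⊹ʳ }
        ∩-other : ∀ {v} → v ∈ (S ⊹ w) ∩ X → w ≢ y → w ≢ z → v ∈ S - e
        ∩-other v∈ w≢y w≢z = case view v∈ of λ { (in-S p) → p ; (is-y p q) → contradiction (trans (sym q) p)
            w≢y ; (is-z p q) → contradiction (trans (sym q) p) w≢z }
      X-claw : Claw M G X
      X-claw = record
        { claw⊆ = ⊹-lub (⊹-lub (claw⊆ claw ∘ S-e⊆S) (T⊆G tr y∈)) (T⊆G tr z∈)
        ; claw-indep = ⊆-indep M X⊆ indSyz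
        ; claw-ext = λ {x} x∈G x∉X → split (x ∈? S) (λ x∈S → ⊆-indep M (⊹-lub X⊆ (∈∪ˡ (∈∪ˡ x∈S))) indSyz) λ
            x∉S →
            case cover x∈G x∉S of λ
              { (.x , x∈T , inj₁ refl) →
                  ⊆-indep M (⊹-mono X⊆) (line x∈T (λ { refl → x∉X (∈∪ˡ ∈⊹ʳ) }) (λ { refl → x∉X ∈⊹ʳ }))
              ; (w , w∈ , inj₂ refl) → pairs w∈ } }

-- Lifting a decomposition from the contraction

pair-of : ∀ {n} {X : Subset n} → ∣ X ∣ ≡ 2 → ∃₂ λ a b → a ∈ X × b ∈ X × a ≢ b × X ⊆ ⁅ a ⁆ ⊹ b
pair-of {X = X} ∣X∣ =
  case ∣∣>0⇒∈ {p = X} (≤-trans (s≤s z≤n) (≤-reflexive (sym ∣X∣))) of λ { (a , a∈) →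
  let ∣X-a∣ : ∣ (X - a) ∣ ≡ 1
      ∣X-a∣ = suc-injective (trans (sym (∣-∣ a∈)) ∣X∣) in
  case ∣∣>0⇒∈ {p = X - a} (≤-reflexive (sym ∣X-a∣)) of λ { (b , b∈) →
  a , b , a∈ , -⊆ {p = X} b∈ , (λ a≡b → ∉- {p = X} (subst (_∈ X - a) (sym a≡b) b∈)) ,
  λ {x} x∈ → split (x ≟ᶠ a) (λ { refl → ∈∪ˡ (x∈⁅x⁆ a) }) λ x≢a → split (x ≟ᶠ b) (λ { refl → ∈⊹ʳ }) λ x≢b →
    contradiction (∈-⁺ (∈-⁺ x∈ x≢a) x≢b) (∣∣≡0⇒∉ (suc-injective (trans (sym (∣-∣ b∈)) ∣X-a∣))) } }

-- The classes of N are indexed by `S`, and by `single` the circuit of y meets `S` only in `colᴺ y`.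
-- The new class of e consists of e, the old class and the partners of its elements. `points` covers
-- both uses: either every old class supplies a point with which to build a large claw, or no old
-- class has two points.
module Step (M : Matroid) (G S T : Subset (size M)) (simple : Simple M G) (claw : Claw M G S)
    (tr : Transversal M G S T) (noclaw : NoClaw M G (suc ∣ S ∣))
    (tight : ∣ Contraction.rest M G S T simple claw tr noclaw ∣ ≤ ∣ T ∣)
    (colᴺ : Fin (size M) → Fin (size M)) (colᴺ-∈ : ∀ {y} → y ∈ T → colᴺ y ∈ S)
    (single : ∀ {e y} → y ∈ T → Tight.Supp M G S T simple claw tr noclaw tight e y → e ≡ colᴺ y)
    (B : Subset (size M)) (B-indepᴺ : Indep (Contraction.N M G S T simple claw tr) B) (B⊆T : B ⊆ T)
    (basisᴺ : ∀ e → Basis (Contraction.N M G S T simple claw tr) (cls T colᴺ e) (B ∩ cls T colᴺ e))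
    (k : ℕ) (rankᴺ : ∀ {e} → e ∈ S → ∣ B ∩ cls T colᴺ e ∣ ≡ k ⊎ ∣ B ∩ cls T colᴺ e ∣ ≡ suc k)
    (sizeᴺ : ∀ {e} → e ∈ S → ∣ cls T colᴺ e ∣ + 1 ≡ 2 ^ ∣ B ∩ cls T colᴺ e ∣)
    (points : (∀ {e} → e ∈ S → ∃ λ z → z ∈ cls T colᴺ e) ⊎ (∀ {y z} → y ∈ T → z ∈ T → colᴺ y ≡ colᴺ z →
        y ≡ z)) where
  open Contraction M G S T simple claw tr
  private module P = Tight M G S T simple claw tr noclaw
  private
    pair = P.pair tight
    Over = P.Over tight
    S⊆G = claw⊆ claw

    C : Fin (size M) → Subset (size M)
    C = cls T colᴺ

    ∈C⁻ : ∀ {y e} → y ∈ C e → y ∈ T × colᴺ y ≡ e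
    ∈C⁻ = ∈cls⁻ T colᴺ

    separatedᴺ : Separated N T colᴺ
    separatedᴺ = spanning⇒separated N colᴺ B-indepᴺ λ {x} {e} → basis-spans (basisᴺ e)

    abstract
      colouring : ∃ λ (g : Fin (size M) → Fin (size M)) → ∀ x → x ∈ G →
        (x ∈ S → g x ≡ x) × (∀ y → y ∈ T → Over y x → g x ≡ colᴺ y)
      colouring = choose G {P = λ x c → (x ∈ S → c ≡ x) × (∀ y → y ∈ T → Over y x → c ≡ colᴺ y)} id λ {x} x∈G
          → split (x ∈? S)
        (λ x∈S → x , (λ _ → refl) , λ y y∈ over → contradiction x∈S (P.over-∉S tight y∈ over))
        (λ x∉S → case P.cover tight x∈G x∉S of λ { (y , y∈ , over) → colᴺ y , (λ x∈S → contradiction x∈S x∉S)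
            ,
          λ z z∈ over′ → cong colᴺ (P.over-unique tight y∈ z∈ over over′) })

  col : Fin (size M) → Fin (size M)
  col = proj₁ colouring

  private
    col-S : ∀ {x} → x ∈ S → col x ≡ x
    col-S x∈ = proj₁ (proj₂ colouring _ (S⊆G x∈)) x∈

    col-over : ∀ {y x} → y ∈ T → Over y x → col x ≡ colᴺ y
    col-over y∈ over = proj₂ (proj₂ colouring _ (P.over-∈G tight y∈ over)) _ y∈ over

    col-∈S : ∀ {x} → x ∈ G → col x ∈ S
    col-∈S {x} x∈G = split (x ∈? S) (λ x∈S → subst (_∈ S) (sym (col-S x∈S)) x∈S) λ x∉S →
      case P.cover tight x∈G x∉S of λ { (y , y∈ , over) → subst (_∈ S) (sym (col-over y∈ over)) (colᴺ-∈ y∈) }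

    E : Fin (size M) → Subset (size M)
    E = cls G col

    E⊆G : ∀ {e} → E e ⊆ G
    E⊆G = proj₁ ∘ ∈cls⁻ G col

    over-∈E : ∀ {y x} → y ∈ T → Over y x → x ∈ E (colᴺ y)
    over-∈E y∈ over = ∈cls⁺ G col (P.over-∈G tight y∈ over) (col-over y∈ over)

    data View (e x : Fin (size M)) : Set where
      root : x ≡ e → View e x
      over : ∀ y → y ∈ T → colᴺ y ≡ e → Over y x → View e x

    view : ∀ {e x} → x ∈ E e → View e x
    view {e} {x} x∈ = case ∈cls⁻ G col x∈ of λ { (x∈G , eq) → split (x ∈? S)
      (λ x∈S → root (trans (sym (col-S x∈S)) eq))
      (λ x∉S → case P.cover tight x∈G x∉S of λ { (y , y∈ , o) → over y y∈ (trans (sym (col-over y∈ o)) eq) o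
          }) }

    -- Otherwise `supp-outside` produces a second element of the support, contrary to `single`.
    triangle : ∀ {y} → y ∈ T → Collinear M (colᴺ y) y (pair y)
    triangle {y} y∈ ind = case P.supp-outside tight {J = ⁅ colᴺ y ⁆} y∈ (⁅⁆⊆ (colᴺ-∈ y∈)) ind of λ
        { (e , supp , e∉) →
      e∉ (subst (_∈ ⁅ colᴺ y ⁆) (sym (single y∈ supp)) (x∈⁅x⁆ (colᴺ y))) }

    -- Over `S` a partner may be replaced by its representative, so induction on the number of
    -- elements outside `T` reduces to the direct sum N.
    lift-separated : ∀ W → (∀ {x} → x ∈ W → x ∈ G × x ∉ S) → (∀ e → Indep M (S ∪ (W ∩ E e))) → Indep M (S ∪ W)
    lift-separated W W⊆ indW = go ∣ W ─ T ∣ W ≤-refl W⊆ indW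
      where
      go : ∀ m W → ∣ W ─ T ∣ ≤ m → (∀ {x} → x ∈ W → x ∈ G × x ∉ S) → (∀ e → Indep M (S ∪ (W ∩ E e))) →
          Indep M (S ∪ W)
      go m W le W⊆ indW = case nonempty? (W ─ T) of λ
        { (no empty) →
            let W⊆T : W ⊆ T
                W⊆T {x} x∈ = decidable-stable (x ∈? T) λ x∉ → empty (x , ∈─⁺ x∈ x∉)
            in proj₂ (separatedᴺ W W⊆T λ e → N-indep (W⊆T ∘ p∩q⊆p W (C e)) (⊆-indep M
                 (∪-lub ∈∪ˡ (λ x∈ → case x∈p∩q⁻ W (C e) x∈ of λ
                     { (x∈W , x∈C) → case ∈C⁻ x∈C of λ { (x∈T , refl) →
                   ∈∪ʳ (x∈p∩q⁺ (x∈W , over-∈E x∈T (inj₁ refl))) } })) (indW e)))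
        ; (yes (x , x∈)) → case ∈─⁻ W T x∈ of λ { (x∈W , x∉T) → case W⊆ x∈W of λ { (x∈G , x∉S) →
            case P.cover tight x∈G x∉S of λ
              { (y , y∈ , inj₁ refl) → contradiction y∈ x∉T
              ; (y , y∈ , inj₂ refl) → replaced m W le W⊆ indW y y∈ x∈W x∈ } } } }
        where
        replaced : ∀ m W → ∣ W ─ T ∣ ≤ m → (∀ {x} → x ∈ W → x ∈ G × x ∉ S) → (∀ e → Indep M (S ∪ (W ∩ E e))) →
                   ∀ y → y ∈ T → pair y ∈ W → pair y ∈ W ─ T → Indep M (S ∪ W)
        replaced zero W le W⊆ indW y y∈ x∈W x∈ = contradiction (n≤0⇒n≡0 le) (λ eq → ∣∣≡0⇒∉ eq x∈)
        replaced (suc m) W le W⊆ indW y y∈ x∈W x∈ =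
          ⊆-indep M (∪-lub ∈∪ˡ (∈∪ʳ ∘ ⊆-⊹)) (P.indep-over tight y∈ (inj₂ refl) (y∉W ∘ -⊆ {p = W})
            (go m ((W - pair y) ⊹ y) smaller (λ z∈ → [ W⊆ ∘ -⊆ {p = W} , (λ { refl → T⊆G tr y∈ , T∌S tr y∈ })
                ]′ (∈⊹⁻ (W - pair y) z∈)) indW′))
          where
          indSyx : ∀ e → y ∈ W ∩ E e → pair y ∈ W ∩ E e → Indep M (S ⊹ y ⊹ pair y)
          indSyx e p q = ⊆-indep M (⊹-lub (⊹-lub ∈∪ˡ (∈∪ʳ p)) (∈∪ʳ q)) (indW e)
          y∉W : y ∉ W
          y∉W y∈W = P.pair-dep tight y∈
              (indSyx (colᴺ y) (x∈p∩q⁺ (y∈W , over-∈E y∈ (inj₁ refl)))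
              (x∈p∩q⁺ (x∈W , over-∈E y∈ (inj₂ refl))))
          smaller : ∣ ((W - pair y) ⊹ y) ─ T ∣ ≤ m
          smaller = ≤-pred (≤-trans (s≤s (p⊆q⇒∣p∣≤∣q∣ {q = (W ─ T) - pair y} λ z∈ →
              case ∈─⁻ ((W - pair y) ⊹ y) T z∈ of λ { (z∈′ , z∉T) →
            [ (λ z∈W → case ∈-⁻ {p = W} z∈W of λ { (z∈W , z≢) → ∈-⁺ (∈─⁺ z∈W z∉T) z≢ }) ,
                (λ { refl → contradiction y∈ z∉T }) ]′ (∈⊹⁻ (W - pair y) z∈′) }))
            (≤-trans (≤-reflexive (sym (∣-∣ x∈))) le))
          indW′ : ∀ e → Indep M (S ∪ (((W - pair y) ⊹ y) ∩ E e))
          indW′ e = split (colᴺ y ≟ᶠ e)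
            (λ { refl → ⊆-indep M (∪-lub ∈∪ˡ
                (λ z∈ → case x∈p∩q⁻ ((W - pair y) ⊹ y) (E e) z∈ of λ { (z∈′ , z∈E) →
                  ∈∪ʳ ([ (λ z∈W → case ∈-⁻ {p = W} z∈W of λ
                      { (z∈W , z≢) → ∈∪ˡ (∈-⁺ (x∈p∩q⁺ (z∈W , z∈E)) z≢) }) , (λ { refl → ∈⊹ʳ }) ]′
                      (∈⊹⁻ (W - pair y) z∈′)) }))
                (parallel-replace (P.pair-∉S tight y∈) (∉- {p = W ∩ E e}) (T⊆G tr y∈) (T∌S tr y∈)
                    (P.pair-≢ tight y∈ ∘ sym)
                  (P.pair-dep tight y∈ ∘ ⊆-indep M (⊹-lub (⊹-lub (∈∪ˡ ∘ ∈∪ˡ) ∈⊹ʳ) (∈∪ˡ ∈⊹ʳ)))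
                  (⊆-indep M (∪-lub ∈∪ˡ (∈∪ʳ ∘ ⊹-lub (-⊆ {p = W ∩ E e})
                      (x∈p∩q⁺ (x∈W , over-∈E y∈ (inj₂ refl))))) (indW e))) })
            (λ ≢e → ⊆-indep M (∪-lub ∈∪ˡ (λ z∈ → case x∈p∩q⁻ ((W - pair y) ⊹ y) (E e) z∈ of λ { (z∈′ , z∈E) →
                  ∈∪ʳ (x∈p∩q⁺ ([ -⊆ {p = W} ,
                      (λ { refl → contradiction (trans (sym (col-over y∈ (inj₁ refl)))
                      (proj₂ (∈cls⁻ G col z∈E))) ≢e }) ]′ (∈⊹⁻ (W - pair y) z∈′) , z∈E)) })) (indW e))

    -- Lines through e and lines joining some y to `pair y` are completed by the triangle of e, y
    -- and `pair y`. What remains are points over two different elements of `T`.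
    third-E : ∀ {e a b} → a ∈ E e → b ∈ E e → a ≢ b → ∃ λ c → c ∈ E e × c ≢ a × c ≢ b × Collinear M a b c
    third-E {e} {a} {b} a∈ b∈ a≢b = case (view a∈ , view b∈) of λ
      { (root refl , root refl) → contradiction refl a≢b
      ; (root refl , over y y∈ refl o) → from-root y∈ o
      ; (over y y∈ refl o , root refl) →
          case from-root y∈ o of λ { (c , c∈ , c≢e , c≢a , tri) → c , c∈ , c≢a , c≢e , collinear-swap M tri }
      ; (over y y∈ refl o , over z z∈ eq o′) → split (y ≟ᶠ z)
          (λ { refl → same y∈ o o′ })
          (λ y≢z → different y∈ z∈ y≢z eq o o′) }
      where
      col-∈E : ∀ {y} → y ∈ T → colᴺ y ∈ E (colᴺ y)
      col-∈E y∈ = ∈cls⁺ G col (S⊆G (colᴺ-∈ y∈)) (col-S (colᴺ-∈ y∈))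
      ≢col : ∀ {y x} → y ∈ T → Over y x → x ≢ colᴺ y
      ≢col y∈ o eq = P.over-∉S tight y∈ o (subst (_∈ S) (sym eq) (colᴺ-∈ y∈))
      from-root : ∀ {y b} → y ∈ T → Over y b → ∃ λ c → c ∈ E (colᴺ y) × c ≢ colᴺ y × c ≢ b × Collinear M
          (colᴺ y) b c
      from-root {y} y∈ (inj₁ refl) = pair y , over-∈E y∈ (inj₂ refl) , ≢col y∈ (inj₂ refl) , P.pair-≢ tight y∈
          , triangle y∈
      from-root {y} y∈ (inj₂ refl) = y , over-∈E y∈ (inj₁ refl) , ≢col y∈ (inj₁ refl) , P.pair-≢ tight y∈ ∘
          sym ,
        collinear-swap M (collinear-rotate M (collinear-rotate M (triangle y∈)))
      same : ∀ {y} → y ∈ T → Over y a → Over y b → ∃ λ c → c ∈ E (colᴺ y) × c ≢ a × c ≢ b × Collinear M a b c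
      same y∈ (inj₁ refl) (inj₁ refl) = contradiction refl a≢b
      same y∈ (inj₂ refl) (inj₂ refl) = contradiction refl a≢b
      same {y} y∈ (inj₁ refl) (inj₂ refl) = colᴺ y , col-∈E y∈ , ≢col y∈ (inj₁ refl) ∘ sym , ≢col y∈
          (inj₂ refl) ∘ sym , collinear-rotate M (triangle y∈)
      same {y} y∈ (inj₂ refl) (inj₁ refl) = colᴺ y , col-∈E y∈ , ≢col y∈ (inj₂ refl) ∘ sym , ≢col y∈
          (inj₁ refl) ∘ sym , collinear-swap M (collinear-rotate M (triangle y∈))

      -- With one point z f of every other class f, the points a and b would form a (t + 1)-claw.
      different : ∀ {y z} → y ∈ T → z ∈ T → y ≢ z → colᴺ z ≡ colᴺ y → Over y a → Over z b →
                  ∃ λ c → c ∈ E (colᴺ y) × c ≢ a × c ≢ b × Collinear M a b c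
      different {y} {z} y∈ z∈ y≢z eq oa ob = case points of λ
        { (inj₂ small) → contradiction (small y∈ z∈ (sym eq)) y≢z
        ; (inj₁ full) → case choose S {P = λ f z → z ∈ C f} id full of λ
            { (ζ , ζ∈) → Transversal-claw.third ζ ζ∈ } }
        where
        module Transversal-claw (ζ : Fin (size M) → Fin (size M)) (ζ∈ : ∀ f → f ∈ S → ζ f ∈ C f) where
          e₀ = colᴺ y
          e₀∈S : e₀ ∈ S
          e₀∈S = colᴺ-∈ y∈
          Z? : Decidable (λ x → x ∈ T × colᴺ x ≢ e₀ × ζ (colᴺ x) ≡ x)
          Z? x = (x ∈? T) ×-dec ¬? (colᴺ x ≟ᶠ e₀) ×-dec (ζ (colᴺ x) ≟ᶠ x)
          Z X : Subset (size M)
          Z = ⟪ Z? ⟫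
          X = Z ⊹ a ⊹ b
          a∈E : a ∈ E e₀
          a∈E = over-∈E y∈ oa
          b∈E : b ∈ E e₀
          b∈E = subst (λ e → b ∈ E e) eq (over-∈E z∈ ob)
          Z∉E : ∀ {x} → x ∈ Z → x ∉ E e₀
          Z∉E x∈Z x∈E = case ∈⟪⟫⁻ Z? x∈Z of λ
              { (x∈T , ≢e₀ , _) → ≢e₀ (trans (sym (col-over x∈T (inj₁ refl))) (proj₂ (∈cls⁻ G col x∈E))) }
          ∣Z∣ : ∣ Z ∣ ≡ ∣ (S - e₀) ∣
          ∣Z∣ = ≤-antisym
            (∣∣-injective {R = λ x f → x ∈ Z × colᴺ x ≡ f} Z (S - e₀)
              (λ x∈ → case ∈⟪⟫⁻ Z? x∈ of λ { (x∈T , ≢e₀ , _) → _ , ∈-⁺ (colᴺ-∈ x∈T) ≢e₀ , x∈ , refl })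
              (λ { _ _ (x∈ , p) (x′∈ , q) → trans (sym (proj₂ (proj₂ (∈⟪⟫⁻ Z? x∈))))
                  (trans (cong ζ (trans p (sym q))) (proj₂ (proj₂ (∈⟪⟫⁻ Z? x′∈)))) }))
            (∣∣-injective {R = λ f x → f ∈ S × ζ f ≡ x} (S - e₀) Z
              (λ f∈ → case ∈-⁻ {p = S} f∈ of λ { (f∈S , f≢) → case ∈C⁻ (ζ∈ _ f∈S) of λ { (ζ∈T , c≡) →
                _ , ∈⟪⟫⁺ Z? (ζ∈T , (λ eq → f≢ (trans (sym c≡) eq)) , cong ζ c≡) , f∈S , refl } })
              (λ { _ _ (f∈ , p) (g∈ , q) → trans (sym (proj₂ (∈C⁻ (ζ∈ _ f∈))))
                  (trans (cong colᴺ (trans p (sym q))) (proj₂ (∈C⁻ (ζ∈ _ g∈)))) }))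
          ∣X∣ : ∣ X ∣ ≡ suc ∣ S ∣
          ∣X∣ = trans (∣⊹∣ (Z ⊹ a) (∉⊹ (λ b∈ → Z∉E b∈ b∈E) (a≢b ∘ sym)))
            (cong suc (trans (∣⊹∣ Z (λ a∈ → Z∉E a∈ a∈E)) (trans (cong suc ∣Z∣) (sym (∣-∣ e₀∈S)))))
          X⊆ : ∀ {x} → x ∈ X → x ∈ G × x ∉ S
          X⊆ x∈ = [ (λ x∈′ → [ (λ x∈Z → case ∈⟪⟫⁻ Z? x∈Z of λ { (x∈T , _) → T⊆G tr x∈T , T∌S tr x∈T })
                                  , (λ { refl → P.over-∈G tight y∈ oa , P.over-∉S tight y∈ oa }) ]′
                                      (∈⊹⁻ Z x∈′))
                    , (λ { refl → P.over-∈G tight z∈ ob , P.over-∉S tight z∈ ob }) ]′ (∈⊹⁻ (Z ⊹ a) x∈)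
          X∩e₀ : X ∩ E e₀ ⊆ ⁅ a ⁆ ⊹ b
          X∩e₀ x∈ = case x∈p∩q⁻ X (E e₀) x∈ of λ { (x∈X , x∈E) →
            [ (λ x∈′ → [ (λ x∈Z → contradiction x∈E (Z∉E x∈Z)) , (λ { refl → ∈∪ˡ (x∈⁅x⁆ a) }) ]′ (∈⊹⁻ Z x∈′))
                , (λ { refl → ∈⊹ʳ }) ]′ (∈⊹⁻ (Z ⊹ a) x∈X) }
          X∩f : ∀ {f} → f ≢ e₀ → X ∩ E f ⊆ ⁅ ζ f ⁆
          X∩f {f} f≢ x∈ = case x∈p∩q⁻ X (E f) x∈ of λ { (x∈X , x∈E) → let c≡f = proj₂ (∈cls⁻ G col x∈E) in
            [ (λ x∈′ → [ (λ x∈Z → case ∈⟪⟫⁻ Z? x∈Z of λ { (x∈T , _ , ζ≡) →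
                           subst (_∈ ⁅ ζ f ⁆) (trans (cong ζ (trans (sym c≡f) (col-over x∈T (inj₁ refl)))) ζ≡)
                               (x∈⁅x⁆ (ζ f)) })
                       , (λ { refl → contradiction (trans (sym c≡f) (proj₂ (∈cls⁻ G col a∈E))) f≢ }) ]′
                           (∈⊹⁻ Z x∈′))
            , (λ { refl → contradiction (trans (sym c≡f) (proj₂ (∈cls⁻ G col b∈E))) f≢ }) ]′ (∈⊹⁻ (Z ⊹ a) x∈X)
                }
          indSab : Indep M (S ∪ (⁅ a ⁆ ⊹ b))
          indSab = P.indep-over tight z∈ ob
              (λ z∈a → y≢z (P.over-unique tight y∈ z∈ (subst (Over y) (sym (x∈⁅y⁆⇒x≡y a z∈a)) oa)
              (inj₁ refl)))
            (⊆-indep M (∪-lub ∈∪ˡ (⊹-lub (⁅⁆⊆ (∈∪ʳ ∈⊹ʳ)) (∈∪ʳ (∈∪ˡ (x∈⁅x⁆ z)))))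
              (P.indep-over tight y∈ {W = ⁅ z ⁆} oa (y≢z ∘ x∈⁅y⁆⇒x≡y z)
                (⊆-indep M (∪-lub (∈∪ˡ ∘ ∈∪ˡ) (⊹-lub (⁅⁆⊆ ∈⊹ʳ) (∈∪ˡ ∈⊹ʳ))) (T-pair tr y∈ z∈ y≢z))))
          ζ∈G : ∀ {f} → f ∈ S → ζ f ∈ G
          ζ∈G f∈ = T⊆G tr (proj₁ (∈C⁻ (ζ∈ _ f∈)))
          E⇒∈S : ∀ {f x} → x ∈ E f → f ∈ S
          E⇒∈S x∈ = case ∈cls⁻ G col x∈ of λ { (x∈G , refl) → col-∈S x∈G }
          indX∩ : ∀ f → Indep M (S ∪ (X ∩ E f))
          indX∩ f = split (f ≟ᶠ e₀)
            (λ { refl → ⊆-indep M (∪-lub ∈∪ˡ (∈∪ʳ ∘ X∩e₀)) indSab })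
            (λ f≢ → split (f ∈? S)
              (λ f∈S → ⊆-indep M (∪-lub ∈∪ˡ (∈∪ʳ ∘ X∩f f≢)) (indep-S⊹ (ζ∈G f∈S)))
              (λ f∉S → ⊆-indep M (∪-lub id λ x∈ → contradiction (E⇒∈S (p∩q⊆q X (E f) x∈)) f∉S)
                  (claw-indep claw)))
          indSX : Indep M (S ∪ X)
          indSX = lift-separated X X⊆ indX∩
          third : ∃ λ c → c ∈ E e₀ × c ≢ a × c ≢ b × Collinear M a b c
          -- `X` has |S| + 1 elements, so it is not a claw and some c depends on it. By
          -- `lift-separated` the dependence over `S` is confined to the class of c, and `dep-∩`
          -- removes `S` again. A class other than that of e₀ has at most one point of `X`, which
          -- simplicity excludes.
          third = case extension-of-nonclaw M G X (proj₁ ∘ X⊆) (⊆-indep M ∈∪ʳ indSX) (λ c → noclaw c ∣X∣) of λ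
              { (c , c∈G , c∉X , dep) →
            let c∉S = λ c∈S → dep (⊆-indep M (⊹-lub ∈∪ʳ (∈∪ˡ c∈S)) indSX)
                f = col c
                c∈E = ∈cls⁺ G col c∈G refl
                depS : ¬ Indep M ((S ∪ (X ∩ E f)) ⊹ c)
                depS ind = dep (⊆-indep M ∈∪ʳ
                    (lift-separated (X ⊹ c) (λ x∈ → [ X⊆ , (λ { refl → c∈G , c∉S }) ]′ (∈⊹⁻ X x∈)) λ g →
                    split (g ≟ᶠ f)
                  (λ { refl → ⊆-indep M (∪-lub (∈∪ˡ ∘ ∈∪ˡ) λ x∈ → case x∈p∩q⁻ (X ⊹ c) (E f) x∈ of λ
                      { (x∈′ , x∈E) →
                      [ (λ x∈X → ∈∪ˡ (∈∪ʳ (x∈p∩q⁺ (x∈X , x∈E)))) , (λ { refl → ∈⊹ʳ }) ]′ (∈⊹⁻ X x∈′) }) ind })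
                  (λ g≢f → ⊆-indep M (∪-lub ∈∪ˡ λ x∈ → case x∈p∩q⁻ (X ⊹ c) (E g) x∈ of λ { (x∈′ , x∈E) →
                      ∈∪ʳ (x∈p∩q⁺ ([ id , (λ { refl → contradiction (sym (proj₂ (∈cls⁻ G col x∈E))) g≢f }) ]′
                          (∈⊹⁻ X x∈′) , x∈E)) }) (indX∩ g))))
                dep∩ : ¬ Indep M ((X ∩ E f) ⊹ c)
                dep∩ ind = dep-∩ M (S ∪ (X ∩ E f)) X indSX (λ c∈ → [ c∉S , c∉X ]′ (x∈p∪q⁻ S X c∈))
                    (∪-lub ∈∪ˡ (∈∪ʳ ∘ p∩q⊆p X (E f))) ∈∪ʳ depS dep
                  (⊆-indep M (⊹-mono λ x∈ → case x∈p∩q⁻ (S ∪ (X ∩ E f)) X x∈ of λ { (x∈′ , x∈X) →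
                    [ (λ x∈S → contradiction x∈S (proj₂ (X⊆ x∈X))) , id ]′ (x∈p∪q⁻ S (X ∩ E f) x∈′) }) ind)
            in split (f ≟ᶠ e₀)
              (λ f≡ → c , subst (λ e → c ∈ E e) f≡ c∈E , (λ { refl → c∉X (∈∪ˡ ∈⊹ʳ) }) , (λ { refl → c∉X ∈⊹ʳ })
                  ,
                 λ ind → dep∩ (⊆-indep M (⊹-mono (X∩e₀ ∘ subst (λ e → _ ∈ X ∩ E e) f≡)) ind))
              (λ f≢ → contradiction (⊆-indep M (⊹-mono (X∩f f≢)) (simple (ζ∈G (E⇒∈S c∈E)) c∈G)) dep∩) }

    E-noclaw : ∀ {e} → NoClaw M (E e) 2
    E-noclaw {X} claw ∣X∣ = case pair-of ∣X∣ of λ { (a , b , a∈ , b∈ , a≢b , X⊆) →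
      case third-E (claw⊆ claw a∈) (claw⊆ claw b∈) a≢b of λ { (c , c∈ , c≢a , c≢b , col) →
      col (⊆-indep M (⊹-mono (⊹-lub (⁅⁆⊆ a∈) b∈))
        (claw-ext claw c∈ λ c∈X → [ (λ c∈a → c≢a (x∈⁅y⁆⇒x≡y a c∈a)) , c≢b ]′ (∈⊹⁻ ⁅ a ⁆ (X⊆ c∈X)))) } }

    Bᴹ : Subset (size M)
    Bᴹ = S ∪ B

    indBᴹ : Indep M Bᴹ
    indBᴹ = proj₂ B-indepᴺ

    module _ {e : Fin (size M)} (e∈S : e ∈ S) where
      I₀ : Subset (size M)
      I₀ = (B ∩ C e) ⊹ e

      e∉ : e ∉ B ∩ C e
      e∉ e∈ = T∌S tr (B⊆T (p∩q⊆p B (C e) e∈)) e∈S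

      I₀⊆E : I₀ ⊆ E e
      I₀⊆E = ⊹-lub (λ x∈ → case ∈C⁻ (p∩q⊆q B (C e) x∈) of λ { (x∈T , refl) → over-∈E x∈T (inj₁ refl) })
          (∈cls⁺ G col (S⊆G e∈S) (col-S e∈S))

      indI₀ : Indep M I₀
      indI₀ = ⊆-indep M (⊹-lub (∈∪ʳ ∘ p∩q⊆p B (C e)) (∈∪ˡ e∈S)) indBᴹ

      ∣I₀∣ : ∣ I₀ ∣ ≡ suc ∣ B ∩ C e ∣
      ∣I₀∣ = ∣⊹∣ (B ∩ C e) e∉

      Pairs : Subset (size M)
      Pairs = E e ∩ rest noclaw

      ∣Pairs∣≤ : ∣ Pairs ∣ ≤ ∣ C e ∣
      ∣Pairs∣≤ = ∣∣-injective {R = λ x y → y ∈ C e × x ≡ pair y} Pairs (C e)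
        (λ x∈ → case x∈p∩q⁻ (E e) (rest noclaw) x∈ of λ
            { (x∈E , x∈rest) → case ∈rest noclaw x∈rest of λ { (_ , x∉S , x∉T) →
          case view x∈E of λ
            { (root refl) → contradiction e∈S x∉S
            ; (over y y∈ _ (inj₁ refl)) → contradiction y∈ x∉T
            ; (over y y∈ eq (inj₂ x≡)) → y , ∈cls⁺ T colᴺ y∈ eq , ∈cls⁺ T colᴺ y∈ eq , x≡ } } })
        (λ { _ _ (_ , p) (_ , q) → trans p (sym q) })

      E⊆ : E e ⊆ (C e ⊹ e) ∪ Pairs
      E⊆ x∈ = case view x∈ of λ
        { (root refl) → ∈∪ˡ ∈⊹ʳ
        ; (over y y∈ eq (inj₁ refl)) → ∈∪ˡ (∈∪ˡ (∈cls⁺ T colᴺ y∈ eq))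
        ; (over y y∈ eq (inj₂ refl)) → ∈∪ʳ (x∈p∩q⁺ (x∈ , P.pair-∈rest tight y∈)) }

      2^≤ : 2 ^ ∣ I₀ ∣ ≤ ∣ span M (E e) I₀ ∣ + 1
      2^≤ = ≤-trans (≤-reflexive (sym (f-one ∣ I₀ ∣))) (+-monoˡ-≤ 1 (bound 1 M
        (λ x∈ y∈ → simple (E⊆G (span⊆ M x∈)) (E⊆G (span⊆ M y∈))) (span-basis M I₀⊆E indI₀)
            (span-noclaw M indI₀ E-noclaw)))

      ≤2^ : ∣ E e ∣ + 1 ≤ 2 ^ ∣ I₀ ∣
      ≤2^ = begin
        ∣ E e ∣ + 1                        ≤⟨ +-monoˡ-≤ 1 (p⊆q⇒∣p∣≤∣q∣ E⊆) ⟩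
        ∣ (C e ⊹ e) ∪ Pairs ∣ + 1          ≤⟨ +-monoˡ-≤ 1 (∣∪∣≤ (C e ⊹ e) Pairs) ⟩
        ∣ C e ⊹ e ∣ + ∣ Pairs ∣ + 1        ≡⟨ cong (λ x → x + ∣ Pairs ∣ + 1)
            (∣⊹∣ (C e) λ e∈C → T∌S tr (proj₁ (∈C⁻ e∈C)) e∈S) ⟩
        suc ∣ C e ∣ + ∣ Pairs ∣ + 1        ≤⟨ +-monoˡ-≤ 1 (+-monoʳ-≤ (suc ∣ C e ∣) ∣Pairs∣≤) ⟩
        suc ∣ C e ∣ + ∣ C e ∣ + 1          ≡⟨ cong (_+ 1) (+-comm (suc ∣ C e ∣) ∣ C e ∣) ⟩
        ∣ C e ∣ + suc ∣ C e ∣ + 1          ≡⟨ cong (λ x → ∣ C e ∣ + x + 1) (+-comm 1 ∣ C e ∣) ⟩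
        ∣ C e ∣ + (∣ C e ∣ + 1) + 1        ≡⟨ trans (cong (_+ 1) (+-comm ∣ C e ∣ (∣ C e ∣ + 1)))
            (+-assoc (∣ C e ∣ + 1) ∣ C e ∣ 1) ⟩
        (∣ C e ∣ + 1) + (∣ C e ∣ + 1)      ≡⟨ cong₂ _+_ (sizeᴺ e∈S) (sizeᴺ e∈S) ⟩
        2 ^ ∣ B ∩ C e ∣ + 2 ^ ∣ B ∩ C e ∣  ≡⟨ cong (2 ^ ∣ B ∩ C e ∣ +_) (+-identityʳ _) ⟨
        2 ^ suc ∣ B ∩ C e ∣                ≡⟨ cong (2 ^_) ∣I₀∣ ⟨
        2 ^ ∣ I₀ ∣                         ∎
        where open ≤-Reasoning

      -- With ρ the size of `I₀`, the class has at most 2^ρ - 1 elements, and the bound for t = 1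
      -- already finds that many in the span of `I₀`.
      spanning : E e ⊆ span M (E e) I₀
      spanning = ⊆∧∣∣≥⇒⊇ (span⊆ M) (+-cancelʳ-≤ 1 _ _ (≤-trans ≤2^ 2^≤))

      ∣E∣ : ∣ E e ∣ + 1 ≡ 2 ^ ∣ I₀ ∣
      ∣E∣ = ≤-antisym ≤2^ (≤-trans 2^≤ (+-monoˡ-≤ 1 (p⊆q⇒∣p∣≤∣q∣ (span⊆ M))))

      I₀≡ : I₀ ≡ Bᴹ ∩ E e
      I₀≡ = ⊆-antisym
        (λ x∈ → x∈p∩q⁺ ([ ∈∪ʳ ∘ p∩q⊆p B (C e) , (λ { refl → ∈∪ˡ e∈S }) ]′ (∈⊹⁻ (B ∩ C e) x∈) , I₀⊆E x∈))
        (λ x∈ → case x∈p∩q⁻ Bᴹ (E e) x∈ of λ { (x∈B , x∈E) →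
          [ (λ x∈S → subst (_∈ I₀) (trans (sym (proj₂ (∈cls⁻ G col x∈E))) (col-S x∈S)) ∈⊹ʳ)
          , (λ x∈B → ∈∪ˡ (x∈p∩q⁺ (x∈B , ∈cls⁺ T colᴺ (B⊆T x∈B)
              (trans (sym (col-over (B⊆T x∈B) (inj₁ refl))) (proj₂ (∈cls⁻ G col x∈E))))))
          ]′ (x∈p∪q⁻ S B x∈B) })

  decomposition : Decomposition M G ∣ S ∣ (suc k)
  decomposition = record
    { colours = S ; ∣colours∣ = refl ; col = col ; col-∈ = col-∈S ; B = Bᴹ ; B-indep = indBᴹ
    ; class-basis = λ e → split (e ∈? S)
        (λ e∈S → subst (Basis M (E e)) (I₀≡ e∈S) record
          { basis⊆ = I₀⊆E e∈S ; basis-indep = indI₀ e∈S ; basis-spans = proj₂ ∘ ∈span⁻ M ∘ spanning e∈S })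
        -- All colours of elements lie in `S`, so this class is empty.
        (λ e∉S → record
          { basis⊆ = p∩q⊆q Bᴹ (E e) ; basis-indep = ⊆-indep M (p∩q⊆p Bᴹ (E e)) indBᴹ
          ; basis-spans = λ x∈ → contradiction (case ∈cls⁻ G col x∈ of λ { (x∈G , refl) → col-∈S x∈G }) e∉S })
    ; class-rank = λ {e} e∈S → subst (λ ρ → ρ ≡ suc k ⊎ ρ ≡ suc (suc k))
        (trans (sym (∣I₀∣ e∈S)) (cong ∣_∣ (I₀≡ e∈S)))
        ([ inj₁ ∘ cong suc , inj₂ ∘ cong suc ]′ (rankᴺ e∈S))
    ; class-size = λ e∈S → trans (∣E∣ e∈S) (cong (λ X → 2 ^ ∣ X ∣) (I₀≡ e∈S))
    ; class-noclaw = λ _ → E-noclaw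
    }

-- Free contractions and the exceptional case

small-class : ∀ {n} {X : Subset n} → (∀ {x y} → x ∈ X → y ∈ X → x ≡ y) →
              (∣ X ∣ ≡ 0 ⊎ ∣ X ∣ ≡ 1) × ∣ X ∣ + 1 ≡ 2 ^ ∣ X ∣
small-class {n} {X} one = case nonempty? X of λ
  { (no empty) → let eq = trans (cong ∣_∣ (Empty-unique empty)) (∣⊥∣≡0 n) in
      inj₁ eq , subst (λ k → k + 1 ≡ 2 ^ k) (sym eq) refl
  ; (yes (x , x∈)) →
      let eq = trans (cong ∣_∣ (⊆-antisym {i = X} {j = ⁅ x ⁆} (λ y∈ → subst (_∈ ⁅ x ⁆) (one x∈ y∈) (x∈⁅x⁆ x))
              (⁅⁆⊆ x∈))) (∣⁅x⁆∣≡1 x)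
      in inj₂ eq , subst (λ k → k + 1 ≡ 2 ^ k) (sym eq) refl }

module _ {m : ℕ} (M : Matroid) (T : Subset (size M)) (indT : Indep M T) (col : Fin (size M) → Fin m)
         (col-injective : ∀ {x y} → x ∈ T → y ∈ T → col x ≡ col y → x ≡ y) where
  rainbow-class : ∀ {e x y} → x ∈ cls T col e → y ∈ cls T col e → x ≡ y
  rainbow-class x∈ y∈ = case (∈cls⁻ T col x∈ , ∈cls⁻ T col y∈) of λ
      { ((x∈T , p) , (y∈T , q)) → col-injective x∈T y∈T (trans p (sym q)) }

  rainbow-∩ : ∀ e → T ∩ cls T col e ≡ cls T col e
  rainbow-∩ e = ⊆-antisym {i = T ∩ cls T col e} (p∩q⊆q T (cls T col e)) λ x∈ →
      x∈p∩q⁺ (proj₁ (∈cls⁻ T col x∈) , x∈)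

  rainbow-basis : ∀ e → Basis M (cls T col e) (T ∩ cls T col e)
  rainbow-basis e = record
    { basis⊆ = p∩q⊆q T (cls T col e) ; basis-indep = ⊆-indep M (p∩q⊆p T (cls T col e)) indT
    ; basis-spans = λ {x} x∈ → inj₁ (subst (x ∈_) (sym (rainbow-∩ e)) x∈) }

  rainbow-rank : ∀ e → ∣ T ∩ cls T col e ∣ ≡ 0 ⊎ ∣ T ∩ cls T col e ∣ ≡ 1
  rainbow-rank e = subst (λ X → ∣ X ∣ ≡ 0 ⊎ ∣ X ∣ ≡ 1) (sym (rainbow-∩ e)) (proj₁ (small-class rainbow-class))

  rainbow-size : ∀ e → ∣ cls T col e ∣ + 1 ≡ 2 ^ ∣ T ∩ cls T col e ∣
  rainbow-size e = subst (λ X → ∣ cls T col e ∣ + 1 ≡ 2 ^ ∣ X ∣) (sym (rainbow-∩ e))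
      (proj₂ (small-class rainbow-class))

-- Each element receives its own colour; the remaining t - |G| colours stand for geometries of rank
-- 0.
free-decomposition : ∀ M {G} t .{{_ : NonZero t}} → Indep M G → ∣ G ∣ < t → Decomposition M G t 0
free-decomposition M {G} t@(suc _) indG lt =
  case choose G {P = λ x i → ∀ j → enum G j ≡ x → i ≡ inject≤ j (<⇒≤ lt)} (λ _ → zero)
         (λ x∈ → case enum-surjective G x∈ of λ { (i , refl) → inject≤ i (<⇒≤ lt) , λ j eq →
             cong (λ i → inject≤ i (<⇒≤ lt)) (enum-injective G (sym eq)) }) of λ { (col , ok) →
  let inj : ∀ {x y} → x ∈ G → y ∈ G → col x ≡ col y → x ≡ y
      inj x∈ y∈ eq = case (enum-surjective G x∈ , enum-surjective G y∈) of λ { ((i , refl) , (j , refl)) →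
        cong (enum G) (inject≤-injective (<⇒≤ lt) (<⇒≤ lt) i j
            (trans (sym (ok _ x∈ i refl)) (trans eq (ok _ y∈ j refl)))) }
  in record
    { colours = ⊤ ; ∣colours∣ = ∣⊤∣≡n t ; col = col ; col-∈ = λ _ → ∈⊤ ; B = G ; B-indep = indG
    ; class-basis = rainbow-basis M G indG col inj
    ; class-rank = λ {e} _ → rainbow-rank M G indG col inj e
    ; class-size = λ {e} _ → rainbow-size M G indG col inj e
    ; class-noclaw = λ {e} _ {X} claw ∣X∣ → case pair-of ∣X∣ of λ { (a , b , a∈ , b∈ , a≢b , _) →
        a≢b (rainbow-class M G indG col inj (claw⊆ claw a∈) (claw⊆ claw b∈)) } } }

-- Some circuit meets `S` in at least two elements. The whole contraction is stored because it
-- serves twice: to read off the circuits of M, and, when the contraction N of a larger matroid is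
-- of this kind, to find too many disjoint supports.
record Exceptional (M : Matroid) (G : Subset (size M)) (simple : Simple M G) (t : ℕ) : Set where
  field
    S T     : Subset (size M)
    ∣S∣     : ∣ S ∣ ≡ t
    claw    : Claw M G S
    tr      : Transversal M G S T
    noclaw  : NoClaw M G (suc ∣ S ∣)
    tight   : ∣ Contraction.rest M G S T simple claw tr noclaw ∣ ≤ ∣ T ∣
    T-indep : Indep (Contraction.N M G S T simple claw tr) T
    T<t     : ∣ T ∣ < t
    {y}     : Fin (size M)
    y∈      : y ∈ T
    {e₁ e₂} : Fin (size M)
    e₁≢e₂   : e₁ ≢ e₂
    supp₁   : Tight.Supp M G S T simple claw tr noclaw tight e₁ y
    supp₂   : Tight.Supp M G S T simple claw tr noclaw tight e₂ y

module Inductive (M : Matroid) (G S T : Subset (size M)) (simple : Simple M G) (claw : Claw M G S)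
    (tr : Transversal M G S T) (noclaw : NoClaw M G (suc ∣ S ∣))
    (tight : ∣ Contraction.rest M G S T simple claw tr noclaw ∣ ≤ ∣ T ∣) where
  open Contraction M G S T simple claw tr
  private module P = Tight M G S T simple claw tr noclaw

  Supp = P.Supp tight
  Supp? = P.Supp? tight

  module Free (indT : Indep N T) (single : ∀ {y e₁ e₂} → y ∈ T → Supp e₁ y → Supp e₂ y → e₁ ≡ e₂) where
    free-disjoint : ∀ {y z} → y ∈ T → z ∈ T → y ≢ z → ∀ {e} → Supp e y → ¬ Supp e z
    free-disjoint y∈ z∈ y≢z = P.supp-disjoint tight y∈ z∈ y≢z λ x∈ _ _ →
      ⊆-indep M (⊹-lub (⊹-lub (⊹-lub ∈∪ˡ (∈∪ʳ y∈)) (∈∪ʳ z∈)) (∈∪ʳ x∈)) (proj₂ indT)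

    lifted : Decomposition M G ∣ S ∣ 1
    lifted = case choose T {P = λ y e → Supp e y} id (P.supp-nonempty tight) of λ { (col , ok) →
      let inj : ∀ {x y} → x ∈ T → y ∈ T → col x ≡ col y → x ≡ y
          inj {x} {y} x∈ y∈ eq = decidable-stable (x ≟ᶠ y) λ x≢y →
            free-disjoint x∈ y∈ x≢y (ok x x∈) (subst (λ e → Supp e y) (sym eq) (ok y y∈))
      in Step.decomposition M G S T simple claw tr noclaw tight col (λ y∈ → proj₁ (ok _ y∈))
           (λ y∈ supp → single y∈ supp (ok _ y∈)) T indT id
           (rainbow-basis N T indT col inj) 0 (λ {e} _ → rainbow-rank N T indT col inj e)
               (λ {e} _ → rainbow-size N T indT col inj e)
           (inj₂ inj) }

  module Decomposed {k} (D : Decomposition N T ∣ S ∣ (suc k)) where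
    open Decomposition D
    private
      C = cls T col

    class-point : ∀ {i} → i ∈ colours → ∃ λ y → y ∈ C i
    class-point {i} i∈ = case ∣∣>0⇒∈ {p = B ∩ C i} ([ positive , positive ]′ (class-rank i∈)) of λ
        { (y , y∈) → y , p∩q⊆q B (C i) y∈ }
      where
      positive : ∀ {a b} → a ≡ suc b → 0 < a
      positive refl = s≤s z≤n

    -- No class contains both y and z, so the three points meet each class in at most a pair,
    -- independent by `N-simple`.
    two-point : ∀ {y z x} → y ∈ T → z ∈ T → x ∈ T → col y ≢ col z → Indep M (S ⊹ y ⊹ z ⊹ x)
    two-point {y} {z} {x} y∈ z∈ x∈ cy≢cz = ⊆-indep M
      (⊹-lub (⊹-lub (⊹-lub ∈∪ˡ (∈∪ʳ (∈∪ˡ (∈∪ˡ (x∈⁅x⁆ y))))) (∈∪ʳ (∈∪ˡ ∈⊹ʳ))) (∈∪ʳ ∈⊹ʳ))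
      (proj₂ (separated W (⊹-lub (⊹-lub (⁅⁆⊆ y∈) z∈) x∈) λ f → split (col y ≟ᶠ f)
        (λ { refl → ⊆-indep N (λ w∈ → case x∈p∩q⁻ W (C f) w∈ of λ { (w∈W , w∈C) →
            [ (λ w∈yz → [ ∈∪ˡ , (λ { refl → contradiction (sym (proj₂ (∈cls⁻ T col w∈C))) cy≢cz }) ]′
                (∈⊹⁻ ⁅ y ⁆ w∈yz)) , (λ { refl → ∈⊹ʳ }) ]′ (∈⊹⁻ (⁅ y ⁆ ⊹ z) w∈W) })
            (N-simple y∈ x∈) })
        (λ cy≢f → ⊆-indep N (λ w∈ → case x∈p∩q⁻ W (C f) w∈ of λ { (w∈W , w∈C) →
            [ (λ w∈yz → [ (λ w∈y → contradiction
                (trans (cong col (sym (x∈⁅y⁆⇒x≡y y w∈y))) (proj₂ (∈cls⁻ T col w∈C))) cy≢f)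
                        , (λ { refl → ∈∪ˡ (x∈⁅x⁆ z) }) ]′ (∈⊹⁻ ⁅ y ⁆ w∈yz)) , (λ { refl → ∈⊹ʳ }) ]′
                            (∈⊹⁻ (⁅ y ⁆ ⊹ z) w∈W) })
            (N-simple z∈ x∈))))
      where
      W = ⁅ y ⁆ ⊹ z ⊹ x

    different-disjoint : ∀ {y z} → y ∈ T → z ∈ T → col y ≢ col z → ∀ {e} → Supp e y → ¬ Supp e z
    different-disjoint y∈ z∈ cy≢cz = P.supp-disjoint tight y∈ z∈ (cy≢cz ∘ cong col) λ x∈ _ _ →
        two-point y∈ z∈ x∈ cy≢cz

    Rooted : Fin m → Fin (size M) → Set
    Rooted i e = ∃ λ y → y ∈ T × col y ≡ i × Supp e y

    -- `α` picks for each class an element in the support of one of its points. Supports from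
    -- different classes are disjoint, so `α` is injective, and onto `S` because there are |S|
    -- classes. Every support element of y is then some `α j`, and disjointness forces j = col y.
    module Relabel (α : Fin m → Fin (size M)) (ok : ∀ i → i ∈ colours → Rooted i (α i)) where
      α∈S : ∀ {i} → i ∈ colours → α i ∈ S
      α∈S i∈ = case ok _ i∈ of λ { (_ , _ , _ , (e∈ , _)) → e∈ }

      rooted-unique : ∀ {y j} → y ∈ T → j ∈ colours → Supp (α j) y → j ≡ col y
      rooted-unique {y} {j} y∈ j∈ supp = decidable-stable (j ≟ᶠ col y) λ j≢ →
          case ok j j∈ of λ { (z , z∈ , refl , supp′) →
        different-disjoint z∈ y∈ j≢ supp′ supp }

      α-injective : ∀ {i j} → i ∈ colours → j ∈ colours → α i ≡ α j → i ≡ j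
      α-injective {i} {j} i∈ j∈ eq = case ok j j∈ of λ { (z , z∈ , refl , supp) →
        rooted-unique z∈ i∈ (subst (λ e → Supp e z) (sym eq) supp) }

      α-surjective : ∀ {e} → e ∈ S → ∃ λ i → i ∈ colours × α i ≡ e
      α-surjective = ∣∣-surjective {R = λ i e → α i ≡ e} colours S (λ i e → α i ≟ᶠ e)
          (λ i∈ → _ , α∈S i∈ , refl)
        (λ i∈ j∈ p q → α-injective i∈ j∈ (trans p (sym q))) (≤-reflexive (sym ∣colours∣))

      single : ∀ {e y} → y ∈ T → Supp e y → e ≡ α (col y)
      single y∈ supp = case α-surjective (proj₁ supp) of λ
          { (j , j∈ , refl) → cong α (rooted-unique y∈ j∈ supp) }

      col′ : Fin (size M) → Fin (size M)
      col′ = α ∘ col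

      same-class : ∀ {j} → j ∈ colours → C j ≡ cls T col′ (α j)
      same-class j∈ = ⊆-antisym
        (λ x∈ → case ∈cls⁻ T col x∈ of λ { (x∈T , refl) → ∈cls⁺ T col′ x∈T refl })
        (λ x∈ → case ∈cls⁻ T col′ x∈ of λ { (x∈T , eq) → ∈cls⁺ T col x∈T (α-injective (col-∈ x∈T) j∈ eq) })

      transfer : ∀ {ℓ} (Q : Subset (size M) → Set ℓ) → (∀ {j} → j ∈ colours → Q (C j)) → ∀ {e} → e ∈ S →
          Q (cls T col′ e)
      transfer Q q e∈ = case α-surjective e∈ of λ { (j , j∈ , refl) → subst Q (same-class j∈) (q j∈) }

      lifted : Decomposition M G ∣ S ∣ (suc (suc k))
      -- A `Decomposition` does not confine its `B` to the ground set, hence `B ∩ T`.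
      lifted = Step.decomposition M G S T simple claw tr noclaw tight col′ (α∈S ∘ col-∈) single (B ∩ T)
        (⊆-indep N (p∩q⊆p B T) B-indep) (p∩q⊆q B T)
        (λ e → split (e ∈? S) (transfer Basis∩
            (λ {j} _ → subst (Basis N (C j)) (B∩ (C⊆T col)) (class-basis j))) λ e∉ → record
          { basis⊆ = p∩q⊆q (B ∩ T) (cls T col′ e) ; basis-indep = ⊆-indep N
              (p∩q⊆p B T ∘ p∩q⊆p (B ∩ T) (cls T col′ e)) B-indep
          ; basis-spans = λ x∈ → contradiction (case ∈cls⁻ T col′ x∈ of λ { (x∈T , refl) → α∈S (col-∈ x∈T) })
              e∉ })
        (suc k)
        (transfer (λ X → ∣ (B ∩ T) ∩ X ∣ ≡ suc k ⊎ ∣ (B ∩ T) ∩ X ∣ ≡ suc (suc k)) λ j∈ →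
          subst (λ X → ∣ X ∣ ≡ suc k ⊎ ∣ X ∣ ≡ suc (suc k)) (B∩ (C⊆T col)) (class-rank j∈))
        (transfer (λ X → ∣ X ∣ + 1 ≡ 2 ^ ∣ (B ∩ T) ∩ X ∣) λ j∈ →
            trans (class-size j∈) (cong (λ X → 2 ^ ∣ X ∣) (B∩ (C⊆T col))))
        (inj₁ (transfer (λ X → ∃ λ z → z ∈ X) class-point))
        where
        Basis∩ : Subset (size M) → Set
        Basis∩ X = Basis N X ((B ∩ T) ∩ X)
        C⊆T : ∀ {m} (col : Fin (size M) → Fin m) {j} → cls T col j ⊆ T
        C⊆T col = proj₁ ∘ ∈cls⁻ T col
        B∩ : ∀ {X} → X ⊆ T → B ∩ X ≡ (B ∩ T) ∩ X
        B∩ {X} X⊆ = ⊆-antisym {i = B ∩ X} {j = (B ∩ T) ∩ X}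
          (λ x∈ → case x∈p∩q⁻ B X x∈ of λ { (x∈B , x∈X) → x∈p∩q⁺ (x∈p∩q⁺ (x∈B , X⊆ x∈X) , x∈X) })
          (λ x∈ → case x∈p∩q⁻ (B ∩ T) X x∈ of λ { (x∈B , x∈X) → x∈p∩q⁺ (p∩q⊆p B T x∈B , x∈X) })

    lifted : 0 < ∣ S ∣ → Decomposition M G ∣ S ∣ (suc (suc k))
    -- `0<∣S∣` supplies the default value for indices outside `colours`.
    lifted 0<∣S∣ = case choose colours {P = Rooted} (λ _ → proj₁ (∣∣>0⇒∈ {p = S} 0<∣S∣))
        (λ i∈ → case class-point i∈ of λ { (y , y∈C) →
        case ∈cls⁻ T col y∈C of λ { (y∈ , refl) → case P.supp-nonempty tight y∈ of λ
            { (e , supp) → e , y , y∈ , refl , supp } } }) of λ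
      { (α , ok) → Relabel.lifted α ok }

  -- The support of an exceptional point of N has two elements, so the claw and this point are t + 1 points of N
  -- any two of which span a two-point line; their supports in S would be disjoint.
  not-exceptional : ¬ Exceptional N T N-simple ∣ S ∣
  not-exceptional X = contradiction (≤-trans (≤-reflexive (sym (trans (∣⊹∣ X.S y∉S₂) (cong suc X.∣S∣))))
      supports) (<-irrefl refl)
    where
    module X = Exceptional X
    module Q = Tight N T X.S X.T N-simple X.claw X.tr X.noclaw
    module C₂ = Contraction N T X.S X.T N-simple X.claw X.tr
    open X using (y)
    S₂ = X.S
    S₂⊆T = claw⊆ X.claw
    y∈T : y ∈ T
    y∈T = T⊆G X.tr X.y∈
    y∉S₂ : y ∉ S₂
    y∉S₂ = T∌S X.tr X.y∈
    with-root : ∀ {s x} → s ∈ S₂ → x ∈ T → x ≢ y → Indep N (⁅ s ⁆ ⊹ y ⊹ x)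
    with-root {s} {x} s∈ x∈ x≢y = split (x ∈? S₂)
      (λ x∈S₂ → ⊆-indep N (⊹-lub (⊹-lub (⁅⁆⊆ (∈∪ˡ s∈)) ∈⊹ʳ) (∈∪ˡ x∈S₂)) (C₂.indep-S⊹ y∈T))
      λ x∉S₂ → case Q.cover X.tight x∈ x∉S₂ of λ { (w , w∈ , over) → split (w ≟ᶠ y)
        (λ { refl → case over of λ
          { (inj₁ eq) → contradiction eq x≢y
          -- Here x is the partner of y. Of the two support elements at least one differs from s;
          -- omitting it from the claw keeps s and leaves a set independent with y and x.
          ; (inj₂ refl) → split (s ≟ᶠ X.e₁)
              (λ { refl → via X.supp₂ X.e₁≢e₂ })
              (λ s≢e₁ → via X.supp₁ s≢e₁) } })
        (λ w≢y → ⊆-indep N (⊹-lub (⊹-lub (⁅⁆⊆ (∈∪ˡ s∈)) (∈∪ʳ (∈∪ˡ (x∈⁅x⁆ y)))) (∈∪ʳ ∈⊹ʳ))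
          (Q.indep-over X.tight w∈ {W = ⁅ y ⁆} over (w≢y ∘ x∈⁅y⁆⇒x≡y y)
            (⊆-indep N (∪-lub (∈∪ˡ ∘ ∈∪ˡ) (⊹-lub (⁅⁆⊆ ∈⊹ʳ) (∈∪ˡ ∈⊹ʳ))) (T-pair X.tr w∈ X.y∈ w≢y)))) }
      where
      via : ∀ {e} → Q.Supp X.tight e y → s ≢ e → Indep N (⁅ s ⁆ ⊹ y ⊹ Q.pair X.tight y)
      via (_ , ind) s≢e = ⊆-indep N (⊹-mono (⊹-mono (⁅⁆⊆ (∈-⁺ s∈ s≢e)))) ind
    within : ∀ {p q x} → p ∈ S₂ → q ∈ S₂ → x ∈ T → Indep N (⁅ p ⁆ ⊹ q ⊹ x)
    within p∈ q∈ x∈ = ⊆-indep N (⊹-mono (⊹-lub (⁅⁆⊆ p∈) q∈)) (C₂.indep-S⊹ x∈)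
    line : ∀ {p q x} → p ∈ S₂ ⊹ y → q ∈ S₂ ⊹ y → p ≢ q → x ∈ T → x ≢ p → x ≢ q → Indep N (⁅ p ⁆ ⊹ q ⊹ x)
    line {p} {q} p∈ q∈ p≢q x∈ x≢p x≢q = [
        (λ p∈S → [ (λ q∈S → within p∈S q∈S x∈) , (λ { refl → with-root p∈S x∈ x≢q }) ]′ (∈⊹⁻ S₂ q∈))
      , (λ { refl → [ (λ q∈S → ⊆-indep N (⊹-mono (⊹-lub (⁅⁆⊆ ∈⊹ʳ) (∈∪ˡ (x∈⁅x⁆ q)))) (with-root q∈S x∈ x≢p)) ,
          (λ { refl → contradiction refl p≢q }) ]′ (∈⊹⁻ S₂ q∈) }) ]′ (∈⊹⁻ S₂ p∈)
    in-T : ∀ {p} → p ∈ S₂ ⊹ y → p ∈ T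
    in-T = ⊹-lub S₂⊆T y∈T
    supports : ∣ S₂ ⊹ y ∣ ≤ ∣ S ∣
    supports = ∣∣-injective {R = λ p e → Supp e p} (S₂ ⊹ y) S
      (λ p∈ → case P.supp-nonempty tight (in-T p∈) of λ { (e , supp) → e , proj₁ supp , supp })
      (λ {p} {q} p∈ q∈ suppp suppq → decidable-stable (p ≟ᶠ q) λ p≢q →
        P.supp-disjoint tight (in-T p∈) (in-T q∈) p≢q
          (λ x∈ x≢p x≢q → ⊆-indep M (⊹-lub (⊹-lub (⊹-lub ∈∪ˡ (∈∪ʳ (∈∪ˡ (∈∪ˡ (x∈⁅x⁆ p))))) (∈∪ʳ (∈∪ˡ ∈⊹ʳ)))
              (∈∪ʳ ∈⊹ʳ))
            (proj₂ (line p∈ q∈ p≢q x∈ x≢p x≢q))) suppp suppq)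

-- Induction on the rank in steps of t. A contraction of rank below t is free, and the existence of
-- a support with two elements decides between the alternatives; one of larger rank must be
-- decomposed itself, by `not-exceptional`.
extremal : ∀ t .{{_ : NonZero t}} r M {G B} (simple : Simple M G) → Basis M G B → ∣ B ∣ ≡ r →
    NoClaw M G (suc t) → ∣ G ∣ ≡ f r t →
           Decomposition M G t (r / t) ⊎ Exceptional M G simple t
extremal t r = step-rec t Goal small step r
  where
  Goal : ℕ → Set₁
  Goal r = ∀ M {G B} (simple : Simple M G) → Basis M G B → ∣ B ∣ ≡ r → NoClaw M G (suc t) → ∣ G ∣ ≡ f r t →
           Decomposition M G t (r / t) ⊎ Exceptional M G simple t

  free : ∀ M {G B} → Basis M G B → ∣ G ∣ ≤ ∣ B ∣ → Indep M G
  free M bas le = ⊆-indep M (⊆∧∣∣≥⇒⊇ (basis⊆ bas) le) (basis-indep bas)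

  small : ∀ r → r < t → Goal r
  small r r<t M {G} {B} simple bas ∣B∣ noclaw ∣G∣ = inj₁ (subst (Decomposition M G t) (sym (m<n⇒m/n≡0 r<t))
    (free-decomposition M t (free M bas (≤-reflexive (trans ∣G∣≡r (sym ∣B∣))))
        (≤-<-trans (≤-reflexive ∣G∣≡r) r<t)))
    where
    ∣G∣≡r = trans ∣G∣ (f-small r t r<t)

  -- Without a t-claw the bound for t - 1 would apply, and it exceeds f r t by `f-anti`; for t = 1
  -- singletons are claws.
  claw-exists : ∀ t r M {G B} → Simple M G → Basis M G B → .{{_ : NonZero t}} → ∣ B ∣ ≡ r → t ≤ r →
      ∣ G ∣ ≡ f r t → ∃ λ S → Claw M G S × ∣ S ∣ ≡ t
  claw-exists t@(suc t′) r M {G} {B} simple bas ∣B∣ t≤r ∣G∣ = case anySubset?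
      (λ S → Claw? M G S ×-dec (∣ S ∣ ≟ t)) of λ
    { (yes h) → h
    ; (no ¬h) → contradiction (λ {S} c eq → ¬h (S , c , eq)) (has-claw t′ ∣B∣ t≤r ∣G∣) }
    where
    has-claw : ∀ t′ → ∣ B ∣ ≡ r → suc t′ ≤ r → ∣ G ∣ ≡ f r (suc t′) → ¬ NoClaw M G (suc t′)
    has-claw zero ∣B∣ t≤r _ no1 = case ∣∣>0⇒∈ {p = B} (≤-trans t≤r (≤-reflexive (sym ∣B∣))) of λ { (x , x∈B) →
      no1 (singleton-claw M _ simple (basis⊆ bas x∈B)) (∣⁅x⁆∣≡1 x) }
    has-claw (suc t″) refl t≤r ∣G∣ nc = contradiction
        (≤-trans (bound (suc t″) M simple bas nc) (≤-reflexive ∣G∣)) (<⇒≱ (f-anti (suc t″) r t≤r))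

  step : ∀ r → Goal r → Goal (t + r)
  step r ih M {G} {B} simple bas ∣B∣ noclaw ∣G∣ =
    case claw-exists t (t + r) M simple bas ∣B∣ (m≤m+n t r) ∣G∣ of λ { (S , claw , ∣S∣) →
    case transversal M G claw of λ { (T , tr) →
    let open Contraction M G S T simple claw tr using (N) in
    case basis-extend N {G = T} (⊥⊆ {p = T}) (⊥-indep N) of λ
        { (B′ , _ , bas′) → contracted S claw ∣S∣ T tr B′ bas′ } } }
    where
    module _ (S : Subset (size M)) (claw : Claw M G S) (∣S∣ : ∣ S ∣ ≡ t) (T : Subset (size M))
        (tr : Transversal M G S T) where
      open Contraction M G S T simple claw tr hiding (∣G∣)
      nc : NoClaw M G (suc ∣ S ∣)
      nc = subst (NoClaw M G ∘ suc) (sym ∣S∣) noclaw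
      module _ (B′ : Subset (size M)) (bas′ : Basis N T B′) where
        ∣B′∣ : ∣ B′ ∣ ≡ r
        ∣B′∣ = +-cancelˡ-≡ t ∣ B′ ∣ r (trans (cong (_+ ∣ B′ ∣) (sym ∣S∣)) (trans (sym (∣S∪∣ (basis⊆ bas′)))
          (trans (basis-size M (N-basis bas′) bas) ∣B∣)))
        f≤ : f r t ≤ ∣ T ∣
        f≤ = subst (λ r → f r t ≤ ∣ T ∣) ∣B′∣ (bound t N N-simple bas′ (N-noclaw noclaw))
        T+rest : ∣ T ∣ + ∣ rest nc ∣ ≡ f r t + f r t
        T+rest = +-cancelˡ-≡ t _ _ (begin
          t + (∣ T ∣ + ∣ rest nc ∣)      ≡⟨ cong (_+ (∣ T ∣ + ∣ rest nc ∣)) ∣S∣ ⟨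
          ∣ S ∣ + (∣ T ∣ + ∣ rest nc ∣)  ≡⟨ Contraction.∣G∣ M G S T simple claw tr nc ⟨
          ∣ G ∣                          ≡⟨ ∣G∣ ⟩
          f (t + r) t                    ≡⟨ f-step r t ⟩
          t + 2 * f r t                  ≡⟨ cong (λ x → t + (f r t + x)) (+-identityʳ (f r t)) ⟩
          t + (f r t + f r t)            ∎)
          where open ≡-Reasoning
        -- The bound for N gives `T` at least `f r t` elements, and both sets together have exactly
        -- twice that many.
        rest≤f : ∣ rest nc ∣ ≤ f r t
        rest≤f = +-cancelˡ-≤ (f r t) _ _ (≤-trans (+-monoˡ-≤ (∣ rest nc ∣) f≤) (≤-reflexive T+rest))
        tight : ∣ rest nc ∣ ≤ ∣ T ∣
        tight = ≤-trans rest≤f f≤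
        ∣T∣ : ∣ T ∣ ≡ f r t
        ∣T∣ = ≤-antisym (≤-trans (∣T∣≤∣rest∣ nc) rest≤f) f≤

        open Inductive M G S T simple claw tr nc tight

        finish : ∀ {k} → suc (r / t) ≡ k → Decomposition M G ∣ S ∣ k → Decomposition M G t ((t + r) / t)
        finish eq D = subst₂ (Decomposition M G) ∣S∣ (trans (sym eq) (sym ([t+r]/t r t))) D

        contracted : Decomposition M G t ((t + r) / t) ⊎ Exceptional M G simple t
        contracted = split (r <? t)
          (λ r<t →
            let ∣T∣≡r = trans ∣T∣ (f-small r t r<t)
                indT = free N bas′ (≤-reflexive (trans ∣T∣≡r (sym ∣B′∣)))
            in case any? (λ y → (y ∈? T) ×-dec any?
                (λ e₁ → any? λ e₂ → ¬? (e₁ ≟ᶠ e₂) ×-dec Supp? e₁ y ×-dec Supp? e₂ y)) of λ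
              { (yes (y , y∈ , e₁ , e₂ , e₁≢e₂ , supp₁ , supp₂)) → inj₂ record
                  { S = S ; T = T ; ∣S∣ = ∣S∣ ; claw = claw ; tr = tr ; noclaw = nc ; tight = tight ; T-indep
                      = indT
                  ; T<t = ≤-<-trans (≤-reflexive ∣T∣≡r) r<t ; y∈ = y∈ ; e₁≢e₂ = e₁≢e₂ ; supp₁ = supp₁ ; supp₂
                      = supp₂ }
              ; (no ¬h) → inj₁ (finish (cong suc (m<n⇒m/n≡0 r<t)) (Free.lifted indT λ {y} {e₁} {e₂} y∈ s₁ s₂ →
                  decidable-stable (e₁ ≟ᶠ e₂) λ e₁≢e₂ → ¬h (y , y∈ , e₁ , e₂ , e₁≢e₂ , s₁ , s₂))) })
          (λ r≮t → case ih N N-simple bas′ ∣B′∣ (N-noclaw noclaw) ∣T∣ of λ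
            { (inj₁ D) → inj₁ (large (≮⇒≥ r≮t) D)
            ; (inj₂ X) → contradiction (subst (Exceptional N T N-simple) (sym ∣S∣) X) not-exceptional })
          where
          large : t ≤ r → Decomposition N T t (r / t) → Decomposition M G t ((t + r) / t)
          -- From t ≤ r the quotient is a successor, so every summand of N is non-empty.
          large t≤r D with r / t | m≥n⇒m/n>0 {r} {t} t≤r | [t+r]/t r t
          ... | suc k | _ | eq = subst₂ (Decomposition M G) ∣S∣ (sym eq)
            (Decomposed.lifted (subst (λ s → Decomposition N T s (suc k)) (sym ∣S∣) D)
                (≤-trans (>-nonZero⁻¹ t) (≤-reflexive (sym ∣S∣))))

-- The exceptional matroids as sums of coloops and circuits

pointwise-map : ∀ {a b c r} {A : Set a} {B : Set b} {C : Set c} {R : A → C → Set r} {g : A → B} {h : B → C}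
    {xs} →
                (∀ {x} → x ∈ˡ xs → R x (h (g x))) → Pointwise R xs (map h (map g xs))
pointwise-map {xs = []}     p = []
pointwise-map {xs = x ∷ xs} p = p (here refl) ∷ pointwise-map (p ∘ there)

circuit-embedding : ∀ M {C} k → ∣ C ∣ ≡ suc k → ¬ Indep M C → (∀ {z} → z ∈ C → Indep M (C - z)) →
    Embedding (circuit k) M C
circuit-embedding M {C} k ∣C∣ dep ind = subst (λ s → Embedding (U k s) M C) ∣C∣
    (U-embedding M k λ {J} J⊆C → mk⇔ (to J⊆C) (from J⊆C))
  where
  to : ∀ {J} → J ⊆ C → Indep M J → ∣ J ∣ ≤ k
  to {J} J⊆C indJ = ≮⇒≥ λ lt → dep (⊆-indep M (⊆∧∣∣≥⇒⊇ J⊆C (≤-trans (≤-reflexive ∣C∣) lt)) indJ)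
  from : ∀ {J} → J ⊆ C → ∣ J ∣ ≤ k → Indep M J
  from {J} J⊆C le = case ⊈⇒∃ {p = C} {q = J}
      (λ C⊆J → contradiction (≤-trans (≤-reflexive (sym ∣C∣)) (≤-trans (p⊆q⇒∣p∣≤∣q∣ C⊆J) le)) (<-irrefl refl))
      of
    λ { (z , z∈C , z∉J) → ⊆-indep M (λ x∈ → ∈-⁺ (J⊆C x∈) (∈∉⇒≢ x∈ z∉J)) (ind z∈C) }

coloop-embedding : ∀ M {C} → ∣ C ∣ ≡ 1 → Indep M C → Embedding coloop M C
coloop-embedding M {C} ∣C∣ ind = subst (λ s → Embedding (U 1 s) M C) ∣C∣ (U-embedding M 1 λ J⊆C →
  mk⇔ (λ _ → ≤-trans (p⊆q⇒∣p∣≤∣q∣ J⊆C) (≤-reflexive ∣C∣)) (λ _ → ⊆-indep M J⊆C ind))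

-- The colour of a circuit is its element y of `T`, shared by y, `pair y` and the support of y. An
-- element of `S` in no support is its own colour and becomes a coloop. Disjointness of supports
-- makes the colouring well defined.
module Circuits (M : Matroid) (t : ℕ) (simple : Simple M ⊤) (X : Exceptional M ⊤ simple t) where
  open Exceptional X
  open Contraction M ⊤ S T simple claw tr
  private
    module P = Tight M ⊤ S T simple claw tr noclaw
    pair = P.pair tight
    Supp = P.Supp tight
    Over = P.Over tight

    disjoint : ∀ {y z e} → y ∈ T → z ∈ T → Supp e y → Supp e z → y ≡ z
    disjoint {y} {z} y∈ z∈ s s′ = decidable-stable (y ≟ᶠ z) λ y≢z → P.supp-disjoint tight y∈ z∈ y≢z
      (λ x∈ _ _ → ⊆-indep M (⊹-lub (⊹-lub (⊹-lub ∈∪ˡ (∈∪ʳ y∈)) (∈∪ʳ z∈)) (∈∪ʳ x∈)) (proj₂ T-indep)) s s′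

    supporter? : ∀ e → Dec (∃ λ y → y ∈ T × Supp e y)
    supporter? e = any? λ y → (y ∈? T) ×-dec P.Supp? tight e y

    record Colour (x c : Fin (size M)) : Set where
      field
        on-over : ∀ {y} → y ∈ T → Over y x → c ≡ y
        on-supp : ∀ {y} → y ∈ T → Supp x y → c ≡ y
        on-free : x ∈ S → (∀ {y} → y ∈ T → ¬ Supp x y) → c ≡ x
    open Colour

    abstract
      colouring : ∃ λ (g : Fin (size M) → Fin (size M)) → ∀ x → x ∈ ⊤ → Colour x (g x)
      colouring = choose ⊤ {P = Colour} id λ {x} _ → split (x ∈? S)
        (λ x∈S → case supporter? x of λ
          { (yes (y , y∈ , supp)) → y , record
              { on-over = λ z∈ o → contradiction x∈S (P.over-∉S tight z∈ o)
              ; on-supp = λ z∈ s → disjoint y∈ z∈ supp s ; on-free = λ _ none → contradiction supp (none y∈) }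
          ; (no ¬h) → x , record
              { on-over = λ z∈ o → contradiction x∈S (P.over-∉S tight z∈ o)
              ; on-supp = λ z∈ s → contradiction (_ , z∈ , s) ¬h ; on-free = λ _ _ → refl } })
        (λ x∉S → case P.cover tight ∈⊤ x∉S of λ { (y , y∈ , o) → y , record
              { on-over = λ z∈ o′ → P.over-unique tight y∈ z∈ o o′
              ; on-supp = λ _ s → contradiction (proj₁ s) x∉S ; on-free = λ x∈S _ → contradiction x∈S x∉S } })

    col : Fin (size M) → Fin (size M)
    col = proj₁ colouring

    colour : ∀ x → Colour x (col x)
    colour x = proj₂ colouring x ∈⊤

    C : Fin (size M) → Subset (size M)
    C = cls ⊤ col

    Free? : Decidable (λ e → e ∈ S × ¬ (∃ λ y → y ∈ T × Supp e y))
    Free? e = (e ∈? S) ×-dec ¬? (supporter? e)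

    F : Subset (size M)
    F = ⟪ Free? ⟫

    data View (x : Fin (size M)) : Set where
      free : x ∈ F → View x
      supp : ∀ {y} → y ∈ T → Supp x y → View x
      over : ∀ {y} → y ∈ T → Over y x → View x

    view : ∀ x → View x
    view x = split (x ∈? S)
      (λ x∈S → case supporter? x of λ { (yes (y , y∈ , s)) → supp y∈ s ; (no ¬h) →
          free (∈⟪⟫⁺ Free? (x∈S , ¬h)) })
      (λ x∉S → case P.cover tight ∈⊤ x∉S of λ { (y , y∈ , o) → over y∈ o })

    col-free : ∀ {x} → x ∈ F → col x ≡ x
    col-free {x} x∈ = case ∈⟪⟫⁻ Free? x∈ of λ { (x∈S , none) → on-free (colour x) x∈S λ y∈ s →
        none (_ , y∈ , s) }

    col-supp : ∀ {x y} → y ∈ T → Supp x y → col x ≡ y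
    col-supp = on-supp (colour _)

    col-over : ∀ {x y} → y ∈ T → Over y x → col x ≡ y
    col-over = on-over (colour _)

    F∌T : ∀ {x} → x ∈ F → x ∉ T
    F∌T x∈F x∈T = T∌S tr x∈T (proj₁ (∈⟪⟫⁻ Free? x∈F))

    C-free : ∀ {x c} → c ∈ F → x ∈ C c → x ≡ c
    C-free {x} c∈ x∈ = let eq = proj₂ (∈cls⁻ ⊤ col x∈) in case view x of λ
      { (free x∈F) → trans (sym (col-free x∈F)) eq
      ; (supp y∈ s) → contradiction (subst (_∈ T) (trans (sym (col-supp y∈ s)) eq) y∈) (F∌T c∈)
      ; (over y∈ o) → contradiction (subst (_∈ T) (trans (sym (col-over y∈ o)) eq) y∈) (F∌T c∈) }

    data Circuit-view (y x : Fin (size M)) : Set where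
      in-supp : Supp x y → Circuit-view y x
      is-base : x ≡ y → Circuit-view y x
      is-pair : x ≡ pair y → Circuit-view y x

    C-circuit : ∀ {x y} → y ∈ T → x ∈ C y → Circuit-view y x
    C-circuit {x} {y} y∈ x∈ = let eq = proj₂ (∈cls⁻ ⊤ col x∈) in case view x of λ
      { (free x∈F) → contradiction (subst (_∈ T) (trans (sym eq) (col-free x∈F)) y∈) (F∌T x∈F)
      ; (supp z∈ s) → in-supp (subst (Supp x) (trans (sym (col-supp z∈ s)) eq) s)
      ; (over z∈ o) → [ is-base , is-pair ]′ (subst (λ z → Over z x) (trans (sym (col-over z∈ o)) eq) o) }

    y∈C : ∀ {y} → y ∈ T → y ∈ C y
    y∈C y∈ = ∈cls⁺ ⊤ col ∈⊤ (col-over y∈ (inj₁ refl))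

    pair∈C : ∀ {y} → y ∈ T → pair y ∈ C y
    pair∈C y∈ = ∈cls⁺ ⊤ col ∈⊤ (col-over y∈ (inj₂ refl))

    supp∈C : ∀ {y e} → y ∈ T → Supp e y → e ∈ C y
    supp∈C y∈ s = ∈cls⁺ ⊤ col ∈⊤ (col-supp y∈ s)

    -- `supp-outside` would give a support element of y outside its class, but the class contains
    -- them all.
    pair-dep : ∀ {y} → y ∈ T → ¬ Indep M (((S ∪ T) ∩ C y) ⊹ pair y)
    pair-dep {y} y∈ ind = case P.supp-outside tight {J = S ∩ C y} y∈ (p∩q⊆p S (C y)) (⊆-indep M
        (⊹-mono (⊹-lub (λ x∈ → case x∈p∩q⁻ S (C y) x∈ of λ { (x∈S , x∈C) → x∈p∩q⁺ (∈∪ˡ x∈S , x∈C) })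
            (x∈p∩q⁺ (∈∪ʳ y∈ , y∈C y∈)))) ind) of
      λ { (e , s , e∉) → e∉ (x∈p∩q⁺ (proj₁ s , supp∈C y∈ s)) }

    separated : Separated M ⊤ col
    separated = spanning⇒separated M col (proj₂ T-indep) λ {x} {c} x∈ → case view x of λ
      { (free x∈F) → inj₁ (x∈p∩q⁺ (∈∪ˡ (proj₁ (∈⟪⟫⁻ Free? x∈F)) , x∈))
      ; (supp _ s) → inj₁ (x∈p∩q⁺ (∈∪ˡ (proj₁ s) , x∈))
      ; (over y∈ (inj₁ refl)) → inj₁ (x∈p∩q⁺ (∈∪ʳ y∈ , x∈))
      ; (over {y} y∈ (inj₂ refl)) → inj₂ (subst (λ c → ¬ Indep M (((S ∪ T) ∩ C c) ⊹ pair y))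
          (trans (sym (col-over y∈ (inj₂ refl))) (proj₂ (∈cls⁻ ⊤ col x∈))) (pair-dep y∈)) }

    -- Without y or its partner, what remains lies in `S` and one further element, independent by
    -- the claw; without a support element, independence is part of `Supp`.
    circuit-indep : ∀ {y z} → y ∈ T → z ∈ C y → Indep M (C y - z)
    circuit-indep {y} {z} y∈ z∈ = case C-circuit y∈ z∈ of λ
      { (is-base refl) → ⊆-indep M
          (λ x∈ → case ∈-⁻ {p = C y} x∈ of λ { (x∈C , x≢) → case C-circuit y∈ x∈C of λ
          { (in-supp s) → ∈∪ˡ (proj₁ s) ; (is-base eq) → contradiction eq x≢ ; (is-pair refl) → ∈⊹ʳ } })
              (indep-S⊹ (P.pair-∈G tight y∈))
      ; (is-pair refl) → ⊆-indep M
          (λ x∈ → case ∈-⁻ {p = C y} x∈ of λ { (x∈C , x≢) → case C-circuit y∈ x∈C of λ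
          { (in-supp s) → ∈∪ˡ (proj₁ s) ; (is-base refl) → ∈⊹ʳ ; (is-pair eq) → contradiction eq x≢ } })
              (indep-S⊹ ∈⊤)
      ; (in-supp s) → ⊆-indep M (λ x∈ → case ∈-⁻ {p = C y} x∈ of λ { (x∈C , x≢) → case C-circuit y∈ x∈C of λ
          { (in-supp s′) → ∈∪ˡ (∈∪ˡ (∈-⁺ (proj₁ s′) x≢)) ; (is-base refl) → ∈∪ˡ ∈⊹ʳ ; (is-pair refl) → ∈⊹ʳ }
              }) (proj₂ s) }

    circuit-rank : Fin (size M) → ℕ
    circuit-rank y = ∣ C y - y ∣

    circuit-class : ∀ {y} → y ∈ T → Embedding (circuit (circuit-rank y)) M (C y)
    circuit-class y∈ = circuit-embedding M _ (∣-∣ (y∈C y∈))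
      (λ ind → pair-dep y∈ (⊆-indep M (⊹-lub (p∩q⊆q (S ∪ T) (C _)) (pair∈C y∈)) ind)) (circuit-indep y∈)

    free-class : ∀ {e} → e ∈ F → Embedding coloop M (C e)
    free-class {e} e∈ = subst (Embedding coloop M)
        (⊆-antisym {i = ⁅ e ⁆} {j = C e} (⁅⁆⊆ (∈cls⁺ ⊤ col ∈⊤ (col-free e∈)))
        (λ x∈ → subst (_∈ ⁅ e ⁆) (sym (C-free e∈ x∈)) (x∈⁅x⁆ e)))
      (coloop-embedding M (∣⁅x⁆∣≡1 e) (indep-⁅⁆ M simple ∈⊤))

    coloured : ∀ x → col x ∈ˡ elements F ++ elements T
    coloured x = case view x of λ
      { (free x∈F) → ∈-++⁺ˡ (∈-elements⁺ F (subst (_∈ F) (sym (col-free x∈F)) x∈F))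
      ; (supp y∈ s) → ∈-++⁺ʳ (elements F) (∈-elements⁺ T (subst (_∈ T) (sym (col-supp y∈ s)) y∈))
      ; (over y∈ o) → ∈-++⁺ʳ (elements F) (∈-elements⁺ T (subst (_∈ T) (sym (col-over y∈ o)) y∈)) }

  ks : List ℕ
  ks = map circuit-rank (elements T)

  length-ks : length ks ≡ ∣ T ∣
  length-ks = trans (length-map circuit-rank (elements T)) (length-elements T)

  coloops : ℕ
  coloops = length (elements F)

  isomorphism : M ≅ ⨁ (replicate coloops coloop ++ map circuit ks)
  isomorphism = embedding⇒≅ (⨁-embedding M ⊤ col separated
    (Unique.++⁺ (elements-unique F) (elements-unique T) λ
        { (p , q) → F∌T (∈-elements⁻ F p) (∈-elements⁻ T q) })
    (λ {x} _ → coloured x)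
    (++⁺ (pointwise-replicate (free-class ∘ ∈-elements⁻ F)) (pointwise-map (circuit-class ∘ ∈-elements⁻ T))))

  -- The class of the distinguished y contains y, `pair y` and two support elements.
  not-all-triangles : ¬ All (λ k → size (circuit k) ≡ 3) ks
  not-all-triangles all = contradiction (≤-trans four (≤-reflexive ∣C∣≡3)) λ { (s≤s (s≤s (s≤s ()))) }
    where
    ∣C∣≡3 : ∣ C y ∣ ≡ 3
    ∣C∣≡3 = trans (∣-∣ (y∈C y∈)) (All.lookup all (∈-map⁺ circuit-rank (∈-elements⁺ T y∈)))
    S∌ : ∀ {e z} → e ∈ S → z ∉ S → e ≢ z
    S∌ = ∈∉⇒≢
    four : 4 ≤ ∣ C y ∣
    four = begin
      4                                    ≡⟨ cong (2 +_)
          (trans (∣⊹∣ ⁅ y ⁆ (λ p∈ → P.pair-≢ tight y∈ (x∈⁅y⁆⇒x≡y y p∈))) (cong suc (∣⁅x⁆∣≡1 y))) ⟨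
      2 + ∣ ⁅ y ⁆ ⊹ pair y ∣               ≡⟨ cong suc
          (∣⊹∣ (⁅ y ⁆ ⊹ pair y) (∉⊹ (λ e∈ → S∌ (proj₁ supp₁) (T∌S tr y∈) (x∈⁅y⁆⇒x≡y y e∈))
          (S∌ (proj₁ supp₁) (P.pair-∉S tight y∈)))) ⟨
      1 + ∣ ⁅ y ⁆ ⊹ pair y ⊹ e₁ ∣          ≡⟨ ∣⊹∣ (⁅ y ⁆ ⊹ pair y ⊹ e₁)
          (∉⊹ (∉⊹ (λ e∈ → S∌ (proj₁ supp₂) (T∌S tr y∈) (x∈⁅y⁆⇒x≡y y e∈))
          (S∌ (proj₁ supp₂) (P.pair-∉S tight y∈))) (e₁≢e₂ ∘ sym)) ⟨
      ∣ ⁅ y ⁆ ⊹ pair y ⊹ e₁ ⊹ e₂ ∣         ≤⟨ p⊆q⇒∣p∣≤∣q∣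
          (⊹-lub (⊹-lub (⊹-lub (⁅⁆⊆ (y∈C y∈)) (pair∈C y∈)) (supp∈C y∈ supp₁)) (supp∈C y∈ supp₂)) ⟩
      ∣ C y ∣                              ∎
      where open ≤-Reasoning

  -- `T` is a basis of N, so its size, which is the number of circuits, is r - t.
  rank-T : ∀ {B} → Basis M ⊤ B → ∣ B ∣ ≡ t + ∣ T ∣
  rank-T bas = trans (basis-size M bas
      (N-basis record { basis⊆ = id ; basis-indep = T-indep ; basis-spans = inj₁ }))
    (trans (∣S∪∣ id) (cong (_+ ∣ T ∣) ∣S∣))

  0<∣T∣ : 0 < ∣ T ∣
  0<∣T∣ = ≤-trans (s≤s z≤n) (≤-reflexive (sym (∣-∣ y∈)))

-- Comparison with rank, flats and circuits

module _ (M : Matroid) where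
  private variable
    I X : Subset (size M)

  ∣indep∣≤rankOf : I ⊆ X → Indep M I → ∣ I ∣ ≤ rankOf M X
  ∣indep∣≤rankOf {I} {X} I⊆X ind = All.lookup (xs≤max 0 (map ∣_∣ (List.filter P? (subsets (size M)))))
    (∈-map⁺ ∣_∣ (∈-filter⁺ P? (∈-bitVectors I) ((λ {x} → I⊆X {x}) , ind)))
    where P? = λ I → (I ⊆? X) ×-dec Indep? M I

  rankOf≤ : ∀ {k} → (∀ {I} → I ⊆ X → Indep M I → ∣ I ∣ ≤ k) → rankOf M X ≤ k
  rankOf≤ {X} {k} h = max≤v⁺ z≤n (All.tabulate λ {j} j∈ → case ∈-map⁻ ∣_∣ j∈ of λ { (I , I∈ , eq) →
    case ∈-filter⁻ P? {xs = subsets (size M)} I∈ of λ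
        { (_ , I⊆X , ind) → ≤-trans (≤-reflexive eq) (h I⊆X ind) } })
    where P? = λ I → (I ⊆? X) ×-dec Indep? M I

  rank-basis : ∀ {B} → Basis M ⊤ B → rank M ≡ ∣ B ∣
  rank-basis bas = ≤-antisym (rankOf≤ λ I⊆ ind → basis-bound M bas I⊆ ind)
      (∣indep∣≤rankOf ⊆⊤ (basis-indep bas))

  claw⇒isClaw : ∀ {S} → Claw M ⊤ S → IsClaw M S
  claw⇒isClaw {S} c = (λ e e∉ → ≤-trans (s≤s (rankOf≤ λ I⊆ _ → p⊆q⇒∣p∣≤∣q∣ I⊆))
    (≤-trans (≤-reflexive (sym (∣⊹∣ S e∉))) (∣indep∣≤rankOf id (claw-ext c ∈⊤ e∉)))) , claw-indep c

  -- A dependent singleton is a circuit of size one; once singletons are independent, a dependent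
  -- pair is a circuit of size at most two.
  isSimple⇒simple : IsSimple M → Simple M ⊤
  isSimple⇒simple isSimple {x} {y} _ _ = decidable-stable (Indep? M (⁅ x ⁆ ⊹ y)) λ dep →
    contradiction (isSimple (⁅ x ⁆ ⊹ y) (dep , λ {D} → proper {D}))
        (<⇒≱ (s≤s (≤-trans (∣∪∣≤ ⁅ x ⁆ ⁅ y ⁆) (≤-reflexive (cong₂ _+_ (∣⁅x⁆∣≡1 x) (∣⁅x⁆∣≡1 y))))))
    where
    point : ∀ z → Indep M ⁅ z ⁆
    point z = decidable-stable (Indep? M ⁅ z ⁆) λ dep → contradiction
      (isSimple ⁅ z ⁆ (dep , λ { {D} (D⊆ , w , w∈ , w∉) → ⊆-indep M (λ {v} v∈ → contradiction
         (subst (_∈ D) (trans (x∈⁅y⁆⇒x≡y z (D⊆ v∈)) (sym (x∈⁅y⁆⇒x≡y z w∈))) v∈) w∉) (⊥-indep M) }))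
      (<⇒≱ (s≤s (≤-trans (≤-reflexive (∣⁅x⁆∣≡1 z)) (s≤s z≤n))))
    proper : ∀ {D} → (D ⊆ ⁅ x ⁆ ⊹ y × ∃ λ w → w ∈ ⁅ x ⁆ ⊹ y × w ∉ D) → Indep M D
    proper {D} (D⊆ , w , w∈ , w∉) = [
        (λ w∈x → ⊆-indep M (λ v∈ →
        [ (λ v∈x → contradiction (subst (_∈ D) (trans (x∈⁅y⁆⇒x≡y x v∈x) (sym (x∈⁅y⁆⇒x≡y x w∈x))) v∈) w∉)
                                        , (λ { refl → x∈⁅x⁆ y }) ]′ (∈⊹⁻ ⁅ x ⁆ (D⊆ v∈))) (point y))
      , (λ { refl → ⊆-indep M (λ v∈ → [ id , (λ { refl → contradiction v∈ w∉ }) ]′ (∈⊹⁻ ⁅ x ⁆ (D⊆ v∈)))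
          (point x) }) ]′ (∈⊹⁻ ⁅ x ⁆ w∈)

theorem3p3 : (t : ℕ) .{{_ : NonZero t}} (r : ℕ) (M : Matroid) →
    IsSimple M → rank M ≡ r → ¬ HasClaw M (suc t) →
    (f r t ≤ size M) ×
    (size M ≡ f r t →
    (M ≅ 𝐌 r t) ⊎
    (t < r × r < 2 * t ×
    ∃₂ λ c ks → length ks ≡ r ∸ t ×
    ¬ All (λ k → size (circuit k) ≡ 3) ks ×
    M ≅ ⨁ (replicate c coloop ++ map circuit ks)))
theorem3p3 t r M isSimple rank≡r ¬hasClaw =
  case basis-extend M {G = ⊤} (⊥⊆ {p = ⊤}) (⊥-indep M) of λ { (B , _ , bas) →
  let ∣B∣≡r = trans (sym (rank-basis M bas)) rank≡r in
  subst₂ (λ r n → f r t ≤ n) ∣B∣≡r (∣⊤∣≡n (size M)) (bound t M simple bas noclaw) ,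
  λ size≡f → case extremal t r M simple bas ∣B∣≡r noclaw (trans (∣⊤∣≡n (size M)) size≡f) of λ
    { (inj₁ D) → inj₁ (decomposition⇒≅ M r t simple D size≡f)
    ; (inj₂ X) → inj₂ (exceptional X (trans (sym ∣B∣≡r) (Circuits.rank-T M t simple X bas))) } }
  where
  simple = isSimple⇒simple M isSimple
  noclaw : NoClaw M ⊤ (suc t)
  noclaw {S} c ∣S∣ = ¬hasClaw (S , claw⇒isClaw M c , ∣S∣)
  exceptional : (X : Exceptional M ⊤ simple t) → r ≡ t + ∣ Exceptional.T X ∣ → t < r × r < 2 * t ×
    ∃₂ λ c ks → length ks ≡ r ∸ t × ¬ All (λ k → size (circuit k) ≡ 3) ks × M ≅ ⨁
        (replicate c coloop ++ map circuit ks)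
  exceptional X refl =
    -- Both inequalities come from 0 < |T| < t, as r is t + |T|.
    ≤-trans (≤-reflexive (+-comm 1 t)) (+-monoʳ-≤ t 0<∣T∣) ,
    +-monoʳ-< t (≤-trans T<t (≤-reflexive (sym (+-identityʳ t)))) ,
    coloops , ks , trans length-ks (sym (m+n∸m≡n t ∣ T ∣)) , not-all-triangles , isomorphism
    where
    open Exceptional X using (T; T<t)
    open Circuits M t simple X
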